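{- Let $\mathcal{D}=(\mathcal{P},\mathcal{B})$ be a $(v,k,\lambda)$ symmetric design with $k>\lambda(\lambda-2)$, and let $G$ be a flag-transitive automorphism group of $\mathcal{D}$. Then one of the following holds: (a) $G$ is point-primitive, and as a primitive permutation group on $\mathcal{P}$ it is of affine type or of almost simple type; (b) $G$ is point-imprimitive and $(v,k,\lambda)=(\lambda^2(\lambda+2),\lambda(\lambda+1),\lambda)$. Moreover, if $G$ preserves a system of imprimitivity on $\mathcal{P}$ consisting of $d$ classes of size $c$, then there is a constant $\ell$ such that $|B\cap\Delta|\in\{0,\ell\}$ for each block $B\in\mathcal{B}$ and each imprimitivity class $\Delta$, and $(c,d,\ell)=(\lambda^2,\lambda+2,\lambda)$ or $(c,d,\ell)=(\lambda+2,\lambda^2,2)$.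
   Context: A $2$-$(v,k,\lambda)$ design is a finite incidence structure $\mathcal{D}=(\mathcal{P},\mathcal{B})$ consisting of a set $\mathcal{P}$ of $v$ points and a set $\mathcal{B}$ of $k$-subsets of $\mathcal{P}$ (blocks) such that any two distinct points are contained in exactly $\lambda$ blocks; it is assumed that $2\le k<v$ and $\lambda\geq 1$. It is called a $(v,k,\lambda)$ symmetric design if the number of blocks equals $v$. An automorphism group $G$ of $\mathcal{D}$ is a permutation group on $\mathcal{P}$ preserving $\mathcal{B}$. It is flag-transitive if it acts transitively on the set of flags, i.e. pairs $(\alpha,B)$ with $\alpha\in\mathcal{P}$, $B\in\mathcal{B}$, $\alpha\in B$. It is point-primitive (point-imprimitive) if it acts primitively (imprimitively) on $\mathcal{P}$. A system of imprimitivity is a $G$-invariant partition of $\mathcal{P}$ into $d$ classes of equal size $c$ with $c,d>1$. A finite primitive permutation group $G$ is of affine type if it has an elementary abelian regular normal subgroup, and of almost simple type if its socle is a non-abelian simple group $T$ (so $T\le G\le \mathrm{Aut}(T)$). -}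

module Defs where

open import Data.Fin using (Fin)
open import Data.Fin.Permutation using (Permutation′; _⟨$⟩ʳ_; _⟨$⟩ˡ_; _≈_; id; flip; _∘ₚ_)
open import Data.Fin.Subset using (Subset; _∈_; ∣_∣)
open import Data.Fin.Subset.Properties using (_∈?_)
open import Data.List using (List; length; filter)
open import Data.List.Relation.Unary.Unique.Propositional using (Unique)
open import Data.Nat using (ℕ; zero; suc; _≤_; _<_)
open import Data.Nat.Primality using (Prime)
open import Data.Product using (Σ-syntax; ∃-syntax; ∃!; _×_)
open import Data.Sum using (_⊎_)
open import Level using (0ℓ)
open import Relation.Binary.PropositionalEquality using (_≡_; _≢_)
open import Relation.Nullary using (¬_)
open import Relation.Nullary.Decidable using (_×-dec_)
open import Relation.Unary using (Pred; Decidable)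
import Data.List.Membership.Propositional as List

-- Point set Fin v.  The block set is a duplicate-free list, whose order is irrelevant.
record Design (v k λ′ : ℕ) : Set where
  field
    blocks       : List (Subset v)
    distinct     : Unique blocks
    block-size   : ∀ {B} → B List.∈ blocks → ∣ B ∣ ≡ k
    pair-blocks  : ∀ {x y : Fin v} → x ≢ y →
                   length (filter (λ B → (x ∈? B) ×-dec (y ∈? B)) blocks) ≡ λ′
    2≤k          : 2 ≤ k
    k<v          : k < v
    1≤λ          : 1 ≤ λ′

open Design public using (blocks)

Symmetric : ∀ {v k λ′} → Design v k λ′ → Set
Symmetric {v} D = length (blocks D) ≡ v

-- A subgroup of Sym (Fin v).  Permutations are compared pointwise (_≈_), so membership must
-- respect _≈_; decidable membership makes G a finite subset of Sym (Fin v) constructively.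
record PermGroup (v : ℕ) : Set₁ where
  field
    Member     : Pred (Permutation′ v) 0ℓ
    member?    : Decidable Member
    resp       : ∀ {g h} → g ≈ h → Member g → Member h
    id-closed  : Member id
    ∘-closed   : ∀ {g h} → Member g → Member h → Member (g ∘ₚ h)
    inv-closed : ∀ {g} → Member g → Member (flip g)

infix 4 _∈ᴳ_ _⊆ᴳ_ _⊴_

_∈ᴳ_ : ∀ {v} → Permutation′ v → PermGroup v → Set
g ∈ᴳ G = PermGroup.Member G g

_⊆ᴳ_ : ∀ {v} → PermGroup v → PermGroup v → Set
H ⊆ᴳ G = ∀ {g} → g ∈ᴳ H → g ∈ᴳ G

_⊴_ : ∀ {v} → PermGroup v → PermGroup v → Set
N ⊴ G = N ⊆ᴳ G × (∀ {g n} → g ∈ᴳ G → n ∈ᴳ N → flip g ∘ₚ n ∘ₚ g ∈ᴳ N)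

Trivial : ∀ {v} → PermGroup v → Set
Trivial G = ∀ {g} → g ∈ᴳ G → g ≈ id

Abelian : ∀ {v} → PermGroup v → Set
Abelian G = ∀ {g h} → g ∈ᴳ G → h ∈ᴳ G → (g ∘ₚ h) ≈ (h ∘ₚ g)

Simple : ∀ {v} → PermGroup v → Set₁
Simple T = ¬ Trivial T × (∀ N → N ⊴ T → Trivial N ⊎ T ⊆ᴳ N)

power : ∀ {v} → Permutation′ v → ℕ → Permutation′ v
power g zero    = id
power g (suc n) = g ∘ₚ power g n

ElementaryAbelian : ∀ {v} → PermGroup v → Set
ElementaryAbelian N = Abelian N × (∃[ p ] (Prime p × (∀ {g} → g ∈ᴳ N → power g p ≈ id)))

MinimalNormal : ∀ {v} → PermGroup v → PermGroup v → Set₁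
MinimalNormal N G = N ⊴ G × ¬ Trivial N × (∀ M → M ⊴ G → M ⊆ᴳ N → Trivial M ⊎ N ⊆ᴳ M)

-- S is the subgroup generated by the minimal normal subgroups of G.
IsSocle : ∀ {v} → PermGroup v → PermGroup v → Set₁
IsSocle S G = (∀ N → MinimalNormal N G → N ⊆ᴳ S)
            × (∀ H → (∀ N → MinimalNormal N G → N ⊆ᴳ H) → S ⊆ᴳ H)

Transitive : ∀ {v} → PermGroup v → Set
Transitive G = ∀ x y → ∃[ g ] (g ∈ᴳ G × g ⟨$⟩ʳ x ≡ y)

Regular : ∀ {v} → PermGroup v → Set
Regular G = Transitive G × (∀ {g} → g ∈ᴳ G → ∀ x → g ⟨$⟩ʳ x ≡ x → g ≈ id)

-- The image g(B): a point y lies in it iff g⁻¹(y) lies in B.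
image : ∀ {v} → Permutation′ v → Subset v → Subset v
image g B = tabulate (λ y → lookup B (g ⟨$⟩ˡ y))
  where open import Data.Vec using (tabulate; lookup)

record SystemOfImprimitivity {v} (G : PermGroup v) (c d : ℕ) : Set where
  field
    class      : Fin d → Subset v
    partition  : ∀ x → ∃! _≡_ (λ i → x ∈ class i)
    class-size : ∀ i → ∣ class i ∣ ≡ c
    invariant  : ∀ {g} → g ∈ᴳ G → ∀ i → ∃[ j ] image g (class i) ≡ class j
    1<c        : 1 < c
    1<d        : 1 < d

open SystemOfImprimitivity public using (class)

Primitive : ∀ {v} → PermGroup v → Set
Primitive G = Transitive G × (∀ c d → ¬ SystemOfImprimitivity G c d)

Imprimitive : ∀ {v} → PermGroup v → Set
Imprimitive G = Transitive G × (∃[ c ] ∃[ d ] SystemOfImprimitivity G c d)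

AffineType : ∀ {v} → PermGroup v → Set₁
AffineType {v} G = Σ[ N ∈ PermGroup v ] (N ⊴ G × ElementaryAbelian N × Regular N)

AlmostSimpleType : ∀ {v} → PermGroup v → Set₁
AlmostSimpleType {v} G = Σ[ T ∈ PermGroup v ] (IsSocle T G × Simple T × ¬ Abelian T)

IsAutomorphismGroup : ∀ {v k λ′} → Design v k λ′ → PermGroup v → Set
IsAutomorphismGroup D G = ∀ {g B} → g ∈ᴳ G → B List.∈ blocks D → image g B List.∈ blocks D

FlagTransitive : ∀ {v k λ′} → Design v k λ′ → PermGroup v → Set
FlagTransitive D G =
  ∀ {x y B C} → B List.∈ blocks D → x ∈ B → C List.∈ blocks D → y ∈ C →
  ∃[ g ] (g ∈ᴳ G × g ⟨$⟩ʳ x ≡ y × image g B ≡ C)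

{-# OPTIONS --safe #-}
module Submission where

-- For a G_α-invariant set Γ not containing α and a block B through α, flag-transitivity gives
-- k |B ∩ Γ| = λ |Γ|.  Hence k₀ = k / gcd(k, λ) divides |Γ|; moreover k₀ is prime to v and the
-- hypothesis k > λ(λ - 2) gives v < (k₀ + 1)³.
--
-- If G preserves classes Δ of size c, then Γ = Δ ∖ {α} shows |B ∩ Δ| ∈ {0, ℓ} with
-- k (ℓ - 1) = λ (c - 1).  Together with k (k - 1) = λ (v - 1) this leaves the two families and
-- three sporadic triples, which violate ℓ ∣ k or ℓ ∣ c λ.
--
-- If G is primitive, let N be a nonabelian minimal normal subgroup and suppose that N is not
-- simple or that C_G(N) ≠ 1.  One of two things happens.
--
-- Either N_α splits along a family of b ≥ 2 commuting conjugate normal subgroups K of N.  Then the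
-- points form a grid with v = w ^ b, and the b lines through α yield k A = λ b (w - 1), which has
-- solutions only for b = 2 and w ∈ {4, 9, 11, 21}.  Counting the lines that meet a block excludes
-- 9, 11 and 21, and a nonabelian simple group cannot act faithfully on the 4 points of a line.
--
-- Or D = N_α is simple and v = |D| ^ e.  Then |X| ^ e ≡ 1 (mod k₀) for every X ≤ D whose
-- G_α-conjugates are D-conjugates.  Subgroups X of least order among those of index prime to q
-- have this property (they replace Sylow subgroups), and so do their centres; by the bound on v
-- they are abelian and D is the product of two of them, contradicting Itô's theorem.

-- Maximality of G_α enters only in this form: a subgroup normalised by G_α lies in G_α or is
-- transitive. Applied to the product of the projections of N_α to the simple factors of N, it
-- separates product actions (including N_α = 1, the twisted wreath type) from the case where N_α
-- projects onto every factor; the latter is again a grid (compound diagonal type) or a single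
-- diagonal.
--
-- In the diagonal case nothing bounds Out(D) without the classification of simple groups, and the
-- G_α-conjugates of a subgroup of D need not be D-conjugates. So the congruence is available only
-- for subgroups to which a Frattini argument applies. A divisor j > 1 of |D| with j^e ≡ 1 (mod k₀)
-- has j^e > k₀, and the bound on v leaves no room for three such factors; this replaces all finer
-- information on D.
--
-- A property of subgroups need not be decidable, so subgroups of least order are obtained only
-- inside refutations. The minimal normal subgroup that the conclusion has to exhibit is found by
-- searching subsets.

open import Defs
open import Algebra.Bundles using (Group)
import Algebra.Properties.Group as GroupProperties
open import Algebra.Structures using (IsGroup)
open import Data.Bool using (Bool; true; false; if_then_else_; not; _∧_) renaming (T to IsTrue)
open import Data.Empty using (⊥; ⊥-elim)
open import Data.Fin using (Fin; zero; suc; toℕ; fromℕ<; cast; combine; finToFun; funToFin)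
open import Data.Fin.Permutation using (Permutation′; permutation; _⟨$⟩ʳ_; _⟨$⟩ˡ_; _≈_; flip; _∘ₚ_)
import Data.Fin.Permutation as Perm
import Data.Fin.Properties as Fin
open import Data.Fin.Subset.Properties using (_∈?_; anySubset?; drop-there; x∈p∩q⁺; x∈p∩q⁻)
open import Data.List using (List; []; _∷_; length; filter)
import Data.List as List
open import Data.List.Membership.Propositional using (_∈_)
open import Data.List.Membership.Propositional.Properties using (∈-lookup)
open import Data.List.Relation.Unary.All using (_∷_)
open import Data.List.Relation.Unary.Any renaming (index to position) using ()
open import Data.List.Relation.Unary.Any.Properties using (lookup-index)
open import Data.Nat hiding (_⊓_)
open import Data.Nat.Coprimality using (Coprime; coprime-divisor; coprime-/gcd)
open import Data.Nat.Divisibility hiding (quotient)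
open import Data.Nat.DivMod using (_/_; m/n*n≡m)
open import Data.Nat.GCD using (gcd; gcd[m,n]∣m; gcd[m,n]∣n; gcd[m,n]≢0)
open import Data.Nat.Induction using (<-wellFounded)
open import Data.Nat.Primality using (Prime; euclidsLemma; prime⇒nonTrivial; ¬prime[1])
open import Data.Nat.Primality.Factorisation using (factorise)
open import Data.Nat.Properties
open import Data.Nat.Tactic.RingSolver using (solve-∀)
open import Data.Product
open import Data.Sum using (_⊎_; inj₁; inj₂; [_,_]′)
open import Data.Unit using (tt)
open import Data.Vec using (Vec; []; _∷_; here; there; lookup; tabulate)
open import Data.Vec.Properties using (lookup∘tabulate; lookup⇒[]=; []=⇒lookup; tabulate-cong)
open import Function using (_∘_; id)
open import Induction.WellFounded using (Acc; acc)
import Relation.Binary.Reflection as Reflection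
open import Relation.Binary.PropositionalEquality hiding (J; [_]; resp)
open import Relation.Nullary using (¬_; Dec; yes; no)
open import Relation.Nullary.Decidable using (_×-dec_; _→-dec_; _⊎-dec_; ¬?; map′; does; decidable-stable; toWitness; toWitnessFalse; dec-true; dec-false)
import Algebra.Properties.CommutativeMonoid.Sum +-0-commutativeMonoid as Sum
import Algebra.Properties.Semiring.Sum +-*-semiring as Sum*

-- Counting in finite sets

opaque
  ind : ∀ {P : Set} → Dec P → ℕ
  ind d = if does d then 1 else 0

  ind-yes : ∀ {P : Set} (d : Dec P) → P → ind d ≡ 1
  ind-yes (yes _) _ = refl
  ind-yes (no ¬p) p = ⊥-elim (¬p p)

  ind-no : ∀ {P : Set} (d : Dec P) → ¬ P → ind d ≡ 0
  ind-no (yes p) ¬p = ⊥-elim (¬p p)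
  ind-no (no _) _ = refl

  ind-mono : ∀ {P Q : Set} (d : Dec P) (e : Dec Q) → (P → Q) → ind d ≤ ind e
  ind-mono (yes p) e f = ≤-reflexive (sym (ind-yes e (f p)))
  ind-mono (no _) e f = z≤n

  ind-cong : ∀ {P Q : Set} (d : Dec P) (e : Dec Q) → (P → Q) → (Q → P) → ind d ≡ ind e
  ind-cong d e f g = ≤-antisym (ind-mono d e f) (ind-mono e d g)

  ind-× : ∀ {P Q : Set} (d : Dec P) (e : Dec Q) → ind (d ×-dec e) ≡ ind d * ind e
  ind-× (yes _) (yes _) = refl
  ind-× (yes _) (no _) = refl
  ind-× (no _) _ = refl

  ind-split : ∀ {P Q : Set} (d : Dec P) (e : Dec Q) → ind d ≡ ind (d ×-dec e) + ind (d ×-dec ¬? e)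
  ind-split (yes _) (yes _) = refl
  ind-split (yes _) (no _) = refl
  ind-split (no _) _ = refl

  sum : ∀ {n} → (Fin n → ℕ) → ℕ
  sum = Sum.sum

  sum-zero : ∀ (f : Fin 0 → ℕ) → sum f ≡ 0
  sum-zero f = refl

  sum-suc : ∀ {n} (f : Fin (suc n) → ℕ) → sum f ≡ f zero + sum (f ∘ suc)
  sum-suc f = refl

  sum-cong-≗ : ∀ {n} {f g : Fin n → ℕ} → (∀ x → f x ≡ g x) → sum f ≡ sum g
  sum-cong-≗ = Sum.sum-cong-≗

  ∑-comm : ∀ {m n} (f : Fin m → Fin n → ℕ) → sum (λ i → sum (f i)) ≡ sum (λ j → sum (λ i → f i j))
  ∑-comm = Sum.∑-comm

  ∑-distrib-+ : ∀ {n} (f g : Fin n → ℕ) → sum (λ i → f i + g i) ≡ sum f + sum g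
  ∑-distrib-+ = Sum.∑-distrib-+

  *-distribˡ-sum : ∀ {n} c (f : Fin n → ℕ) → c * sum f ≡ sum (λ i → c * f i)
  *-distribˡ-sum = Sum*.*-distribˡ-sum

  *-distribʳ-sum : ∀ {n} c (f : Fin n → ℕ) → sum f * c ≡ sum (λ i → f i * c)
  *-distribʳ-sum = Sum*.*-distribʳ-sum

  sum-mono : ∀ {n} (f g : Fin n → ℕ) → (∀ x → f x ≤ g x) → sum f ≤ sum g
  sum-mono {zero} f g h = z≤n
  sum-mono {suc n} f g h = +-mono-≤ (h zero) (sum-mono (f ∘ suc) (g ∘ suc) (h ∘ suc))

  sum-bij : ∀ {n} (f : Fin n → ℕ) (σ τ : Fin n → Fin n) →
            (∀ x → σ (τ x) ≡ x) → (∀ x → τ (σ x) ≡ x) → sum f ≡ sum (f ∘ σ)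
  sum-bij f σ τ στ τσ = Sum.sum-permute f (permutation σ τ στ τσ)

  sum-const : ∀ n c → sum {n} (λ _ → c) ≡ n * c
  sum-const zero c = refl
  sum-const (suc n) c = cong (c +_) (sum-const n c)

  sum-∣ : ∀ {n} (f : Fin n → ℕ) c → (∀ x → c ∣ f x) → c ∣ sum f
  sum-∣ {zero} f c h = c ∣0
  sum-∣ {suc n} f c h = ∣m∣n⇒∣m+n (h zero) (sum-∣ (f ∘ suc) c (h ∘ suc))

  sum-0 : ∀ {n} (f : Fin n → ℕ) → (∀ x → f x ≡ 0) → sum f ≡ 0
  sum-0 {n} f h = trans (sum-cong-≗ h) (Sum.sum-replicate-zero n)

  sum-δ : ∀ {n} (a : Fin n) (f : Fin n → ℕ) → sum (λ x → ind (x Fin.≟ a) * f x) ≡ f a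
  sum-δ {suc n} zero f = trans (cong₂ _+_ (*-identityˡ (f zero)) (sum-0 {n} _ (λ _ → refl))) (+-identityʳ _)
  sum-δ {suc n} (suc a) f = trans (sum-cong-≗ (λ x → cong (_* f (suc x))
      (ind-cong (suc x Fin.≟ suc a) (x Fin.≟ a) Fin.suc-injective (cong suc)))) (sum-δ a (f ∘ suc))


-- `Mem` is implicit, so a set is written down by its decision procedure alone; cardinalities are
-- then sums of indicators.
record DSet (n : ℕ) : Set₁ where
  constructor mk
  field
    {Mem} : Fin n → Set
    mem?  : ∀ x → Dec (Mem x)

open DSet public using (mem?)

infix 4 _∊_ _⊑_
_∊_ : ∀ {n} → Fin n → DSet n → Set
x ∊ X = DSet.Mem X x

_⊑_ : ∀ {n} → DSet n → DSet n → Set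
X ⊑ Y = ∀ x → x ∊ X → x ∊ Y

infix 8 #_
#_ : ∀ {n} → DSet n → ℕ
# X = sum (λ x → ind (mem? X x))

infixr 7 _⊓ˢ_
_⊓ˢ_ : ∀ {n} → DSet n → DSet n → DSet n
X ⊓ˢ Y = mk (λ x → mem? X x ×-dec mem? Y x)

full : ∀ {n} → DSet n
full = mk (λ x → yes (refl {x = x}))

single : ∀ {n} → Fin n → DSet n
single a = mk (Fin._≟ a)

#-mono : ∀ {n} (X Y : DSet n) → X ⊑ Y → # X ≤ # Y
#-mono X Y h = sum-mono _ _ (λ x → ind-mono (mem? X x) (mem? Y x) (h x))

#-cong : ∀ {n} (X Y : DSet n) → X ⊑ Y → Y ⊑ X → # X ≡ # Y
#-cong X Y h h' = ≤-antisym (#-mono X Y h) (#-mono Y X h')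

#-full : ∀ n → # (full {n}) ≡ n
#-full n = trans (sum-cong-≗ (λ x → ind-yes (mem? full x) refl)) (trans (sum-const n 1) (*-identityʳ n))

#-single : ∀ {n} (a : Fin n) → # (single a) ≡ 1
#-single a = trans (sum-cong-≗ (λ x → sym (*-identityʳ (ind (x Fin.≟ a))))) (sum-δ a (λ _ → 1))

#-empty : ∀ {n} (X : DSet n) → (∀ x → ¬ x ∊ X) → # X ≡ 0
#-empty X h = sum-0 _ (λ x → ind-no (mem? X x) (h x))

#-split : ∀ {n} (X Y : DSet n) → # X ≡ # (X ⊓ˢ Y) + # (mk (λ x → mem? X x ×-dec ¬? (mem? Y x)))
#-split X Y = trans (sum-cong-≗ (λ x → ind-split (mem? X x) (mem? Y x))) (∑-distrib-+ _ _)

#-remove : ∀ {n} (X : DSet n) a → a ∊ X → # X ≡ suc (# (mk (λ x → mem? X x ×-dec ¬? (x Fin.≟ a))))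
#-remove X a a∈ = trans (#-split X (single a)) (cong (_+ # (mk (λ x → mem? X x ×-dec ¬? (x Fin.≟ a)))) (trans
  (#-cong (X ⊓ˢ single a) (single a) (λ _ → proj₂) (λ { x refl → a∈ , refl })) (#-single a)))

#-pos : ∀ {n} (X : DSet n) a → a ∊ X → 0 < # X
#-pos X a a∈ = subst (0 <_) (sym (#-remove X a a∈)) (s≤s z≤n)

#-strict : ∀ {n} (X Y : DSet n) → X ⊑ Y → ∀ a → a ∊ Y → ¬ a ∊ X → # X < # Y
#-strict X Y h a a∈ a∉ = subst (# X <_) (sym (#-remove Y a a∈))
  (s≤s (#-mono X (mk (λ x → mem? Y x ×-dec ¬? (x Fin.≟ a))) (λ x x∈ → h x x∈ , λ { refl → a∉ x∈ })))

⊑-antisym-# : ∀ {n} (X Y : DSet n) → X ⊑ Y → # Y ≤ # X → Y ⊑ X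
⊑-antisym-# X Y h le a a∈ with mem? X a
... | yes p = p
... | no ¬p = ⊥-elim (<⇒≱ (#-strict X Y h a a∈ ¬p) le)

#≤1 : ∀ {n} (X : DSet n) → (∀ x y → x ∊ X → y ∊ X → x ≡ y) → # X ≤ 1
#≤1 X h with Fin.any? (mem? X)
... | no ¬p = ≤-trans (≤-reflexive (#-empty X (λ x x∈ → ¬p (x , x∈)))) z≤n
... | yes (a , a∈) = ≤-trans (#-mono X (single a) (λ x x∈ → h x a x∈ a∈)) (≤-reflexive (#-single a))

#>1 : ∀ {n} (X : DSet n) a → a ∊ X → 1 < # X → Σ[ b ∈ Fin n ] (b ∊ X × b ≢ a)
#>1 X a a∈ lt with Fin.any? (λ b → mem? X b ×-dec ¬? (b Fin.≟ a))
... | yes p = p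
... | no ¬p = ⊥-elim (<⇒≱ lt (#≤1 X (λ x y x∈ y∈ → trans (eq x x∈) (sym (eq y y∈)))))
  where
  eq : ∀ x → x ∊ X → x ≡ a
  eq x x∈ with x Fin.≟ a
  ... | yes e = e
  ... | no ne = ⊥-elim (¬p (x , x∈ , ne))

sum-fibres : ∀ {m n} (X : DSet m) (f : Fin m → Fin n) →
             # X ≡ sum (λ y → # (mk (λ x → mem? X x ×-dec (y Fin.≟ f x))))
sum-fibres X f = trans (sum-cong-≗ row) (∑-comm _)
  where
  row : ∀ x → ind (mem? X x) ≡ sum (λ y → ind (mem? X x ×-dec (y Fin.≟ f x)))
  row x = sym (trans (sum-cong-≗ (λ y → trans (ind-× (mem? X x) (y Fin.≟ f x)) (*-comm (ind (mem? X x)) _)))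
                     (sum-δ (f x) (λ _ → ind (mem? X x))))

#-inj : ∀ {m n} (X : DSet m) (Y : DSet n) (f : Fin m → Fin n) → (∀ x → x ∊ X → f x ∊ Y) →
        (∀ x x' → x ∊ X → x' ∊ X → f x ≡ f x' → x ≡ x') → # X ≤ # Y
#-inj X Y f into inj = subst (_≤ # Y) (sym (sum-fibres X f)) (sum-mono _ _ fib)
  where
  fib : ∀ y → # (mk (λ x → mem? X x ×-dec (y Fin.≟ f x))) ≤ ind (mem? Y y)
  fib y with mem? Y y
  ... | yes p = ≤-trans (#≤1 _ (λ { x x' (p , e) (p' , e') → inj x x' p p' (trans (sym e) e') })) (≤-reflexive (sym (ind-yes (yes p) p)))
  ... | no ¬p = ≤-trans (≤-reflexive (#-empty _ (λ { x (p , refl) → ¬p (into x p) }))) z≤n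

#-bij : ∀ {n} (X Y : DSet n) (σ τ : Fin n → Fin n) → (∀ x → σ (τ x) ≡ x) → (∀ x → τ (σ x) ≡ x) →
        (∀ x → x ∊ X → σ x ∊ Y) → (∀ x → x ∊ Y → τ x ∊ X) → # X ≡ # Y
#-bij X Y σ τ στ τσ f g = ≤-antisym
  (#-inj X Y σ f (λ x x' _ _ e → trans (sym (τσ x)) (trans (cong τ e) (τσ x'))))
  (#-inj Y X τ g (λ x x' _ _ e → trans (sym (στ x)) (trans (cong σ e) (στ x'))))

-- Both sides count the pairs in `R`. As `R` relates only elements of `X` and `Y`, the sums may run
-- over all indices. Orbits, double cosets, flags and lines are counted this way.
double-count : ∀ {m n} (X : DSet m) (Y : DSet n) {R : Fin m → Fin n → Set} (R? : ∀ x y → Dec (R x y)) a b →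
  (∀ x y → R x y → x ∊ X × y ∊ Y) →
  (∀ x → x ∊ X → # (mk (R? x)) ≡ a) → (∀ y → y ∊ Y → # (mk (λ x → R? x y)) ≡ b) → # X * a ≡ # Y * b
double-count X Y R? a b R⊑ row col = begin
  # X * a                               ≡⟨ *-distribʳ-sum a (λ x → ind (mem? X x)) ⟩
  sum (λ x → ind (mem? X x) * a)        ≡⟨ sum-cong-≗ rows ⟩
  sum (λ x → # (mk (R? x)))             ≡⟨ ∑-comm _ ⟩
  sum (λ y → # (mk (λ x → R? x y)))     ≡⟨ sum-cong-≗ cols ⟨
  sum (λ y → ind (mem? Y y) * b)        ≡⟨ *-distribʳ-sum b (λ y → ind (mem? Y y)) ⟨
  # Y * b                               ∎
  where
  open ≡-Reasoning
  rows : ∀ x → ind (mem? X x) * a ≡ # (mk (R? x))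
  rows x with mem? X x
  ... | yes p = trans (trans (cong (_* a) (ind-yes (yes p) p)) (*-identityˡ a)) (sym (row x p))
  ... | no ¬p = trans (cong (_* a) (ind-no (no ¬p) ¬p)) (sym (#-empty (mk (R? x)) (λ y r → ¬p (proj₁ (R⊑ x y r)))))
  cols : ∀ y → ind (mem? Y y) * b ≡ # (mk (λ x → R? x y))
  cols y with mem? Y y
  ... | yes p = trans (trans (cong (_* b) (ind-yes (yes p) p)) (*-identityˡ b)) (sym (col y p))
  ... | no ¬p = trans (cong (_* b) (ind-no (no ¬p) ¬p)) (sym (#-empty (mk (λ x → R? x y)) (λ x r → ¬p (proj₂ (R⊑ x y r)))))

record DEquiv (n : ℕ) : Set₁ where
  field
    {_~_} : Fin n → Fin n → Set
    ~?    : ∀ x y → Dec (x ~ y)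
    ~refl : ∀ x → x ~ x
    ~sym  : ∀ {x y} → x ~ y → y ~ x
    ~trans : ∀ {x y z} → x ~ y → y ~ z → x ~ z

record Quotient {n} (E : DEquiv n) : Set where
  open DEquiv E
  field
    size : ℕ
    cls  : Fin n → Fin size
    rep  : Fin size → Fin n
    cls-rep : ∀ i → cls (rep i) ≡ i
    sound   : ∀ {x y} → x ~ y → cls x ≡ cls y
    exact   : ∀ {x y} → cls x ≡ cls y → x ~ y

-- Induction on `n`: the point `zero` joins the class of some later point related to it, or else
-- opens a class of its own.
quotient : ∀ {n} (E : DEquiv n) → Quotient E
quotient {zero} E = record { size = 0 ; cls = λ () ; rep = λ () ; cls-rep = λ ()
  ; sound = λ {x} → ⊥-elim (nil x) ; exact = λ {x} → ⊥-elim (nil x) }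
  where
  nil : Fin 0 → ⊥
  nil ()
quotient {suc n} E = go (Fin.any? (λ y → ~? zero (suc y)))
  where
  open DEquiv E
  tail : DEquiv n
  tail = record { ~? = λ x y → ~? (suc x) (suc y) ; ~refl = λ x → ~refl (suc x) ; ~sym = ~sym ; ~trans = ~trans }
  module Q = Quotient (quotient tail)
  go : Dec (Σ[ y ∈ Fin n ] zero ~ suc y) → Quotient E
  go (yes (y , 0~y)) = record { size = Q.size ; cls = cl ; rep = suc ∘ Q.rep ; cls-rep = Q.cls-rep ; sound = snd ; exact = ex }
    where
    cl : Fin (suc n) → Fin Q.size
    cl zero = Q.cls y
    cl (suc x) = Q.cls x
    snd : ∀ {x z} → x ~ z → cl x ≡ cl z
    snd {zero} {zero} _ = refl
    snd {zero} {suc z} r = Q.sound (~trans (~sym 0~y) r)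
    snd {suc x} {zero} r = Q.sound (~trans r 0~y)
    snd {suc x} {suc z} r = Q.sound r
    ex : ∀ {x z} → cl x ≡ cl z → x ~ z
    ex {zero} {zero} _ = ~refl zero
    ex {zero} {suc z} e = ~trans 0~y (Q.exact e)
    ex {suc x} {zero} e = ~trans (Q.exact e) (~sym 0~y)
    ex {suc x} {suc z} e = Q.exact e
  go (no ¬p) = record { size = suc Q.size ; cls = cl ; rep = rp ; cls-rep = cr ; sound = snd ; exact = ex }
    where
    cl : Fin (suc n) → Fin (suc Q.size)
    cl zero = zero
    cl (suc x) = suc (Q.cls x)
    rp : Fin (suc Q.size) → Fin (suc n)
    rp zero = zero
    rp (suc i) = suc (Q.rep i)
    cr : ∀ i → cl (rp i) ≡ i
    cr zero = refl
    cr (suc i) = cong suc (Q.cls-rep i)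
    snd : ∀ {x z} → x ~ z → cl x ≡ cl z
    snd {zero} {zero} _ = refl
    snd {zero} {suc z} r = ⊥-elim (¬p (z , r))
    snd {suc x} {zero} r = ⊥-elim (¬p (x , ~sym r))
    snd {suc x} {suc z} r = cong suc (Q.sound r)
    ex : ∀ {x z} → cl x ≡ cl z → x ~ z
    ex {zero} {zero} _ = ~refl zero
    ex {zero} {suc z} ()
    ex {suc x} {zero} ()
    ex {suc x} {suc z} e = Q.exact (Fin.suc-injective e)

-- Sum over the classes inside `X`. Lagrange's theorem, Sylow's double coset argument and the class
-- equation are instances.
∣-classes : ∀ {n} (E : DEquiv n) (X : DSet n) c → (∀ x y → DEquiv._~_ E x y → x ∊ X → y ∊ X) →
            (∀ x → x ∊ X → c ∣ # (mk (DEquiv.~? E x))) → c ∣ # X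
∣-classes E X c closed div = subst (c ∣_) (sym (sum-fibres X Q.cls)) (sum-∣ _ c fib)
  where
  open DEquiv E
  module Q = Quotient (quotient E)
  fib : ∀ i → c ∣ # (mk (λ x → mem? X x ×-dec (i Fin.≟ Q.cls x)))
  fib i with mem? X (Q.rep i)
  ... | yes p = subst (c ∣_) (#-cong (mk (~? (Q.rep i))) (mk (λ x → mem? X x ×-dec (i Fin.≟ Q.cls x)))
                   (λ x r → closed _ _ r p , trans (sym (Q.cls-rep i)) (Q.sound r))
                   (λ { x (_ , e) → Q.exact (trans (Q.cls-rep i) e) })) (div _ p)
  ... | no ¬p = subst (c ∣_) (sym (#-empty _ (λ { x (x∈ , e) →
                   ¬p (closed _ _ (Q.exact (trans (sym e) (sym (Q.cls-rep i)))) x∈) }))) (c ∣0)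

record Enumeration {N} (X : DSet N) : Set where
  field
    size  : ℕ
    to    : Fin size → Fin N
    to∊   : ∀ i → to i ∊ X
    from  : ∀ x → x ∊ X → Σ[ i ∈ Fin size ] to i ≡ x
    inj   : ∀ {i j} → to i ≡ to j → i ≡ j

enumerate : ∀ {N} (X : DSet N) → Enumeration X
enumerate {zero} X = record { size = 0 ; to = λ () ; to∊ = λ () ; from = λ () ; inj = λ {} }
enumerate {suc N} X with mem? X zero | enumerate (mk (mem? X ∘ suc))
... | no ¬p | T = record { size = T.size ; to = suc ∘ T.to ; to∊ = T.to∊ ; from = fr ; inj = T.inj ∘ Fin.suc-injective }
  where
  module T = Enumeration T
  fr : ∀ x → x ∊ X → Σ[ i ∈ Fin T.size ] suc (T.to i) ≡ x
  fr zero p = ⊥-elim (¬p p)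
  fr (suc x) p = map₂ (cong suc) (T.from x p)
... | yes p | T = record { size = suc T.size ; to = t ; to∊ = t∊ ; from = fr ; inj = ij }
  where
  module T = Enumeration T
  t : Fin (suc T.size) → Fin (suc N)
  t zero = zero
  t (suc i) = suc (T.to i)
  t∊ : ∀ i → t i ∊ X
  t∊ zero = p
  t∊ (suc i) = T.to∊ i
  fr : ∀ x → x ∊ X → Σ[ i ∈ Fin (suc T.size) ] t i ≡ x
  fr zero _ = zero , refl
  fr (suc x) q = let i , e = T.from x q in suc i , cong suc e
  ij : ∀ {i j} → t i ≡ t j → i ≡ j
  ij {zero} {zero} _ = refl
  ij {zero} {suc j} ()
  ij {suc i} {zero} ()
  ij {suc i} {suc j} e = cong suc (T.inj (Fin.suc-injective e))

two-elements : ∀ {b} → b ≡ 2 → Σ[ i ∈ Fin b ] Σ[ j ∈ Fin b ] (i ≢ j × ∀ x → x ≡ i ⊎ x ≡ j)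
two-elements refl = zero , suc zero , (λ ()) , λ { zero → inj₁ refl ; (suc zero) → inj₂ refl }

enumeration-size : ∀ {N} (X : DSet N) (E : Enumeration X) → Enumeration.size E ≡ # X
enumeration-size X E = sym (trans (sym (*-identityʳ _)) (trans (double-count X full (λ x i → x Fin.≟ E.to i) 1 1
    (λ { x i refl → E.to∊ i , refl })
    (λ x x∈ → let i , e = E.from x x∈ in trans (#-cong _ (single i) (λ j p → E.inj (trans (sym p) (sym e))) (λ { j refl → sym e })) (#-single i))
    (λ i _ → #-single (E.to i))) (trans (*-identityʳ _) (#-full _))))
  where module E = Enumeration E

sum-fibresʷ : ∀ {m n} (h : Fin m → Fin n) (f : Fin m → ℕ) → sum f ≡ sum (λ c → sum (λ x → ind (c Fin.≟ h x) * f x))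
sum-fibresʷ h f = trans (sum-cong-≗ (λ x → sym (sum-δ (h x) (λ _ → f x)))) (∑-comm _)

-- Arithmetic

opaque
  prime-divisor : ∀ m → 1 < m → Σ[ p ∈ ℕ ] (Prime p × p ∣ m)
  prime-divisor m@(suc _) 1<m with factorise m
  ... | record { factors = [] ; isFactorisation = e } = ⊥-elim (<⇒≢ 1<m (sym e))
  ... | record { factors = p ∷ ps ; isFactorisation = e ; factorsPrime = pr ∷ _ } = p , pr , subst (p ∣_) (sym e) (m∣m*n _)

∣-pos : ∀ {m k} → m ∣ k → 0 < k → 0 < m
∣-pos {zero} m∣k 0<k = ⊥-elim (<⇒≢ 0<k (sym (0∣⇒≡0 m∣k)))
∣-pos {suc m} _ _ = s≤s z≤n

no-common-prime⇒coprime : ∀ {a b} → 0 < a → (∀ r → Prime r → r ∣ a → r ∣ b → ⊥) → Coprime a b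
no-common-prime⇒coprime {a} 0<a h {d} (d∣a , d∣b) with d ≟ 1
... | yes e = e
... | no d≢1 = let r , pr , r∣d = prime-divisor d (≤∧≢⇒< (∣-pos d∣a 0<a) (≢-sym d≢1))
               in ⊥-elim (h r pr (∣-trans r∣d d∣a) (∣-trans r∣d d∣b))

^-distribʳ-* : ∀ e a b → (a * b) ^ e ≡ a ^ e * b ^ e
^-distribʳ-* zero a b = refl
^-distribʳ-* (suc e) a b = trans (cong ((a * b) *_) (^-distribʳ-* e a b)) (lem a b (a ^ e) (b ^ e))
  where
  lem : ∀ a b x y → a * b * (x * y) ≡ a * x * (b * y)
  lem = solve-∀

-- `x y - 1 = (x - 1) y + (y - 1)`. This carries the congruence from orders of subgroups to their
-- indices.
∣∸1-quotient : ∀ d x y → 0 < x → 0 < y → d ∣ x ∸ 1 → d ∣ x * y ∸ 1 → d ∣ y ∸ 1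
∣∸1-quotient d (suc x) (suc y) _ _ p q = ∣m+n∣m⇒∣n (subst (d ∣_) (+-comm y (x * suc y)) q) (∣m⇒∣m*n (suc y) p)

-- Here `k = k₀ g`, `λ = l₀ g` and `u = v - 1`. The hypothesis on λ gives `l₀ g ≤ k₀ + 1`, and the
-- parameter equation gives `u l₀ ≤ k₀² g`. Multiplying the second by `l₀²` and using the first
-- leaves `u l₀² ≤ k₀² (k₀ + 1)`.
cubic-bound : ∀ k₀ l₀ g u → 0 < g → 0 < l₀ → l₀ < k₀ → l₀ * g * (l₀ * g) < k₀ * g + 2 * (l₀ * g) →
              k₀ * g * (k₀ * g ∸ 1) ≡ u * (l₀ * g) → suc u < suc k₀ * (suc k₀ * suc k₀)
cubic-bound k₀@(suc a) l₀@(suc c) g@(suc _) u _ _ _ lg par = s≤s (≤-<-trans u≤ (≤-trans (m≤m+n _ (c₁ a)) (≤-reflexive (e₁ a))))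
  where
  c₁ : ℕ → ℕ
  c₁ a = 2 * (a * a) + 7 * a + 4
  e₁ : ∀ a → suc (suc a * suc a * (suc a + 1)) + (2 * (a * a) + 7 * a + 4) ≡ suc a + suc a * suc (suc a) + suc a * (suc (suc a) * suc (suc a))
  e₁ = solve-∀
  h₁ : l₀ * l₀ * g < k₀ + 2 * l₀
  h₁ = *-cancelʳ-< g (l₀ * l₀ * g) (k₀ + 2 * l₀) (subst₂ _<_ (e l₀ g) (e' k₀ l₀ g) lg)
    where
    e : ∀ l g → l * g * (l * g) ≡ l * l * g * g
    e = solve-∀
    e' : ∀ k l g → k * g + 2 * (l * g) ≡ (k + 2 * l) * g
    e' = solve-∀
  -- `k₀ + 2 l₀ ≤ 1 + l₀ (k₀ + 1)`, the difference being `(k₀ - 1)(l₀ - 1)`; the 1 is absorbed by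
  -- the strict inequality `h₁`.
  h₂ : l₀ * l₀ * g ≤ l₀ * (k₀ + 1)
  h₂ = s≤s⁻¹ (≤-trans h₁ (≤-trans (m≤m+n _ (a * c)) (≤-reflexive (e a c))))
    where
    e : ∀ a c → suc a + 2 * suc c + a * c ≡ suc (suc c * (suc a + 1))
    e = solve-∀
  h₃ : u * l₀ ≤ k₀ * k₀ * g
  h₃ = *-cancelʳ-≤ (u * l₀) (k₀ * k₀ * g) g (≤-trans (≤-reflexive (trans (*-assoc u l₀ g) (sym par)))
         (≤-trans (*-monoʳ-≤ (k₀ * g) (m∸n≤m (k₀ * g) 1)) (≤-reflexive (e k₀ g))))
    where
    e : ∀ k g → k * g * (k * g) ≡ k * k * g * g
    e = solve-∀
  u≤ : u ≤ k₀ * k₀ * (k₀ + 1)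
  u≤ = ≤-trans (≤-trans (≤-reflexive (sym (*-identityʳ u))) (*-monoʳ-≤ u {1} {l₀ * l₀} (s≤s z≤n)))
         (*-cancelʳ-≤ (u * (l₀ * l₀)) (k₀ * k₀ * (k₀ + 1)) l₀ (≤-trans (≤-reflexive (e₂ u l₀))
           (≤-trans (*-monoˡ-≤ (l₀ * l₀) h₃) (≤-trans (≤-reflexive (e₃ k₀ g l₀)) (≤-trans (*-monoʳ-≤ (k₀ * k₀) h₂) (≤-reflexive (e₄ k₀ l₀)))))))
    where
    e₂ : ∀ u l → u * (l * l) * l ≡ u * l * (l * l)
    e₂ = solve-∀
    e₃ : ∀ k g l → k * k * g * (l * l) ≡ k * k * (l * l * g)
    e₃ = solve-∀
    e₄ : ∀ k l → k * k * (l * (k + 1)) ≡ k * k * (k + 1) * l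
    e₄ = solve-∀

-- Parameters of designs on a grid

module GridArithmetic where
  geom : ℕ → ℕ → ℕ
  geom zero w = 0
  geom (suc b) w = 1 + w * geom b w

  geom-^ : ∀ b u → suc u ^ b ≡ 1 + u * geom b (suc u)
  geom-^ zero u = cong suc (sym (*-zeroʳ u))
  geom-^ (suc b) u = trans (cong (suc u *_) (geom-^ b u)) (lem u (geom b (suc u)))
    where
    lem : ∀ u s → suc u * (1 + u * s) ≡ 1 + u * (1 + suc u * s)
    lem = solve-∀

  geom-≥ : ∀ b w → w ^ b ≤ geom (suc b) w
  geom-≥ zero w = s≤s z≤n
  geom-≥ (suc b) w = ≤-trans (*-monoʳ-≤ w (geom-≥ b w)) (n≤1+n _)

  -- Here `v = w ^ b`, `u = w - 1`, and `A` is the number of points of a block, other than a given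
  -- point on it, that lie on the b lines through that point. Write s for the geometric sum. E1
  -- results from multiplying the parameter equation by `A` and cancelling the flag count
  -- `k A = λ b u`. E2 is b times the flag count, with `b k = b + s A` from E1. E3 is the hypothesis
  -- on k multiplied by `A` and divided by λ.
  record Equations (b u k l A : ℕ) : Set where
    field
      0<A : 0 < A
      E1 : b * (k ∸ 1) ≡ geom b (suc u) * A
      E2 : l * (b * b * u) ≡ A * (b + geom b (suc u) * A)
      E3 : l * A < b * u + 2 * A

  equations : ∀ b u k l A → 0 < b → 0 < u → 2 ≤ k → 1 ≤ l → k * A ≡ l * (b * u) →
              k * (k ∸ 1) ≡ (suc u ^ b ∸ 1) * l → l * l < k + 2 * l → Equations b u k l A
  equations b@(suc _) u@(suc _) (suc k) l@(suc _) A 0<b 0<u (s≤s 1≤k) 1≤l inc par large = record { 0<A = 0<A' ; E1 = e1 ; E2 = e2 ; E3 = e3 }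
    where
    s : ℕ
    s = geom b (suc u)
    par' : suc k * k ≡ u * s * l
    par' = trans par (cong (λ t → (t ∸ 1) * l) (geom-^ b u))
    0<A' : 0 < A
    0<A' = n≢0⇒n>0 λ { refl → <⇒≢ (*-mono-≤ {1} {l} {1} {b * u} 1≤l (*-mono-≤ 0<b 0<u)) (trans (sym (*-zeroʳ k)) inc) }
    e1 : b * k ≡ s * A
    e1 = *-cancelˡ-≡ _ _ (l * u) {{m*n≢0 l u}} (trans (a₁ b k l u) (trans (cong (_* k) (sym inc)) (trans (a₂ (suc k) A k) (trans (cong (_* A) par') (a₃ u s l A)))))
      where
      a₁ : ∀ b k l u → l * u * (b * k) ≡ l * (b * u) * k
      a₁ = solve-∀
      a₂ : ∀ k' A k → k' * A * k ≡ k' * k * A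
      a₂ = solve-∀
      a₃ : ∀ u s l A → u * s * l * A ≡ l * u * (s * A)
      a₃ = solve-∀
    e2 : l * (b * b * u) ≡ A * (b + s * A)
    e2 = trans (a₁ l b u) (trans (cong (b *_) (sym inc)) (trans (a₂ b k A) (cong (λ t → A * (b + t)) e1)))
      where
      a₁ : ∀ l b u → l * (b * b * u) ≡ b * (l * (b * u))
      a₁ = solve-∀
      a₂ : ∀ b k A → b * (suc k * A) ≡ A * (b + b * k)
      a₂ = solve-∀
    e3 : l * A < b * u + 2 * A
    e3 = *-cancelˡ-< l _ _ (subst₂ _<_ (a₁ l A) (trans (*-distribʳ-+ A (suc k) (2 * l)) (trans (cong (_+ 2 * l * A) inc) (a₂ l (b * u) A))) (*-monoˡ-< A {{>-nonZero 0<A'}} large))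
      where
      a₁ : ∀ l A → l * l * A ≡ l * (l * A)
      a₁ = solve-∀
      a₂ : ∀ l x A → l * x + 2 * l * A ≡ l * (x + 2 * A)
      a₂ = solve-∀

  below : (ℕ → Bool) → ℕ → Bool
  below f zero = true
  below f (suc m) = f m ∧ below f m

  ∧-elim : ∀ {a b} → IsTrue (a ∧ b) → IsTrue a × IsTrue b
  ∧-elim {true} {true} _ = tt , tt

  below-sound : ∀ f m → IsTrue (below f m) → ∀ i → i < m → IsTrue (f i)
  below-sound f (suc m) t i i<m with i ≟ m
  ... | yes refl = proj₁ (∧-elim {f m} t)
  ... | no ne = below-sound f m (proj₂ (∧-elim {f m} t)) i (≤∧≢⇒< (s≤s⁻¹ i<m) ne)

  T-not : ∀ {P : Set} (d : Dec P) → IsTrue (not (does d)) → ¬ P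
  T-not (no ¬p) _ = ¬p

  -- Elimination of λ: E3 is multiplied by `b² u`, and E2 is substituted on the left.
  E4 : ∀ {b u k l A} → Equations b u k l A → A * (A * (b + geom b (suc u) * A)) < (b * u + 2 * A) * (b * b * u) ⊎ b * b * u ≡ 0
  E4 {b} {u} {k} {l} {A} eqs with b * b * u in eq
  ... | zero = inj₂ refl
  ... | suc z = inj₁ (subst (_< (b * u + 2 * A) * suc z) (trans (lem l A (suc z)) (cong (A *_) (trans (cong (l *_) (sym eq)) E2))) (*-monoˡ-< (suc z) E3))
    where
    open Equations eqs
    lem : ∀ l A z → l * A * z ≡ A * (l * z)
    lem = solve-∀

  -- With `t = b - 11` this is `(4 + b)³ ≤ 2 ^ (b + 1)`. It first holds at `b = 11`, which fixes the
  -- range of the search.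
  cube-<-2^ : ∀ t → (15 + t) * ((15 + t) * (15 + t)) ≤ 2 ^ (12 + t)
  cube-<-2^ zero = toWitness {a? = 15 * (15 * 15) ≤? 2 ^ 12} tt
  cube-<-2^ (suc t) = ≤-trans (≤-trans (m≤m+n _ (t * (t * t) + 42 * (t * t) + 582 * t + 2654)) (≤-reflexive (lem t))) (*-monoʳ-≤ 2 (cube-<-2^ t))
    where
    lem : ∀ t → (15 + suc t) * ((15 + suc t) * (15 + suc t)) + (t * (t * t) + 42 * (t * t) + 582 * t + 2654) ≡ 2 * ((15 + t) * ((15 + t) * (15 + t)))
    lem = solve-∀

  -- With `c = 4 + b`, E4 yields `A² s < c³ w²`, while the geometric sum s is at least
  -- `w ^ (c - 1)`. The remaining exponent `c - 3` of w is positive only for `c ≥ 4`, so exponents 2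
  -- and 3 are treated apart.
  bound≥4 : ∀ {b u k l A} → 0 < u → Equations (4 + b) u k l A → A * A * suc u ^ suc b < (4 + b) * ((4 + b) * (4 + b))
  bound≥4 {b} {u@(suc _)} {k} {l} {A} 0<u eqs = *-cancelʳ-< (suc u * suc u) _ _ (≤-<-trans
      (≤-trans (≤-reflexive (lem₀ A (suc u ^ suc b) (suc u))) (*-monoʳ-≤ (A * A) (geom-≥ (3 + b) (suc u))))
      (*-cancelˡ-< A _ _ (≤-<-trans (≤-trans (m≤n+m _ (A * (A * c))) (≤-reflexive (lem₁ A c s))) (<-≤-trans main rhs))))
    where
    open Equations eqs
    c s : ℕ
    c = 4 + b
    s = geom c (suc u)
    lem₀ : ∀ A x w → A * A * x * (w * w) ≡ A * A * (w * (w * x))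
    lem₀ = solve-∀
    lem₁ : ∀ A c s → A * (A * c) + A * (A * A * s) ≡ A * (A * (c + s * A))
    lem₁ = solve-∀
    main : A * (A * (c + s * A)) < (c * u + 2 * A) * (c * c * u)
    main = [ id , (λ ()) ]′ (E4 eqs)
    rhs : (c * u + 2 * A) * (c * c * u) ≤ A * (c * (c * c) * (suc u * suc u))
    rhs = go A c u 0<A (s≤s (s≤s z≤n))
      where
      lem₂ : ∀ a c u → (suc c * u + 2 * suc a) * (suc c * suc c * u) + (a * (suc c * u * (suc c * suc c * u)) + suc a * (2 * c * (suc c * suc c) * u + suc c * (suc c * suc c)))
             ≡ suc a * (suc c * (suc c * suc c) * (suc u * suc u))
      lem₂ = solve-∀
      go : ∀ A c u → 0 < A → 2 ≤ c → (c * u + 2 * A) * (c * c * u) ≤ A * (c * (c * c) * (suc u * suc u))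
      go (suc a) (suc c) u _ _ = ≤-trans (m≤m+n _ _) (≤-reflexive (lem₂ a c u))

  -- The finitely many (b, w, A) left by bound≥4, searched exhaustively.
  Admissible : ℕ → ℕ → ℕ → Set
  Admissible b u A = A * A * suc u ^ (b ∸ 3) < b * (b * b) × b * b * u ∣ A * (b + geom b (suc u) * A) ×
    b ∣ geom b (suc u) * A × A * (A * (b + geom b (suc u) * A)) < (b * u + 2 * A) * (b * b * u)

  admissible? : ∀ b u A → Dec (Admissible b u A)
  admissible? b u A = (A * A * suc u ^ (b ∸ 3) <? b * (b * b)) ×-dec ((b * b * u ∣? A * (b + geom b (suc u) * A)) ×-dec
    ((b ∣? geom b (suc u) * A) ×-dec (A * (A * (b + geom b (suc u) * A)) <? (b * u + 2 * A) * (b * b * u))))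

  search : ℕ → ℕ → ℕ → Bool
  search b u A = not (does (admissible? (4 + b) (suc u) (suc A)))

  -- The box follows from `bound≥4`: `w ≥ 2` forces `b < 11`, and then `w ≥ 66` or an intersection
  -- size of at least 9 is too large. Indices are shifted: the exponent is `4 + b`, `w` is `2 + u`,
  -- and the intersection size is `1 + A`.
  searched : IsTrue (below (λ b → below (λ u → below (search b u) 8) 64) 11)
  searched = tt

  cube-≤-8^ : ∀ b → (4 + b) * ((4 + b) * (4 + b)) ≤ 64 * 8 ^ b
  cube-≤-8^ zero = ≤-refl
  cube-≤-8^ (suc b) = ≤-trans (≤-trans (m≤m+n _ _) (≤-reflexive (lem b))) (≤-trans (*-monoʳ-≤ 8 (cube-≤-8^ b)) (≤-reflexive (lem' (8 ^ b))))
    where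
    lem : ∀ b → (4 + suc b) * ((4 + suc b) * (4 + suc b)) + (7 * (b * (b * b)) + 81 * (b * b) + 309 * b + 387) ≡ 8 * ((4 + b) * ((4 + b) * (4 + b)))
    lem = solve-∀
    lem' : ∀ x → 8 * (64 * x) ≡ 64 * (8 * x)
    lem' = solve-∀

  cube-≤-81 : IsTrue (below (λ b → does ((4 + b) * ((4 + b) * (4 + b)) ≤? 81 * 2 ^ suc b)) 11)
  cube-≤-81 = tt

  T-does : ∀ {P : Set} (d : Dec P) → IsTrue (does d) → P
  T-does (yes p) _ = p

  no-grid≥4 : ∀ {b u k l A} → 0 < u → Equations (4 + b) u k l A → ⊥
  no-grid≥4 {b} {suc u} {k} {l} {zero} _ eqs = <-irrefl refl (Equations.0<A eqs)
  no-grid≥4 {b} {suc u} {k} {l} {suc A} 0<u eqs = T-not (admissible? (4 + b) (suc u) (suc A))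
      (below-sound (search b u) 8 (below-sound (λ u → below (search b u) 8) 64 (below-sound (λ b → below (λ u → below (search b u) 8) 64) 11 searched b b<) u u<) A A<)
      (bd , divides l (sym E2) , divides (k ∸ 1) (trans (sym E1) (*-comm (4 + b) (k ∸ 1))) , [ id , (λ ()) ]′ (E4 eqs))
    where
    open Equations eqs
    c : ℕ
    c = 4 + b
    bd : suc A * suc A * (2 + u) ^ suc b < c * (c * c)
    bd = bound≥4 0<u eqs
    pow≤ : (2 + u) ^ suc b < c * (c * c)
    pow≤ = ≤-<-trans (≤-trans (≤-reflexive (sym (*-identityˡ _))) (*-monoˡ-≤ ((2 + u) ^ suc b) {1} {suc A * suc A} (s≤s z≤n))) bd
    b< : b < 11
    b< with b <? 11
    ... | yes p = p
    ... | no ¬p = ⊥-elim (<⇒≱ pow≤ (≤-trans big (^-monoˡ-≤ (suc b) {2} {2 + u} (s≤s (s≤s z≤n)))))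
      where
      t : ℕ
      t = b ∸ 11
      b≡ : b ≡ 11 + t
      b≡ = sym (m+[n∸m]≡n (≮⇒≥ ¬p))
      big : c * (c * c) ≤ 2 ^ suc b
      big = subst (λ z → (4 + z) * ((4 + z) * (4 + z)) ≤ 2 ^ suc z) (sym b≡) (cube-<-2^ t)
    u< : u < 64
    u< with u <? 64
    ... | yes p = p
    ... | no ¬p = ⊥-elim (<⇒≱ pow≤ (≤-trans (cube-≤-8^ b) (≤-trans (*-monoʳ-≤ 64 (^-monoˡ-≤ b {8} {64} (toWitness {a? = 8 ≤? 64} tt)))
            (^-monoˡ-≤ (suc b) {64} {2 + u} (≤-trans (≮⇒≥ ¬p) (m≤n+m u 2))))))
    A< : A < 8
    A< with A <? 8
    ... | yes p = p
    ... | no ¬p = ⊥-elim (<⇒≱ bd (≤-trans (T-does (c * (c * c) ≤? 81 * 2 ^ suc b) (below-sound (λ b → does ((4 + b) * ((4 + b) * (4 + b)) ≤? 81 * 2 ^ suc b)) 11 cube-≤-81 b b<))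
            (*-mono-≤ (*-mono-≤ (s≤s (≮⇒≥ ¬p)) (s≤s (≮⇒≥ ¬p))) (^-monoˡ-≤ (suc b) {2} {2 + u} (s≤s (s≤s z≤n))))))

  -- The geometric sum is `3 + 3 u + u²`, so modulo `u` E2 reads `u ∣ 3 A (A + 1)`. For `A ≥ 3` the
  -- leading term `A³ u²` defeats E4; `A = 1` and `A = 2` leave only divisors of 6 and of 18.
  no-grid-3 : ∀ {u k l A} → 0 < u → Equations 3 u k l A → ⊥
  no-grid-3 {suc u'} {k} {l} {A} 0<u eqs = go A 0<A E2 ([ id , (λ ()) ]′ (E4 eqs))
    where
    open Equations eqs
    u = suc u'
    divisible : ∀ A → A * (3 + geom 3 (suc u) * A) ≡ A * A * (u * u + 3 * u) + 3 * A + 3 * (A * A)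
    divisible = lem u
      where
      lem : ∀ u A → A * (3 + (1 + suc u * (1 + suc u * (1 + suc u * 0))) * A) ≡ A * A * (u * u + 3 * u) + 3 * A + 3 * (A * A)
      lem = solve-∀
    u∣ : ∀ A → l * (9 * u) ≡ A * (3 + geom 3 (suc u) * A) → u ∣ 3 * A + 3 * (A * A)
    u∣ A e = ∣m+n∣m⇒∣n {u} {A * A * (u * u + 3 * u)} (divides (l * 9) (trans (sym (+-assoc (A * A * (u * u + 3 * u)) (3 * A) (3 * (A * A)))) (trans (sym (divisible A)) (trans (sym e) (sym (*-assoc l 9 u))))))
               (divides (A * A * (u + 3)) (lem A u))
      where
      lem : ∀ A u → A * A * (u * u + 3 * u) ≡ A * A * (u + 3) * u
      lem = solve-∀
    check : ℕ → ℕ → Bool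
    check A u = not (does (9 * u ∣? A * (3 + geom 3 (suc u) * A)))
    check₁ : IsTrue (below (check 1 ∘ suc) 6)
    check₁ = tt
    check₂ : IsTrue (below (check 2 ∘ suc) 18)
    check₂ = tt
    go : ∀ A → 0 < A → l * (9 * u) ≡ A * (3 + geom 3 (suc u) * A) →
         A * (A * (3 + geom 3 (suc u) * A)) < (3 * u + 2 * A) * (9 * u) → ⊥
    go 1 _ e _ = T-not (9 * u ∣? 1 * (3 + geom 3 (suc u) * 1)) (below-sound (check 1 ∘ suc) 6 check₁ u' (∣⇒≤ (u∣ 1 e))) (divides l (sym e))
    go 2 _ e _ = T-not (9 * u ∣? 2 * (3 + geom 3 (suc u) * 2)) (below-sound (check 2 ∘ suc) 18 check₂ u' (∣⇒≤ (u∣ 2 e))) (divides l (sym e))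
    go (suc (suc (suc a))) _ _ lt = <⇒≱ lt (≤-trans (m≤m+n _ _) (≤-reflexive (lem a u)))
      where
      lem : ∀ a u → (3 * u + 2 * suc (suc (suc a))) * (9 * u) +
            ((a * a * a + 9 * (a * a) + 27 * a) * (u * u) + (3 * (a * a * a) + 27 * (a * a) + 63 * a + 27) * u
             + 3 * (3 + a) * (3 + a) + 3 * (3 + a) * (3 + a) * (3 + a))
            ≡ suc (suc (suc a)) * (suc (suc (suc a)) * (3 + (1 + suc u * (1 + suc u * (1 + suc u * 0))) * suc (suc (suc a))))
      lem = solve-∀

  Solution : ℕ → ℕ → Set
  Solution A c = (A ≡ 2 × c ≡ 4) ⊎ (A ≡ 3 × c ≡ 3) ⊎ (A ≡ 4 × c ≡ 4) ⊎ (A ≡ 5 × c ≡ 3)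

  solution? : ∀ A c → Dec (Solution A c)
  solution? A c = ((A ≟ 2) ×-dec (c ≟ 4)) ⊎-dec (((A ≟ 3) ×-dec (c ≟ 3)) ⊎-dec (((A ≟ 4) ×-dec (c ≟ 4)) ⊎-dec ((A ≟ 5) ×-dec (c ≟ 3))))

  search₂? : ∀ A c → Dec ((A * A + c) * c < 16 * (A + 1) + 8 * c × c ∣ 2 * A + 2 * (A * A) × 4 ∣ A * A + c → Solution A c)
  search₂? A c = (((A * A + c) * c <? 16 * (A + 1) + 8 * c) ×-dec ((c ∣? 2 * A + 2 * (A * A)) ×-dec (4 ∣? A * A + c))) →-dec solution? A c

  searched₂ : IsTrue (below (λ A → below (λ c → does (search₂? (suc A) (suc c))) 30) 17)
  searched₂ = tt

  -- The first alternative comes from `(v, k, λ) = (16, 6, 2)`. Biplanes with these parameters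
  -- exist, so arithmetic cannot exclude it.
  Exceptional : ℕ → ℕ → ℕ → Set
  Exceptional u k A = (u ≡ 3) ⊎ (u ≡ 8 × k ≡ 16 × A ≡ 3) ⊎ (u ≡ 10 × k ≡ 25 × A ≡ 4) ⊎ (u ≡ 20 × k ≡ 56 × A ≡ 5)

  -- Modulo `u`, E2 reads `u ∣ 2 A (A + 1)`. In terms of the cofactor `c` it becomes `4 λ = A² + c`,
  -- and E3 turns into a bound on `A` and `c` alone, which gives `A ≤ 17` and `c ≤ 30`.
  grid-2 : ∀ {u k l A} → 0 < u → 2 ≤ k → Equations 2 u k l A → Exceptional u k A
  grid-2 {u} {suc k} {l} {zero} 0<u _ eqs = ⊥-elim (<-irrefl refl (Equations.0<A eqs))
  grid-2 {u@(suc _)} {suc k} {l} {A@(suc A')} 0<u _ eqs = finish A c (T-does (search₂? A c) (go c 0<c bound) (bound , divides u 2A≡' , divides l (sym 4l≡'))) 2A≡' E1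
    where
    open Equations eqs
    u∣ : u ∣ 2 * A + 2 * (A * A)
    u∣ = ∣m+n∣m⇒∣n {u} {A * A * u} (divides (l * 4) (trans (sym (trans E2 (lem A u))) (sym (*-assoc l 4 u)))) (divides (A * A) refl)
      where
      lem : ∀ A u → A * (2 + (1 + suc u * (1 + suc u * 0)) * A) ≡ A * A * u + (2 * A + 2 * (A * A))
      lem = solve-∀
    c : ℕ
    c = _∣_.quotient u∣
    2A≡ : 2 * A + 2 * (A * A) ≡ c * u
    2A≡ = _∣_.equality u∣
    2A≡' : 2 * A + 2 * (A * A) ≡ u * c
    2A≡' = trans 2A≡ (*-comm c u)
    4l≡ : 4 * l ≡ A * A + c
    4l≡ = *-cancelʳ-≡ _ _ u (trans (lem₁ l u) (trans E2 (trans (lem₂ A u) (trans (cong (A * A * u +_) 2A≡) (sym (*-distribʳ-+ u (A * A) c))))))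
      where
      lem₁ : ∀ l u → 4 * l * u ≡ l * (4 * u)
      lem₁ = solve-∀
      lem₂ : ∀ A u → A * (2 + (1 + suc u * (1 + suc u * 0)) * A) ≡ A * A * u + (2 * A + 2 * (A * A))
      lem₂ = solve-∀
    4l≡' : l * 4 ≡ A * A + c
    4l≡' = trans (*-comm l 4) 4l≡
    0<c : 0 < c
    0<c = n≢0⇒n>0 λ e → <⇒≢ {0} {2 * A + 2 * (A * A)} (s≤s z≤n) (sym (trans 2A≡ (cong (_* u) e)))
    bound : (A * A + c) * c < 16 * (A + 1) + 8 * c
    bound = *-cancelˡ-< A _ _ (subst₂ _<_ (trans (lem₁ l A c) (cong (λ t → A * (t * c)) 4l≡)) (trans (lem₂ u A c) (trans (cong (λ t → 8 * t + 8 * A * c) (sym 2A≡')) (lem₃ A c)))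
              (*-monoˡ-< (4 * c) {{m*n≢0 4 c {{_}} {{>-nonZero 0<c}}}} E3))
      where
      lem₁ : ∀ l A c → l * A * (4 * c) ≡ A * (4 * l * c)
      lem₁ = solve-∀
      lem₂ : ∀ u A c → (2 * u + 2 * A) * (4 * c) ≡ 8 * (u * c) + 8 * A * c
      lem₂ = solve-∀
      lem₃ : ∀ A c → 8 * (2 * A + 2 * (A * A)) + 8 * A * c ≡ A * (16 * (A + 1) + 8 * c)
      lem₃ = solve-∀
    A'< : ∀ c → 0 < c → (A * A + c) * c < 16 * (A + 1) + 8 * c → A' < 17
    A'< (suc c) _ bd with A' <? 17
    ... | yes p = p
    ... | no ¬p = ⊥-elim (<⇒≱ bd (subst (λ A → 16 * (A + 1) + 8 * suc c ≤ (A * A + suc c) * suc c) A≡ (≤-trans (m≤m+n _ _) (≤-reflexive (lem (A' ∸ 17) c)))))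
      where
      A≡ : 18 + (A' ∸ 17) ≡ A
      A≡ = cong suc (m+[n∸m]≡n (≮⇒≥ ¬p))
      lem : ∀ a c → 16 * (18 + a + 1) + 8 * suc c + (a * a + 20 * a + 13 + c * (318 + 36 * a + a * a) + c * c) ≡ ((18 + a) * (18 + a) + suc c) * suc c
      lem = solve-∀
    c< : ∀ c → A ≤ 17 → (A * A + c) * c < 16 * (A + 1) + 8 * c → c < 31
    c< c A≤ bd with c <? 31
    ... | yes p = p
    ... | no ¬p = ⊥-elim (<⇒≱ bd (≤-trans (+-monoˡ-≤ (8 * c) (*-monoʳ-≤ 16 (+-monoˡ-≤ 1 A≤))) (≤-trans big (*-monoˡ-≤ c (m≤n+m c (A * A))))))
      where
      lem : ∀ d → 288 + 8 * (31 + d) + (425 + 54 * d + d * d) ≡ (31 + d) * (31 + d)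
      lem = solve-∀
      big : 288 + 8 * c ≤ c * c
      big = subst (λ c → 288 + 8 * c ≤ c * c) (m+[n∸m]≡n (≮⇒≥ ¬p)) (≤-trans (m≤m+n _ _) (≤-reflexive (lem (c ∸ 31))))
    go : ∀ c → 0 < c → (A * A + c) * c < 16 * (A + 1) + 8 * c → IsTrue (does (search₂? A c))
    go (suc c) 0<c bd = below-sound (λ c → does (search₂? A (suc c))) 30
      (below-sound (λ A → below (λ c → does (search₂? (suc A) (suc c))) 30) 17 searched₂ A' (A'< (suc c) 0<c bd))
      c (s≤s⁻¹ (c< (suc c) (A'< (suc c) 0<c bd) bd))
    finish : ∀ A c → Solution A c → 2 * A + 2 * (A * A) ≡ u * c → 2 * k ≡ (1 + suc u * (1 + suc u * 0)) * A → Exceptional u (suc k) A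
    finish _ _ (inj₁ (refl , refl)) e _ = inj₁ (*-cancelʳ-≡ u 3 4 (sym e))
    finish _ _ (inj₂ (inj₁ (refl , refl))) e e' = inj₂ (inj₁ (u≡ , cong suc (*-cancelˡ-≡ k 15 2 (trans e' (cong (λ u → (1 + suc u * (1 + suc u * 0)) * 3) u≡))) , refl))
      where
      u≡ : u ≡ 8
      u≡ = *-cancelʳ-≡ u 8 3 (sym e)
    finish _ _ (inj₂ (inj₂ (inj₁ (refl , refl)))) e e' = inj₂ (inj₂ (inj₁ (u≡ , cong suc (*-cancelˡ-≡ k 24 2 (trans e' (cong (λ u → (1 + suc u * (1 + suc u * 0)) * 4) u≡))) , refl)))
      where
      u≡ : u ≡ 10
      u≡ = *-cancelʳ-≡ u 10 4 (sym e)
    finish _ _ (inj₂ (inj₂ (inj₂ (refl , refl)))) e e' = inj₂ (inj₂ (inj₂ (u≡ , cong suc (*-cancelˡ-≡ k 55 2 (trans e' (cong (λ u → (1 + suc u * (1 + suc u * 0)) * 5) u≡))) , refl)))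
      where
      u≡ : u ≡ 20
      u≡ = *-cancelʳ-≡ u 20 3 (sym e)

  exceptional : ∀ b u k l A → 2 ≤ b → 0 < u → 2 ≤ k → Equations b u k l A → b ≡ 2 × Exceptional u k A
  exceptional 1 u k l A (s≤s ()) _ _ _
  exceptional 2 u k l A _ 0<u 2≤k eqs = refl , grid-2 0<u 2≤k eqs
  exceptional 3 u k l A _ 0<u _ eqs = ⊥-elim (no-grid-3 0<u eqs)
  exceptional (suc (suc (suc (suc b)))) u k l A _ 0<u _ eqs = ⊥-elim (no-grid≥4 0<u eqs)

  -- For b = 2: r₀, r₁ are the two line sizes at a flag and Y is the number of lines meeting B.
  LineCheck : ℕ → ℕ → ℕ → Set
  LineCheck k A w = ∀ r₀ r₁ Y → 0 < r₀ → 0 < r₁ → r₀ + r₁ ≡ A + 2 → k * (A + 2) ≡ r₀ * r₁ * Y → Y ≤ 2 * w → ⊥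

  lineCheck? : ℕ → ℕ → ℕ → ℕ → ℕ → Bool
  lineCheck? k A w r₀ Y = not (does (k * (A + 2) ≟ suc r₀ * (A + 2 ∸ suc r₀) * Y))

  lineCheck : ∀ k A w → IsTrue (below (λ r₀ → below (lineCheck? k A w r₀) (suc (2 * w))) (A + 2)) → LineCheck k A w
  lineCheck k A w t (suc r₀) r₁ Y _ 0<r₁ sm e le = T-not (k * (A + 2) ≟ suc r₀ * (A + 2 ∸ suc r₀) * Y)
    (below-sound (lineCheck? k A w r₀) (suc (2 * w)) (below-sound (λ r₀ → below (lineCheck? k A w r₀) (suc (2 * w))) (A + 2) t r₀ (≤-trans (m≤m+n (suc r₀) r₁) (≤-reflexive sm))) Y (s≤s le))
    (trans e (cong (λ z → suc r₀ * z * Y) (trans (sym (m+n∸m≡n (suc r₀) r₁)) (cong (_∸ suc r₀) sm))))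

  no-lines : ∀ {u k A} → u ≢ 3 → Exceptional u k A → LineCheck k A (suc u)
  no-lines ne (inj₁ e) = ⊥-elim (ne e)
  no-lines ne (inj₂ (inj₁ (refl , refl , refl))) = lineCheck 16 3 9 tt
  no-lines ne (inj₂ (inj₂ (inj₁ (refl , refl , refl)))) = lineCheck 25 4 11 tt
  no-lines ne (inj₂ (inj₂ (inj₂ (refl , refl , refl)))) = lineCheck 56 5 21 tt

-- Parameters of imprimitive designs

module ImprimitiveArithmetic where
  Conclusion : ℕ → ℕ → ℕ → ℕ → ℕ → Set
  Conclusion c d k l ℓ = k ≡ l * (l + 1) × ((c ≡ l * l × d ≡ l + 2 × ℓ ≡ l) ⊎ (c ≡ l + 2 × d ≡ l * l × ℓ ≡ 2))

  -- x is defined by l (d - 1) = k x and y by l = y + u x, where u = ℓ - 1; then k y = l (ℓ + x).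
  solve-xy : ∀ c' d' k l u x y → 0 < l → k * u ≡ l * c' → l * d' ≡ k * x → l ≡ y + u * x → k * y ≡ l * (suc u + x) →
             y * l < suc u + x + 2 * y → 0 < u → 0 < x → suc u ∣ k → suc u ∣ suc c' * l → Conclusion (suc c') (suc d') k l (suc u)
  solve-xy c' d' k l u x zero 0<l _ _ _ e₃ _ _ _ _ _ = ⊥-elim (<⇒≢ (*-mono-≤ {1} {l} {1} {suc u + x} 0<l (s≤s z≤n)) (trans (sym (*-zeroʳ k)) e₃))
  solve-xy c' d' k l 1 (suc x) 1 0<l e₁ e₂ refl e₃ _ _ _ _ _ = k≡ , inj₂ (trans (cong suc c'≡) (sym (+-suc l 1)) , d≡ , refl)
    where
    k≡' : k ≡ l * (2 + suc x)
    k≡' = trans (sym (*-identityʳ k)) e₃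
    lem₁ : ∀ x → (1 + (1 * suc x)) * (2 + suc x) ≡ (1 + (1 * suc x)) * ((1 + (1 * suc x)) + 1)
    lem₁ = solve-∀
    k≡ : k ≡ l * (l + 1)
    k≡ = trans k≡' (lem₁ x)
    c'≡ : c' ≡ l + 1
    c'≡ = *-cancelˡ-≡ _ _ l (trans (sym e₁) (trans (*-identityʳ k) k≡))
    d'≡ : d' ≡ (2 + suc x) * suc x
    d'≡ = *-cancelˡ-≡ _ _ l (trans e₂ (trans (cong (_* suc x) k≡') (*-assoc l (2 + suc x) (suc x))))
    lem₂ : ∀ x → suc ((2 + suc x) * suc x) ≡ (1 + (1 * suc x)) * (1 + (1 * suc x))
    lem₂ = solve-∀
    d≡ : suc d' ≡ l * l
    d≡ = trans (cong suc d'≡) (lem₂ x)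
  solve-xy c' d' k l (suc u) 1 1 0<l e₁ e₂ refl e₃ _ _ _ _ _ = k≡ , inj₁ (c≡ , trans (cong suc d'≡) (sym (+-suc l 1)) , cong 2+ (sym (*-identityʳ u)))
    where
    k≡' : k ≡ l * (2 + u + 1)
    k≡' = trans (sym (*-identityʳ k)) e₃
    lem₁ : ∀ u → (1 + (suc u * 1)) * (2 + u + 1) ≡ (1 + (suc u * 1)) * ((1 + (suc u * 1)) + 1)
    lem₁ = solve-∀
    k≡ : k ≡ l * (l + 1)
    k≡ = trans k≡' (lem₁ u)
    c'≡ : c' ≡ (2 + u + 1) * suc u
    c'≡ = *-cancelˡ-≡ _ _ l (trans (sym e₁) (trans (cong (_* suc u) k≡') (*-assoc l (2 + u + 1) (suc u))))
    lem₂ : ∀ u → suc ((2 + u + 1) * suc u) ≡ (1 + (suc u * 1)) * (1 + (suc u * 1))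
    lem₂ = solve-∀
    c≡ : suc c' ≡ l * l
    c≡ = trans (cong suc c'≡) (lem₂ u)
    d'≡ : d' ≡ l + 1
    d'≡ = *-cancelˡ-≡ _ _ l (trans e₂ (trans (*-identityʳ k) k≡))
  -- The sporadic triples: `(λ, k, ℓ)` is (5, 25, 3), (7, 42, 3) or (7, 42, 4). They satisfy all the
  -- equations and the inequality, but ℓ does not divide k in the first and the last, nor `c λ = 91`
  -- in the second.
  solve-xy c' d' k _ 2 2 1 _ _ _ refl e₃ _ _ _ ℓ∣k _ = ⊥-elim (toWitnessFalse {a? = 3 ∣? 25} tt (subst (3 ∣_) (trans (sym (*-identityʳ k)) e₃) ℓ∣k))
  solve-xy c' d' k _ 2 3 1 _ e₁ _ refl e₃ _ _ _ _ ℓ∣cl = ⊥-elim (toWitnessFalse {a? = 3 ∣? 91} tt (subst (λ c → 3 ∣ suc c * 7) {c'} {12} c'≡ ℓ∣cl))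
    where
    c'≡ : c' ≡ 12
    k≡ : k ≡ 42
    k≡ = trans (sym (*-identityʳ k)) e₃
    c'≡ = *-cancelˡ-≡ c' 12 7 (trans (sym e₁) (cong (_* 2) {k} {42} k≡))
  solve-xy c' d' k _ 3 2 1 _ _ _ refl e₃ _ _ _ ℓ∣k _ = ⊥-elim (toWitnessFalse {a? = 4 ∣? 42} tt (subst (4 ∣_) (trans (sym (*-identityʳ k)) e₃) ℓ∣k))
  solve-xy c' d' k _ 2 (suc (suc (suc (suc x)))) 1 _ _ _ refl _ sm _ _ _ _ = ⊥-elim (<⇒≱ sm (≤-trans (m≤m+n _ _) (≤-reflexive (lem x))))
    where
    lem : ∀ x → 3 + (4 + x) + 2 * 1 + x ≡ 1 * (1 + 2 * (4 + x))
    lem = solve-∀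
  solve-xy c' d' k _ 3 (suc (suc (suc x))) 1 _ _ _ refl _ sm _ _ _ _ = ⊥-elim (<⇒≱ sm (≤-trans (m≤m+n _ _) (≤-reflexive (lem x))))
    where
    lem : ∀ x → 4 + (3 + x) + 2 * 1 + (1 + 2 * x) ≡ 1 * (1 + 3 * (3 + x))
    lem = solve-∀
  solve-xy c' d' k _ (suc (suc (suc (suc u)))) (suc (suc x)) 1 _ _ _ refl _ sm _ _ _ _ = ⊥-elim (<⇒≱ sm (≤-trans (m≤m+n _ _) (≤-reflexive (lem u x))))
    where
    lem : ∀ u x → 5 + u + (2 + x) + 2 * 1 + (u + 3 * x + u * x) ≡ 1 * (1 + (4 + u) * (2 + x))
    lem = solve-∀
  solve-xy c' d' k _ 1 1 2 _ _ _ refl e₃ _ _ _ _ _ = ⊥-elim (toWitnessFalse {a? = 2 ∣? 9} tt (divides k (sym e₃)))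
  solve-xy c' d' k _ (suc u) (suc (suc x)) 2 _ _ _ refl _ sm _ _ _ _ = ⊥-elim (<⇒≱ sm (≤-trans (m≤m+n _ _) (≤-reflexive (lem u x))))
    where
    lem : ∀ u x → suc (suc u) + (2 + x) + 2 * 2 + (2 * u * x + 3 * u + x) ≡ 2 * (2 + suc u * (2 + x))
    lem = solve-∀
  solve-xy c' d' k _ (suc (suc u)) 1 2 _ _ _ refl _ sm _ _ _ _ = ⊥-elim (<⇒≱ sm (≤-trans (m≤m+n _ _) (≤-reflexive (lem u))))
    where
    lem : ∀ u → suc (suc (suc u)) + 1 + 2 * 2 + u ≡ 2 * (2 + suc (suc u) * 1)
    lem = solve-∀
  solve-xy c' d' k _ (suc u) (suc x) (suc (suc (suc y))) _ _ _ refl _ sm _ _ _ _ = ⊥-elim (<⇒≱ sm (≤-trans (m≤m+n _ _) (≤-reflexive (lem u x y))))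
    where
    lem : ∀ u x y → suc (suc u) + suc x + 2 * (3 + y) + (3 + 5 * y + y * y + 2 * u + 2 * x + 3 * (u * x) + y * u + y * x + y * (u * x)) ≡ (3 + y) * (3 + y + suc u * suc x)
    lem = solve-∀

  -- Writing `c d - 1 = (c - 1) d + (d - 1)` turns the parameter equation into
  -- `k (k - 1) = k u d + λ (d - 1)`, so `k` divides `λ (d - 1)`, with quotient `x = k - 1 - u d`.
  -- Expanding `k λ` with this value of `k` shows that `k` divides `λ (ℓ + x)`, with quotient
  -- `y = λ - u x`. The hypothesis on `k`, multiplied by `y` and divided by λ, becomes `small`.
  conclude : ∀ c d k l ℓ → 1 < c → 1 < d → 2 ≤ k → 1 ≤ l → 1 ≤ ℓ → k * (ℓ ∸ 1) ≡ l * (c ∸ 1) → k * (k ∸ 1) ≡ (c * d ∸ 1) * l →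
             l * l < k + 2 * l → ℓ ∣ k → ℓ ∣ c * l → Conclusion c d k l ℓ
  conclude (suc c') (suc d') k@(suc k') l (suc u) (s≤s 0<c') (s≤s 0<d') 2≤k 0<l _ e₁ par large ℓ∣k ℓ∣cl =
      solve-xy c' d' k l u x y 0<l e₁ e₂ l≡ e₃ small 0<u 0<x ℓ∣k ℓ∣cl
    where
    instance
      l≢0 : NonZero l
      l≢0 = >-nonZero 0<l
    d : ℕ
    d = suc d'
    expand : k * k' ≡ k * (u * d) + l * d'
    expand = trans par (trans (lem c' d' l) (trans (cong (λ t → t * d + l * d') (sym e₁)) (cong (_+ l * d') (*-assoc k u d))))
      where
      lem : ∀ c d l → (d + c * suc d) * l ≡ l * c * suc d + l * d
      lem = solve-∀
    ud≤k' : u * d ≤ k'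
    ud≤k' = *-cancelˡ-≤ k (≤-trans (m≤m+n _ (l * d')) (≤-reflexive (sym expand)))
    x : ℕ
    x = k' ∸ u * d
    k'≡ : k' ≡ u * d + x
    k'≡ = sym (m+[n∸m]≡n ud≤k')
    e₂ : l * d' ≡ k * x
    e₂ = +-cancelˡ-≡ (k * (u * d)) _ _ (trans (sym expand) (trans (cong (k *_) k'≡) (*-distribˡ-+ k (u * d) x)))
    kl : k * l ≡ l * (suc u + x) + k * (u * x)
    kl = trans (cong (λ t → suc t * l) k'≡) (trans (lem u d' x l) (cong (l * (suc u + x) +_) (trans (cong (u *_) e₂) (lem' u k x))))
      where
      lem : ∀ u d x l → suc (u * suc d + x) * l ≡ l * (suc u + x) + u * (l * d)
      lem = solve-∀
      lem' : ∀ u k x → u * (k * x) ≡ k * (u * x)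
      lem' = solve-∀
    ux≤l : u * x ≤ l
    ux≤l = *-cancelˡ-≤ k (≤-trans (m≤n+m _ (l * (suc u + x))) (≤-reflexive (sym kl)))
    y : ℕ
    y = l ∸ u * x
    l≡ : l ≡ y + u * x
    l≡ = sym (m∸n+n≡m ux≤l)
    e₃ : k * y ≡ l * (suc u + x)
    e₃ = +-cancelʳ-≡ (k * (u * x)) _ _ (trans (sym (*-distribˡ-+ k y (u * x))) (trans (cong (k *_) (sym l≡)) kl))
    0<u : 0 < u
    0<u = n≢0⇒n>0 λ z → <⇒≢ (*-mono-≤ 0<l 0<c') (sym (trans (sym e₁) (trans (cong (k *_) z) (*-zeroʳ k))))
    0<x : 0 < x
    0<x = n≢0⇒n>0 λ z → <⇒≢ (*-mono-≤ 0<l 0<d') (sym (trans e₂ (trans (cong (k *_) z) (*-zeroʳ k))))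
    0<y : 0 < y
    0<y = n≢0⇒n>0 λ z → <⇒≢ (*-mono-≤ {1} {l} {1} {suc u + x} 0<l (s≤s z≤n)) (sym (trans (sym e₃) (trans (cong (k *_) z) (*-zeroʳ k))))
    small : y * l < suc u + x + 2 * y
    small = *-cancelˡ-< l _ _ (subst₂ _<_ (lem₁ l y) (trans (*-distribʳ-+ y k (2 * l)) (trans (cong (_+ 2 * l * y) e₃) (lem₂ l (suc u + x) y))) (*-monoˡ-< y {{>-nonZero 0<y}} large))
      where
      lem₁ : ∀ l y → l * l * y ≡ l * (y * l)
      lem₁ = solve-∀
      lem₂ : ∀ l z y → l * z + 2 * l * y ≡ l * (z + 2 * y)
      lem₂ = solve-∀

-- Permutations of at most four points

allVec? : ∀ {m} n {P : Vec (Fin m) n → Set} → (∀ v → Dec (P v)) → Dec (∀ v → P v)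
allVec? zero P? = map′ (λ { p [] → p }) (λ f → f []) (P? [])
allVec? (suc n) P? = map′ (λ { f (x ∷ v) → f x v }) (λ f x v → f (x ∷ v)) (Fin.all? (λ x → allVec? n (λ v → P? (x ∷ v))))

InjectiveFun : ∀ {m} → (Fin m → Fin m) → Set
InjectiveFun f = ∀ a b → f a ≡ f b → a ≡ b

injective? : ∀ {m} (f : Fin m → Fin m) → Dec (InjectiveFun f)
injective? f = Fin.all? (λ a → Fin.all? (λ b → (f a Fin.≟ f b) →-dec (a Fin.≟ b)))

-- A function p on pairs of points such that p (f a) (f b) is determined by f and p a b lets a
-- group acting on m + 1 points act on m points.  Applied to Sym(4) → Sym(3) → Sym(2).
induced : ∀ {m} → (Fin (suc m) → Fin (suc m) → Fin m) → (Fin (suc m) → Fin (suc m)) → Fin m → Fin m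
induced p f j = p (f zero) (f (suc j))

Compatible : ∀ {m} → (Fin (suc m) → Fin (suc m) → Fin m) → (Fin (suc m) → Fin (suc m)) → Set
Compatible p f = ∀ a b → ¬ a ≡ b → p (f a) (f b) ≡ induced p f (p a b)

compatible? : ∀ {m} p (f : Fin (suc m) → Fin (suc m)) → Dec (Compatible p f)
compatible? p f = Fin.all? (λ a → Fin.all? (λ b → ¬? (a Fin.≟ b) →-dec (p (f a) (f b) Fin.≟ induced p f (p a b))))

Identity : ∀ {m} → (Fin m → Fin m) → Set
Identity f = ∀ x → f x ≡ x

identity? : ∀ {m} (f : Fin m → Fin m) → Dec (Identity f)
identity? f = Fin.all? (λ x → f x Fin.≟ x)

-- The three partitions of four points into two pairs; a pair is sent to the partition containing
-- it. The induced map Sym(4) → Sym(3) has the Klein four-group as kernel. Values on the diagonal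
-- are arbitrary.
pairing : Fin 4 → Fin 4 → Fin 3
pairing zero zero = zero
pairing zero (suc j) = j
pairing (suc i) zero = i
pairing (suc zero) (suc (suc zero)) = suc (suc zero)
pairing (suc (suc zero)) (suc zero) = suc (suc zero)
pairing (suc zero) (suc (suc (suc zero))) = suc zero
pairing (suc (suc (suc zero))) (suc zero) = suc zero
pairing (suc _) (suc _) = zero

-- The direction of an ordered pair with respect to the cyclic order 0, 1, 2. The induced action on
-- the two directions is the sign, with kernel Alt(3).
orientation : Fin 3 → Fin 3 → Fin 2
orientation zero zero = zero
orientation zero (suc j) = j
orientation (suc zero) zero = suc zero
orientation (suc (suc zero)) zero = zero
orientation (suc (suc zero)) (suc zero) = suc zero
orientation (suc _) (suc _) = zero

Compat-check : ∀ {m} → (Fin (suc m) → Fin (suc m) → Fin m) → Set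
Compat-check {m} p = ∀ (v : Vec (Fin (suc m)) (suc m)) → InjectiveFun (lookup v) → Compatible p (lookup v)

compat-check? : ∀ {m} p → Dec (Compat-check {m} p)
compat-check? {m} p = allVec? (suc m) (λ v → injective? (lookup v) →-dec compatible? p (lookup v))

Kernel-abelian : ∀ {m} → (Fin (suc m) → Fin (suc m) → Fin m) → Set
Kernel-abelian {m} p = ∀ (v : Vec (Fin (suc m)) (suc m)) → InjectiveFun (lookup v) × Identity (induced p (lookup v)) →
                   ∀ (w : Vec (Fin (suc m)) (suc m)) → InjectiveFun (lookup w) × Identity (induced p (lookup w)) →
                   ∀ x → lookup v (lookup w x) ≡ lookup w (lookup v x)

kernel-abelian? : ∀ {m} p → Dec (Kernel-abelian {m} p)
kernel-abelian? {m} p = allVec? (suc m) (λ v → (injective? (lookup v) ×-dec identity? (induced p (lookup v))) →-dec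
  allVec? (suc m) (λ w → (injective? (lookup w) ×-dec identity? (induced p (lookup w))) →-dec Fin.all? (λ x → lookup v (lookup w x) Fin.≟ lookup w (lookup v x))))

pairing-compat : Compat-check pairing
pairing-compat = toWitness {a? = compat-check? pairing} tt

orientation-compat : Compat-check orientation
orientation-compat = toWitness {a? = compat-check? orientation} tt

pairing-kernel : Kernel-abelian pairing
pairing-kernel = toWitness {a? = kernel-abelian? pairing} tt

orientation-kernel : Kernel-abelian orientation
orientation-kernel = toWitness {a? = kernel-abelian? orientation} tt

-- With a single target point every permutation lies in the kernel, so this is the commutativity of
-- Sym(2).
Sym2-abelian : Kernel-abelian {1} (λ _ _ → zero)
Sym2-abelian = toWitness {a? = kernel-abelian? {1} (λ _ _ → zero)} tt

-- Finite groups, actions and flag-transitive designs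

record FinGroup (n : ℕ) : Set where
  infixl 7 _∙_
  infix 8 _⁻¹
  field
    _∙_ : Fin n → Fin n → Fin n
    ε   : Fin n
    _⁻¹ : Fin n → Fin n
    isGroup : IsGroup _≡_ _∙_ ε _⁻¹

record Action {n : ℕ} (G : FinGroup n) (v : ℕ) : Set where
  open FinGroup G
  field
    act   : Fin n → Fin v → Fin v
    act-∙ : ∀ g h x → act (g ∙ h) x ≡ act g (act h x)
    act-ε : ∀ x → act ε x ≡ x
    faithful : ∀ g → (∀ x → act g x ≡ x) → g ≡ ε

-- Symmetry of the design is expressed by indexing the blocks by the same `Fin v` as the points.
-- `large` is `k > λ(λ - 2)` without subtraction, so that λ = 1 is treated correctly.
record FlagDesign (v k l : ℕ) {n : ℕ} (G : FinGroup n) (A : Action G v) : Set₁ where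
  open Action A
  field
    {I}  : Fin v → Fin v → Set
    I?   : ∀ x B → Dec (I x B)
    block-size : ∀ B → # (mk (λ x → I? x B)) ≡ k
    pair-blocks : ∀ {x y} → x ≢ y → # (mk (λ B → I? x B ×-dec I? y B)) ≡ l
    2≤k : 2 ≤ k
    k<v : k < v
    1≤l : 1 ≤ l
    large : l * l < k + 2 * l
    flag : ∀ {x y B C} → I x B → I y C → Σ[ g ∈ Fin n ] (act g x ≡ y × (∀ z → I z B → I (act g z) C) × (∀ z → I (act g z) C → I z B))

-- Subsets, lists and permutation groups

open import Data.Fin.Subset using (Subset; inside; outside; _∩_) renaming (_∈_ to _∈ₛ_; ∣_∣ to card)

∣subset∣ : ∀ {n} (S : Subset n) → card S ≡ # (mk (_∈? S))
∣subset∣ [] = sym (sum-zero _)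
∣subset∣ (s ∷ S) = sym (trans (sum-suc _) (trans (cong₂ _+_ refl (trans (sum-cong-≗ (λ x → ind-cong (suc x ∈? (s ∷ S)) (x ∈? S) drop-there there)) (sym (∣subset∣ S)))) (head s)))
  where
  head : ∀ s → ind (zero ∈? (s ∷ S)) + card S ≡ card (s ∷ S)
  head true = cong (_+ card S) (ind-yes (zero ∈? (inside ∷ S)) here)
  head false = cong (_+ card S) (ind-no (zero ∈? (outside ∷ S)) λ ())

length-filter : ∀ {A : Set} {P : A → Set} (P? : ∀ x → Dec (P x)) (xs : List A) {m} (eq : m ≡ length xs) →
                length (filter P? xs) ≡ # (mk {m} (λ j → P? (List.lookup xs (cast eq j))))
length-filter P? [] refl = sym (sum-zero _)
length-filter P? (x ∷ xs) refl = trans (head (P? x)) (sym (sum-suc _))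
  where
  rest : ℕ
  rest = sum (λ j → ind (P? (List.lookup xs (cast refl j))))
  head : Dec _ → length (filter P? (x ∷ xs)) ≡ ind (P? x) + rest
  head _ with P? x | length-filter P? xs refl
  ... | yes p | e = trans (cong suc e) (cong (_+ rest) (sym (ind-yes (yes p) p)))
  ... | no ¬p | e = trans e (cong (_+ rest) (sym (ind-no (no ¬p) ¬p)))

∈⇒lookup : ∀ {n} {x : Fin n} {S} → x ∈ₛ S → lookup S x ≡ true
∈⇒lookup = []=⇒lookup

lookup⇒∈ : ∀ {n} {x : Fin n} {S} → lookup S x ≡ true → x ∈ₛ S
lookup⇒∈ {x = x} {S} = lookup⇒[]= x S

subset : ∀ {n} → DSet n → Subset n
subset X = tabulate (λ x → does (mem? X x))

∈subset⁺ : ∀ {n} (X : DSet n) {x} → x ∊ X → x ∈ₛ subset X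
∈subset⁺ X {x} p = lookup⇒∈ (trans (lookup∘tabulate _ x) (dec-true (mem? X x) p))

∈subset⁻ : ∀ {n} (X : DSet n) {x} → x ∈ₛ subset X → x ∊ X
∈subset⁻ X {x} p = does-true (mem? X x) (trans (sym (lookup∘tabulate _ x)) (∈⇒lookup p))
  where
  does-true : ∀ {P : Set} (d : Dec P) → does d ≡ true → P
  does-true (yes p) _ = p

∈image : ∀ {v} (g : Permutation′ v) B {y} → lookup (image g B) y ≡ lookup B (g ⟨$⟩ˡ y)
∈image g B {y} = lookup∘tabulate _ y

∈image⁺ : ∀ {v} (g : Permutation′ v) B {x} → x ∈ₛ B → g ⟨$⟩ʳ x ∈ₛ image g B
∈image⁺ g B {x} p = lookup⇒∈ (trans (∈image g B) (trans (cong (lookup B) (Perm.inverseˡ g)) (∈⇒lookup p)))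

∈image⁻ : ∀ {v} (g : Permutation′ v) B {x} → g ⟨$⟩ʳ x ∈ₛ image g B → x ∈ₛ B
∈image⁻ g B {x} p = lookup⇒∈ (trans (cong (lookup B) (sym (Perm.inverseˡ g))) (trans (sym (∈image g B)) (∈⇒lookup p)))

-- The elements of a permutation group, listed without repetitions, form a group on Fin n.
record Realisation {v : ℕ} (G : PermGroup v) : Set where
  field
    n      : ℕ
    group  : FinGroup n
    action : Action group v
    perm   : Fin n → Permutation′ v
    perm-act : ∀ i x → Action.act action i x ≡ perm i ⟨$⟩ʳ x
    perm∈  : ∀ i → perm i ∈ᴳ G
    index  : ∀ g → g ∈ᴳ G → Σ[ i ∈ Fin n ] perm i ≈ g

funToFin-cong : ∀ {m n} {f g : Fin m → Fin n} → (∀ x → f x ≡ g x) → funToFin f ≡ funToFin g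
funToFin-cong {zero} h = refl
funToFin-cong {suc m} h = cong₂ combine (h zero) (funToFin-cong (h ∘ suc))

realise : ∀ {v} (G : PermGroup v) → Realisation G
realise {v} G = record { n = E.size ; group = group ; action = action ; perm = perm ; perm-act = λ _ _ → refl ; perm∈ = perm∈ ; index = index }
  where
  open PermGroup G
  -- Every function on `Fin v` has a code, so the group is found by searching all codes, and a code
  -- of the inverse is sought along with each.
  Code : Set
  Code = Fin (v ^ v)

  fun : Code → Fin v → Fin v
  fun = finToFun

  Inv : Code → Code → Set
  Inv c c' = (∀ x → fun c (fun c' x) ≡ x) × (∀ x → fun c' (fun c x) ≡ x)

  mkPerm : ∀ c c' → Inv c c' → Permutation′ v
  mkPerm c c' (p , q) = permutation (fun c) (fun c') p q

  InG : Code → Set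
  InG c = Σ[ c' ∈ Code ] Σ[ p ∈ Inv c c' ] mkPerm c c' p ∈ᴳ G

  inG? : ∀ c → Dec (InG c)
  inG? c = Fin.any? (λ c' → step c' (Fin.all? (λ x → fun c (fun c' x) Fin.≟ x) ×-dec Fin.all? (λ x → fun c' (fun c x) Fin.≟ x)))
    where
    step : ∀ c' → Dec (Inv c c') → Dec (Σ[ p ∈ Inv c c' ] mkPerm c c' p ∈ᴳ G)
    step c' (no ¬p) = no (¬p ∘ proj₁)
    step c' (yes p) = map′ (p ,_) (λ (q , m) → resp (λ _ → refl) m) (member? (mkPerm c c' p))

  E : Enumeration (mk inG?)
  E = enumerate (mk inG?)

  module E = Enumeration E

  perm : Fin E.size → Permutation′ v
  perm i = let c' , p , _ = E.to∊ i in mkPerm (E.to i) c' p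

  perm∈ : ∀ i → perm i ∈ᴳ G
  perm∈ i = proj₂ (proj₂ (E.to∊ i))

  perm-injective : ∀ {i j} → perm i ≈ perm j → i ≡ j
  perm-injective {i} {j} h = E.inj (trans (sym (Fin.funToFin-finToFin {v} {v} (E.to i))) (trans (funToFin-cong h) (Fin.funToFin-finToFin {v} {v} (E.to j))))

  index : ∀ g → g ∈ᴳ G → Σ[ i ∈ Fin E.size ] perm i ≈ g
  index g g∈ = let i , e = E.from c (c' , inv , resp (λ x → sym (fc x)) g∈) in i , λ x → trans (cong (λ c → fun c x) e) (fc x)
    where
    c c' : Code
    c = funToFin (g ⟨$⟩ʳ_)
    c' = funToFin (g ⟨$⟩ˡ_)
    fc : ∀ x → fun c x ≡ g ⟨$⟩ʳ x
    fc = Fin.finToFun-funToFin (g ⟨$⟩ʳ_)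
    fc' : ∀ x → fun c' x ≡ g ⟨$⟩ˡ x
    fc' = Fin.finToFun-funToFin (g ⟨$⟩ˡ_)
    inv : Inv c c'
    inv = (λ x → trans (fc _) (trans (cong (g ⟨$⟩ʳ_) (fc' x)) (Perm.inverseʳ g))) , (λ x → trans (fc' _) (trans (cong (g ⟨$⟩ˡ_) (fc x)) (Perm.inverseˡ g)))

  ix : ∀ g → g ∈ᴳ G → Fin E.size
  ix g g∈ = proj₁ (index g g∈)

  _∙_ : Fin E.size → Fin E.size → Fin E.size
  -- `∘ₚ` applies its left argument first; the reversal makes the points a left action.
  i ∙ j = ix (perm j ∘ₚ perm i) (∘-closed (perm∈ j) (perm∈ i))

  ε : Fin E.size
  ε = ix Perm.id id-closed

  _⁻¹ : Fin E.size → Fin E.size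
  i ⁻¹ = ix (flip (perm i)) (inv-closed (perm∈ i))

  ∙-act : ∀ i j x → perm (i ∙ j) ⟨$⟩ʳ x ≡ perm i ⟨$⟩ʳ (perm j ⟨$⟩ʳ x)
  ∙-act i j = proj₂ (index (perm j ∘ₚ perm i) (∘-closed (perm∈ j) (perm∈ i)))

  ε-act : ∀ x → perm ε ⟨$⟩ʳ x ≡ x
  ε-act = proj₂ (index Perm.id id-closed)

  ⁻¹-act : ∀ i x → perm (i ⁻¹) ⟨$⟩ʳ x ≡ perm i ⟨$⟩ˡ x
  ⁻¹-act i = proj₂ (index (flip (perm i)) (inv-closed (perm∈ i)))

  group : FinGroup E.size
  group = record { _∙_ = _∙_ ; ε = ε ; _⁻¹ = _⁻¹ ; isGroup = record
    { isMonoid = record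
      { isSemigroup = record
        { isMagma = record { isEquivalence = isEquivalence ; ∙-cong = cong₂ _∙_ }
        ; assoc = λ i j k → perm-injective λ x → trans (∙-act (i ∙ j) k x) (trans (∙-act i j _) (sym (trans (∙-act i (j ∙ k) x) (cong (perm i ⟨$⟩ʳ_) (∙-act j k x))))) }
      ; identity = (λ i → perm-injective λ x → trans (∙-act ε i x) (ε-act _)) , (λ i → perm-injective λ x → trans (∙-act i ε x) (cong (perm i ⟨$⟩ʳ_) (ε-act x))) }
    ; inverse = (λ i → perm-injective λ x → trans (∙-act (i ⁻¹) i x) (trans (⁻¹-act i _) (trans (Perm.inverseˡ (perm i)) (sym (ε-act x)))))
              , (λ i → perm-injective λ x → trans (∙-act i (i ⁻¹) x) (trans (cong (perm i ⟨$⟩ʳ_) (⁻¹-act i x)) (trans (Perm.inverseʳ (perm i)) (sym (ε-act x)))))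
    ; ⁻¹-cong = cong _⁻¹ } }

  action : Action group v
  action = record { act = λ i x → perm i ⟨$⟩ʳ x ; act-∙ = ∙-act ; act-ε = ε-act
    ; faithful = λ i h → perm-injective λ x → trans (h x) (sym (ε-act x)) }

-- Finite groups: word identities, subgroups, orders

module GroupTheory {n : ℕ} (G : FinGroup n) where
  open FinGroup G public
  open IsGroup isGroup public using (assoc; identityˡ; identityʳ; inverseˡ; inverseʳ)

  group : Group _ _
  group = record { isGroup = isGroup }
  open GroupProperties group using (⁻¹-anti-homo-∙; ⁻¹-involutive; ε⁻¹≈ε)

  infixl 7 _·_
  infix 8 _⁻
  -- Free reduction: both sides of an identity become reduced lists of signed letters, so an
  -- identity valid in free groups is proved by `refl`.
  data Expr (k : ℕ) : Set where
    var : Fin k → Expr k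
    _·_ : Expr k → Expr k → Expr k
    _⁻  : Expr k → Expr k
    :ε  : Expr k

  Word : ℕ → Set
  Word k = List (Bool × Fin k)

  ⟦_⟧ : ∀ {k} → Expr k → Vec (Fin n) k → Fin n
  ⟦ var i ⟧ ρ = lookup ρ i
  ⟦ a · b ⟧ ρ = ⟦ a ⟧ ρ ∙ ⟦ b ⟧ ρ
  ⟦ a ⁻ ⟧ ρ = ⟦ a ⟧ ρ ⁻¹
  ⟦ :ε ⟧ ρ = ε

  signed : Bool → Fin n → Fin n
  signed true x = x
  signed false x = x ⁻¹

  evalWord : ∀ {k} → Word k → Vec (Fin n) k → Fin n
  evalWord [] ρ = ε
  evalWord ((s , i) ∷ w) ρ = signed s (lookup ρ i) ∙ evalWord w ρ

  cons : ∀ {k} → Bool → Fin k → Word k → Word k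
  cons s i [] = (s , i) ∷ []
  cons true i ((false , j) ∷ w) = if does (i Fin.≟ j) then w else (true , i) ∷ (false , j) ∷ w
  cons false i ((true , j) ∷ w) = if does (i Fin.≟ j) then w else (false , i) ∷ (true , j) ∷ w
  cons true i ((true , j) ∷ w) = (true , i) ∷ (true , j) ∷ w
  cons false i ((false , j) ∷ w) = (false , i) ∷ (false , j) ∷ w

  push : ∀ {k} → Expr k → Bool → Word k → Word k
  push (var i) s w = cons s i w
  push (a · b) true w = push a true (push b true w)
  push (a · b) false w = push b false (push a false w)
  push (a ⁻) s w = push a (not s) w
  push :ε s w = w

  cons-sound : ∀ {k} s i (w : Word k) ρ → evalWord (cons s i w) ρ ≡ signed s (lookup ρ i) ∙ evalWord w ρ
  cons-sound true i [] ρ = refl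
  cons-sound false i [] ρ = refl
  cons-sound true i ((true , j) ∷ w) ρ = refl
  cons-sound false i ((false , j) ∷ w) ρ = refl
  cons-sound true i ((false , j) ∷ w) ρ with i Fin.≟ j
  ... | no _ = refl
  ... | yes refl = sym (trans (sym (assoc _ _ _)) (trans (cong (_∙ evalWord w ρ) (inverseʳ _)) (identityˡ _)))
  cons-sound false i ((true , j) ∷ w) ρ with i Fin.≟ j
  ... | no _ = refl
  ... | yes refl = sym (trans (sym (assoc _ _ _)) (trans (cong (_∙ evalWord w ρ) (inverseˡ _)) (identityˡ _)))

  push-sound : ∀ {k} (e : Expr k) s w ρ → evalWord (push e s w) ρ ≡ signed s (⟦ e ⟧ ρ) ∙ evalWord w ρ
  push-sound (var i) s w ρ = cons-sound s i w ρ
  push-sound (a · b) true w ρ = trans (push-sound a true _ ρ) (trans (cong (⟦ a ⟧ ρ ∙_) (push-sound b true w ρ)) (sym (assoc _ _ _)))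
  push-sound (a · b) false w ρ = trans (push-sound b false _ ρ) (trans (cong (⟦ b ⟧ ρ ⁻¹ ∙_) (push-sound a false w ρ))
    (trans (sym (assoc _ _ _)) (cong (_∙ evalWord w ρ) (sym (⁻¹-anti-homo-∙ _ _)))))
  push-sound (a ⁻) true w ρ = push-sound a false w ρ
  push-sound (a ⁻) false w ρ = trans (push-sound a true w ρ) (cong (_∙ evalWord w ρ) (sym (⁻¹-involutive _)))
  push-sound :ε true w ρ = sym (identityˡ _)
  push-sound :ε false w ρ = sym (trans (cong (_∙ evalWord w ρ) ε⁻¹≈ε) (identityˡ _))

  open Reflection (setoid (Fin n)) var ⟦_⟧ (λ e ρ → evalWord (push e true []) ρ)
    (λ e ρ → trans (push-sound e true [] ρ) (identityʳ _)) public using (solve; _⊜_)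

  infixl 6 _▷_
  _▷_ : Fin n → Fin n → Fin n
  g ▷ x = g ∙ x ∙ g ⁻¹

  infixl 7 _:▷_
  _:▷_ : ∀ {k} → Expr k → Expr k → Expr k
  g :▷ x = g · x · g ⁻

  ▷-∙ : ∀ g x y → g ▷ (x ∙ y) ≡ (g ▷ x) ∙ (g ▷ y)
  ▷-∙ = solve 3 (λ g x y → g :▷ (x · y) ⊜ (g :▷ x) · (g :▷ y)) refl

  ▷-▷ : ∀ g h x → g ▷ (h ▷ x) ≡ (g ∙ h) ▷ x
  ▷-▷ = solve 3 (λ g h x → g :▷ (h :▷ x) ⊜ (g · h) :▷ x) refl

  ▷-⁻¹ : ∀ g x → (g ▷ x) ⁻¹ ≡ g ▷ (x ⁻¹)
  ▷-⁻¹ = solve 2 (λ g x → (g :▷ x) ⁻ ⊜ g :▷ (x ⁻)) refl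

  ▷-cancelˡ : ∀ g x → g ⁻¹ ▷ (g ▷ x) ≡ x
  ▷-cancelˡ = solve 2 (λ g x → (g ⁻) :▷ (g :▷ x) ⊜ x) refl

  ▷-cancelʳ : ∀ g x → g ▷ (g ⁻¹ ▷ x) ≡ x
  ▷-cancelʳ = solve 2 (λ g x → g :▷ ((g ⁻) :▷ x) ⊜ x) refl

  ▷-injective : ∀ g {x y} → g ▷ x ≡ g ▷ y → x ≡ y
  ▷-injective g {x} {y} e = trans (sym (▷-cancelˡ g x)) (trans (cong (g ⁻¹ ▷_) e) (▷-cancelˡ g y))

  Commutes : Fin n → Fin n → Set
  Commutes x y = x ∙ y ≡ y ∙ x

  comm⇒▷ : ∀ {x y} → Commutes x y → x ▷ y ≡ y
  comm⇒▷ {x} {y} e = trans (cong (_∙ x ⁻¹) e) (solve 2 (λ y x → y · x · x ⁻ ⊜ y) refl y x)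

  ▷⇒comm : ∀ {x y} → x ▷ y ≡ y → Commutes x y
  ▷⇒comm {x} {y} e = trans (solve 2 (λ x y → x · y ⊜ (x :▷ y) · x) refl x y) (cong (_∙ x) e)

  comm-∙ : ∀ {x y z} → Commutes x z → Commutes y z → Commutes (x ∙ y) z
  comm-∙ {x} {y} {z} p q = trans (assoc x y z) (trans (cong (x ∙_) q) (trans (sym (assoc x z y)) (trans (cong (_∙ y) p) (assoc z x y))))

  comm-⁻¹ : ∀ {x z} → Commutes x z → Commutes (x ⁻¹) z
  comm-⁻¹ {x} {z} p = trans (solve 2 (λ x z → x ⁻ · z ⊜ x ⁻ · (z · x) · x ⁻) refl x z)
    (trans (cong (λ t → x ⁻¹ ∙ t ∙ x ⁻¹) (sym p)) (solve 2 (λ x z → x ⁻ · (x · z) · x ⁻ ⊜ z · x ⁻) refl x z))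

  comm-▷ : ∀ g {x y} → Commutes x y → Commutes (g ▷ x) (g ▷ y)
  comm-▷ g {x} {y} p = trans (sym (▷-∙ g x y)) (trans (cong (g ▷_) p) (▷-∙ g y x))

  record Sub : Set₁ where
    field
      set : DSet n
      ε∈  : ε ∊ set
      ∙∈  : ∀ {x y} → x ∊ set → y ∊ set → x ∙ y ∊ set
      ⁻¹∈ : ∀ {x} → x ∊ set → x ⁻¹ ∊ set

  open Sub public

  infix 4 _∈'_ _⊆'_
  _∈'_ : Fin n → Sub → Set
  x ∈' H = x ∊ set H

  _⊆'_ : Sub → Sub → Set
  H ⊆' K = ∀ x → x ∈' H → x ∈' K

  _∈?'_ : ∀ x H → Dec (x ∈' H)
  x ∈?' H = mem? (set H) x

  ∥_∥ : Sub → ℕ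
  ∥ H ∥ = # (set H)

  IsTrivial : Sub → Set
  IsTrivial H = ∀ x → x ∈' H → x ≡ ε

  infix 4 _⊲_
  _⊲_ : Sub → Sub → Set
  K ⊲ N = K ⊆' N × (∀ g x → g ∈' N → x ∈' K → g ▷ x ∈' K)

  CommuteWith : Sub → Sub → Set
  CommuteWith H K = ∀ x y → x ∈' H → y ∈' K → Commutes x y

  ∈-cong : ∀ (H : Sub) {x y} → x ≡ y → x ∈' H → y ∈' H
  ∈-cong H refl p = p

  infixr 7 _⊓_
  _⊓_ : Sub → Sub → Sub
  H ⊓ K = record { set = set H ⊓ˢ set K ; ε∈ = ε∈ H , ε∈ K
    ; ∙∈ = λ (a , b) (c , d) → ∙∈ H a c , ∙∈ K b d ; ⁻¹∈ = λ (a , b) → ⁻¹∈ H a , ⁻¹∈ K b }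

  whole : Sub
  whole = record { set = full ; ε∈ = refl ; ∙∈ = λ _ _ → refl ; ⁻¹∈ = λ _ → refl }

  trivial : Sub
  trivial = record { set = single ε ; ε∈ = refl ; ∙∈ = λ { refl refl → identityˡ ε } ; ⁻¹∈ = λ { refl → ε⁻¹≈ε } }

  centralizer : Sub → Sub → Sub
  centralizer N K = record
    { set = mk (λ x → (x ∈?' N) ×-dec Fin.all? (λ y → (y ∈?' K) →-dec (x ∙ y Fin.≟ y ∙ x)))
    ; ε∈ = ε∈ N , (λ y _ → trans (identityˡ y) (sym (identityʳ y)))
    ; ∙∈ = λ (p , f) (q , g) → ∙∈ N p q , (λ y y∈ → comm-∙ (f y y∈) (g y y∈))
    ; ⁻¹∈ = λ (p , f) → ⁻¹∈ N p , (λ y y∈ → comm-⁻¹ (f y y∈)) }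

  conjugate : Fin n → Sub → Sub
  conjugate g H = record
    { set = mk (λ x → (g ⁻¹ ▷ x) ∈?' H)
    ; ε∈ = ∈-cong H (solve 1 (λ g → :ε ⊜ (g ⁻) :▷ :ε) refl g) (ε∈ H)
    ; ∙∈ = λ p q → ∈-cong H (sym (▷-∙ (g ⁻¹) _ _)) (∙∈ H p q)
    ; ⁻¹∈ = λ p → ∈-cong H (▷-⁻¹ (g ⁻¹) _) (⁻¹∈ H p) }

  ▷∈conjugate : ∀ g H {x} → x ∈' H → g ▷ x ∈' conjugate g H
  ▷∈conjugate g H p = ∈-cong H (sym (▷-cancelˡ g _)) p

  opaque
    ∣conjugate∣ : ∀ g H → ∥ conjugate g H ∥ ≡ ∥ H ∥
    ∣conjugate∣ g H = #-bij _ _ (g ⁻¹ ▷_) (g ▷_) (▷-cancelˡ g) (▷-cancelʳ g) (λ _ p → p) (λ _ p → ▷∈conjugate g H p)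

  product : (H K : Sub) → (∀ h x → h ∈' H → x ∈' K → h ▷ x ∈' K) → Sub
  product H K nrm = record
    { set = mk (λ x → Fin.any? (λ h → (h ∈?' H) ×-dec ((h ⁻¹ ∙ x) ∈?' K)))
    ; ε∈ = ε , ε∈ H , ∈-cong K (sym (inverseˡ ε)) (ε∈ K)
    ; ∙∈ = λ {x} {y} (h , h∈ , p) (h' , h'∈ , q) → h ∙ h' , ∙∈ H h∈ h'∈ ,
        ∈-cong K (solve 4 (λ h h' x y → (h' ⁻) :▷ (h ⁻ · x) · (h' ⁻ · y) ⊜ (h · h') ⁻ · (x · y)) refl h h' x y)
          (∙∈ K (nrm (h' ⁻¹) _ (⁻¹∈ H h'∈) p) q)
    ; ⁻¹∈ = λ {x} (h , h∈ , p) → h ⁻¹ , ⁻¹∈ H h∈ ,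
        ∈-cong K (solve 2 (λ h x → h :▷ ((h ⁻ · x) ⁻) ⊜ h ⁻ ⁻ · x ⁻) refl h x) (nrm h _ h∈ (⁻¹∈ K p)) }

  double-coset : Sub → Fin n → Sub → DSet n
  double-coset A x B = mk (λ y → Fin.any? (λ a → (a ∈?' A) ×-dec ((x ⁻¹ ∙ a ⁻¹ ∙ y) ∈?' B)))

  opaque
    -- Count the pairs (a, y) with `y ∈ a x B`: for fixed `a` they form a coset of `B`, for fixed
    -- `y` a coset of `A ∩ x B x⁻¹`.
    ∣double-coset∣ : ∀ A x B → ∥ A ∥ * ∥ B ∥ ≡ # (double-coset A x B) * ∥ A ⊓ conjugate x B ∥
    ∣double-coset∣ A x B = double-count (set A) (double-coset A x B)
      (λ a y → (a ∈?' A) ×-dec ((x ⁻¹ ∙ a ⁻¹ ∙ y) ∈?' B)) ∥ B ∥ ∥ A ⊓ conjugate x B ∥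
      (λ a y r → proj₁ r , a , r)
      (λ a a∈ → #-bij _ _ (λ y → x ⁻¹ ∙ a ⁻¹ ∙ y) (λ b → a ∙ x ∙ b)
         (solve 3 (λ a x b → x ⁻ · a ⁻ · (a · x · b) ⊜ b) refl a x)
         (solve 3 (λ a x b → a · x · (x ⁻ · a ⁻ · b) ⊜ b) refl a x)
         (λ _ → proj₂) (λ b b∈ → a∈ , ∈-cong B (sym (solve 3 (λ a x b → x ⁻ · a ⁻ · (a · x · b) ⊜ b) refl a x b)) b∈))
      (λ { y (a₀ , a₀∈ , q) → #-bij _ _ (λ a → a ⁻¹ ∙ a₀) (λ z → a₀ ∙ z ⁻¹)
         (solve 2 (λ a z → (a · z ⁻) ⁻ · a ⊜ z) refl a₀)
         (solve 2 (λ a₀ a → a₀ · (a ⁻ · a₀) ⁻ ⊜ a) refl a₀)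
         (λ { a (a∈ , p) → ∙∈ A (⁻¹∈ A a∈) a₀∈ ,
              ∈-cong B (solve 4 (λ x a a₀ y → x ⁻ · a ⁻ · y · (x ⁻ · a₀ ⁻ · y) ⁻ ⊜ (x ⁻) :▷ (a ⁻ · a₀)) refl x a a₀ y)
                (∙∈ B p (⁻¹∈ B q)) })
         (λ { z (z∈ , p) → ∙∈ A a₀∈ (⁻¹∈ A z∈) ,
              ∈-cong B (solve 4 (λ x z a₀ y → (x ⁻) :▷ z · (x ⁻ · a₀ ⁻ · y) ⊜ x ⁻ · (a₀ · z ⁻) ⁻ · y) refl x z a₀ y)
                (∙∈ B p q) }) })

  opaque
    lagrange : ∀ H K → H ⊆' K → ∥ H ∥ ∣ ∥ K ∥
    lagrange H K le = ∣-classes cosets (set K) ∥ H ∥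
      (λ x y r x∈ → ∈-cong K (solve 2 (λ x y → x · (x ⁻ · y) ⊜ y) refl x y) (∙∈ K x∈ (le _ r)))
      (λ x x∈ → ∣-reflexive (sym (#-bij _ _ (x ⁻¹ ∙_) (x ∙_) (solve 2 (λ x z → x ⁻ · (x · z) ⊜ z) refl x)
          (solve 2 (λ x z → x · (x ⁻ · z) ⊜ z) refl x) (λ _ p → p)
          (λ z p → ∈-cong H (solve 2 (λ x z → z ⊜ x ⁻ · (x · z)) refl x z) p))))
      where
      cosets : DEquiv n
      cosets = record { ~? = λ x y → (x ⁻¹ ∙ y) ∈?' H ; ~refl = λ x → ∈-cong H (sym (inverseˡ x)) (ε∈ H)
        ; ~sym = λ {x} {y} p → ∈-cong H (solve 2 (λ x y → (x ⁻ · y) ⁻ ⊜ y ⁻ · x) refl x y) (⁻¹∈ H p)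
        ; ~trans = λ {x} {y} {z} p q → ∈-cong H (solve 3 (λ x y z → x ⁻ · y · (y ⁻ · z) ⊜ x ⁻ · z) refl x y z) (∙∈ H p q) }

  ∣Sub∣-pos : ∀ H → 0 < ∥ H ∥
  ∣Sub∣-pos H = #-pos (set H) ε (ε∈ H)

  opaque
    ∣factor∣ : ∀ W X Y → X ⊆' W → Y ⊆' W → (∀ x → x ∈' X → x ∈' Y → x ≡ ε) →
               (∀ w → w ∈' W → Σ[ x ∈ Fin n ] (x ∈' X × x ⁻¹ ∙ w ∈' Y)) → ∥ W ∥ ≡ ∥ X ∥ * ∥ Y ∥
    ∣factor∣ W X Y XW YW meet fac = begin
      ∥ W ∥                                        ≡⟨ *-identityʳ _ ⟨
      ∥ W ∥ * 1                                    ≡⟨ cong₂ _*_ (#-cong (set W) (double-coset X ε Y) to fro) one ⟩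
      # (double-coset X ε Y) * ∥ X ⊓ conjugate ε Y ∥ ≡⟨ ∣double-coset∣ X ε Y ⟨
      ∥ X ∥ * ∥ Y ∥                               ∎
      where
      open ≡-Reasoning
      to : set W ⊑ double-coset X ε Y
      to w w∈ = let x , x∈ , p = fac w w∈ in x , x∈ , ∈-cong Y (solve 2 (λ x w → x ⁻ · w ⊜ :ε ⁻ · x ⁻ · w) refl x w) p
      fro : double-coset X ε Y ⊑ set W
      fro w (x , x∈ , p) = ∈-cong W (solve 2 (λ x w → x · (:ε ⁻ · x ⁻ · w) ⊜ w) refl x w) (∙∈ W (XW x x∈) (YW _ p))
      one : 1 ≡ ∥ X ⊓ conjugate ε Y ∥
      one = sym (trans (#-cong (set (X ⊓ conjugate ε Y)) (single ε)
        (λ { x (p , q) → meet x p (∈-cong Y (solve 1 (λ x → (:ε ⁻) :▷ x ⊜ x) refl x) q) })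
        (λ { x refl → ε∈ (X ⊓ conjugate ε Y) })) (#-single ε))

  pow : Fin n → ℕ → Fin n
  pow x zero = ε
  pow x (suc m) = x ∙ pow x m

  pow-+ : ∀ x m k → pow x (m + k) ≡ pow x m ∙ pow x k
  pow-+ x zero k = sym (identityˡ _)
  pow-+ x (suc m) k = trans (cong (x ∙_) (pow-+ x m k)) (sym (assoc _ _ _))

  pow-* : ∀ x m k → pow x (m * k) ≡ pow (pow x k) m
  pow-* x zero k = refl
  pow-* x (suc m) k = trans (pow-+ x k (m * k)) (cong (pow x k ∙_) (pow-* x m k))

  pow-∈ : ∀ (H : Sub) {x} → x ∈' H → ∀ m → pow x m ∈' H
  pow-∈ H x∈ zero = ε∈ H
  pow-∈ H x∈ (suc m) = ∙∈ H x∈ (pow-∈ H x∈ m)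

  pow-▷ : ∀ g x m → g ▷ pow x m ≡ pow (g ▷ x) m
  pow-▷ g x zero = solve 1 (λ g → g :▷ :ε ⊜ :ε) refl g
  pow-▷ g x (suc m) = trans (▷-∙ g x _) (cong ((g ▷ x) ∙_) (pow-▷ g x m))

  pow-comm : ∀ {x y} → Commutes x y → ∀ m → Commutes (pow x m) y
  pow-comm c zero = trans (identityˡ _) (sym (identityʳ _))
  pow-comm c (suc m) = comm-∙ c (pow-comm c m)

  pow-∙ : ∀ {x y} → Commutes x y → ∀ m → pow (x ∙ y) m ≡ pow x m ∙ pow y m
  pow-∙ c zero = sym (identityˡ ε)
  pow-∙ {x} {y} c (suc m) = trans (cong (x ∙ y ∙_) (pow-∙ c m)) (trans (solve 4 (λ x y a b → x · y · (a · b) ⊜ x · (y · a) · b) refl x y (pow x m) (pow y m))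
    (trans (cong (λ t → x ∙ t ∙ pow y m) (sym (pow-comm c m))) (solve 4 (λ x y a b → x · (a · y) · b ⊜ (x · a) · (y · b)) refl x y (pow x m) (pow y m))))

  pow-ε : ∀ m → pow ε m ≡ ε
  pow-ε zero = refl
  pow-ε (suc m) = trans (identityˡ _) (pow-ε m)

  finite-order : ∀ x → Σ[ o ∈ ℕ ] (0 < o × pow x o ≡ ε)
  finite-order x with Fin.pigeonhole (n<1+n n) (λ i → pow x (toℕ i))
  ... | i , j , i<j , e = toℕ j ∸ toℕ i , m<n⇒0<n∸m i<j ,
        trans (solve 2 (λ a b → b ⊜ a ⁻ · (a · b)) refl (pow x (toℕ i)) _)
          (trans (cong (pow x (toℕ i) ⁻¹ ∙_) (trans (sym (pow-+ x (toℕ i) _)) (trans (cong (pow x) (m+[n∸m]≡n (<⇒≤ i<j))) (sym e)))) (inverseˡ _))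

  -- Remove primes from an exponent of `x` as long as the power stays trivial. The first nontrivial
  -- power met is killed by the prime just removed.
  prime-order : ∀ (H : Sub) x → x ∈' H → x ≢ ε → Σ[ p ∈ ℕ ] (Prime p × Σ[ y ∈ Fin n ] (y ∈' H × y ≢ ε × pow y p ≡ ε))
  prime-order H x x∈ x≢ε = let o , 0<o , e = finite-order x in go o (<-wellFounded o) 0<o e
    where
    go : ∀ o → Acc _<_ o → 0 < o → pow x o ≡ ε → Σ[ p ∈ ℕ ] (Prime p × Σ[ y ∈ Fin n ] (y ∈' H × y ≢ ε × pow y p ≡ ε))
    go (suc zero) _ _ e = ⊥-elim (x≢ε (trans (sym (identityʳ x)) e))
    go o@(suc (suc _)) (acc rec) 0<o e with prime-divisor o (s≤s (s≤s z≤n))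
    ... | p , pr , divides q o≡ with pow x q Fin.≟ ε
    ...   | no ne = p , pr , pow x q , pow-∈ H x∈ q , ne , trans (sym (pow-* x p q)) (trans (cong (pow x) (trans (*-comm p q) (sym o≡))) e)
    ...   | yes e' = go q (rec (subst (q <_) (sym o≡) (m<m*n q p {{>-nonZero 0<q}} (nonTrivial⇒n>1 p {{prime⇒nonTrivial pr}})))) 0<q e'
      where
      0<q : 0 < q
      0<q = n≢0⇒n>0 λ { refl → <⇒≢ 0<o (sym o≡) }

  -- Subgroups of index prime to q

  ⊆?' : ∀ H K → Dec (H ⊆' K)
  ⊆?' H K = Fin.all? (λ x → (x ∈?' H) →-dec (x ∈?' K))

  opaque
    -- `Φ` need not be decidable, so a least subgroup exists only up to double negation; hence the
    -- continuation into `⊥`.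
    minimal-sub : (Φ : Sub → Set) (H : Sub) → Φ H → ((K : Sub) → Φ K → (∀ L → Φ L → ∥ K ∥ ≤ ∥ L ∥) → ⊥) → ⊥
    minimal-sub Φ H φ k = go ∥ H ∥ H φ ≤-refl
      where
      go : ∀ m K → Φ K → ∥ K ∥ ≤ m → ⊥
      go zero K _ le = <⇒≱ (∣Sub∣-pos K) le
      go (suc m) K φK le = k K φK min
        where
        min : ∀ L → Φ L → ∥ K ∥ ≤ ∥ L ∥
        min L φL with ∥ K ∥ ≤? ∥ L ∥
        ... | yes p = p
        ... | no ¬p = ⊥-elim (go m L φL (s≤s⁻¹ (≤-trans (≰⇒> ¬p) le)))

  opaque
    ⊆∧≥⇒⊇ : ∀ {H K} → H ⊆' K → ∥ K ∥ ≤ ∥ H ∥ → K ⊆' H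
    ⊆∧≥⇒⊇ {H} {K} = ⊑-antisym-# (set H) (set K)

  opaque
    order-1 : ∀ H → ∥ H ∥ ≡ 1 → IsTrivial H
    order-1 H e x x∈ = ⊆∧≥⇒⊇ {trivial} {H} (λ { _ refl → ε∈ H })
      (≤-reflexive (trans e (sym (#-single ε)))) x x∈

  opaque
    ▷-stable⁻¹ : ∀ h H → (∀ x → x ∈' H → h ▷ x ∈' H) → ∀ x → x ∈' H → h ⁻¹ ▷ x ∈' H
    ▷-stable⁻¹ h H st = ⊆∧≥⇒⊇ {conjugate h H} {H} (λ x p → ∈-cong H (▷-cancelʳ h x) (st _ p)) (≤-reflexive (sym (∣conjugate∣ h H)))

  -- That q does not divide the index |D : Q|, expressed without forming a quotient.
  PrimeIndex : ℕ → Sub → Sub → Set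
  PrimeIndex q D Q = Q ⊆' D × ¬ (q * ∥ Q ∥ ∣ ∥ D ∥)

  -- Proper subgroups have index divisible by q. This is the property of q-groups on which Sylow
  -- conjugacy and the nontrivial centre rest.
  QLike : ℕ → Sub → Set₁
  QLike q S = ∀ R → R ⊆' S → ¬ S ⊆' R → q * ∥ R ∥ ∣ ∥ S ∥

  center : Sub → Sub
  center S = centralizer S S

  -- Subgroups of least order among those of index prime to q.  They behave like Sylow
  -- q-subgroups for counting modulo q, without Cauchy's theorem being needed.
  opaque
    minimal⇒QLike : ∀ {q D Q} → Prime q → PrimeIndex q D Q → (∀ L → PrimeIndex q D L → ∥ Q ∥ ≤ ∥ L ∥) → QLike q Q
    minimal⇒QLike {q} {D} {Q} pq (Q⊆D , ¬div) min R R⊆Q ¬Q⊆R with (q * ∥ R ∥) ∣? ∥ Q ∥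
    ... | yes p = p
    ... | no ¬p = ⊥-elim (¬Q⊆R (⊆∧≥⇒⊇ {R} {Q} R⊆Q (min R ((λ x → Q⊆D x ∘ R⊆Q x) , ¬R))))
      where
      instance
        R≢0 : NonZero ∥ R ∥
        R≢0 = >-nonZero (∣Sub∣-pos R)
        Q≢0 : NonZero ∥ Q ∥
        Q≢0 = >-nonZero (∣Sub∣-pos Q)
      ¬R : ¬ (q * ∥ R ∥ ∣ ∥ D ∥)
      ¬R div with lagrange Q D Q⊆D | lagrange R Q R⊆Q
      ... | divides i D≡ | divides j Q≡ with euclidsLemma i j pq (*-cancelʳ-∣ ∥ R ∥
                (subst (q * ∥ R ∥ ∣_) (trans D≡ (trans (cong (i *_) Q≡) (sym (*-assoc i j _)))) div))
      ...   | inj₁ q∣i = ¬div (subst (q * ∥ Q ∥ ∣_) (sym D≡) (*-monoˡ-∣ ∥ Q ∥ q∣i))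
      ...   | inj₂ q∣j = ¬p (subst (q * ∥ R ∥ ∣_) (sym Q≡) (*-monoˡ-∣ ∥ R ∥ q∣j))

  opaque
    q∣order : ∀ {q D Q} → Prime q → PrimeIndex q D Q → q ∣ ∥ D ∥ → q ∣ ∥ Q ∥
    q∣order {q} {D} {Q} pq (Q⊆D , ¬div) q∣D with lagrange Q D Q⊆D
    ... | divides i D≡ with euclidsLemma i ∥ Q ∥ pq (subst (q ∣_) D≡ q∣D)
    ...   | inj₁ q∣i = ⊥-elim (¬div (subst (q * ∥ Q ∥ ∣_) (sym D≡) (*-monoˡ-∣ ∥ Q ∥ q∣i)))
    ...   | inj₂ p = p

  opaque
    -- Sylow's argument: if no conjugate of Q contains S, every intersection of S with a conjugate
    -- is proper in S, so every double coset S x Q has size divisible by q |Q|. Summing over D would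
    -- make q |Q| divide |D|.
    ⊆-conjugate : ∀ {q D S Q} → QLike q S → S ⊆' D → PrimeIndex q D Q → Σ[ x ∈ Fin n ] (x ∈' D × S ⊆' conjugate x Q)
    ⊆-conjugate {q} {D} {S} {Q} ql S⊆D (Q⊆D , ¬div) with Fin.any? (λ x → (x ∈?' D) ×-dec ⊆?' S (conjugate x Q))
    ... | yes p = p
    ... | no none = ⊥-elim (¬div (∣-classes dc (set D) (q * ∥ Q ∥)
          (λ { x y (a , a∈ , p) x∈ → ∈-cong D (solve 3 (λ a x y → a · x · (x ⁻ · a ⁻ · y) ⊜ y) refl a x y)
                                      (∙∈ D (∙∈ D (S⊆D _ a∈) x∈) (Q⊆D _ p)) })
          size))
      where
      dc : DEquiv n
      dc = record
        { ~? = λ x → mem? (double-coset S x Q)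
        ; ~refl = λ x → ε , ε∈ S , ∈-cong Q (solve 1 (λ x → :ε ⊜ x ⁻ · :ε ⁻ · x) refl x) (ε∈ Q)
        ; ~sym = λ { {x} {y} (a , a∈ , p) → a ⁻¹ , ⁻¹∈ S a∈ ,
              ∈-cong Q (solve 3 (λ a x y → (x ⁻ · a ⁻ · y) ⁻ ⊜ y ⁻ · a ⁻ ⁻ · x) refl a x y) (⁻¹∈ Q p) }
        ; ~trans = λ { {x} {y} {z} (a , a∈ , p) (b , b∈ , r) → b ∙ a , ∙∈ S b∈ a∈ ,
              ∈-cong Q (solve 5 (λ a b x y z → (x ⁻ · a ⁻ · y) · (y ⁻ · b ⁻ · z) ⊜ x ⁻ · (b · a) ⁻ · z) refl a b x y z) (∙∈ Q p r) } }
      size : ∀ x → x ∈' D → q * ∥ Q ∥ ∣ # (double-coset S x Q)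
      size x x∈ with ql (S ⊓ conjugate x Q) (λ _ → proj₁) (λ le → none (x , x∈ , λ y y∈ → proj₂ (le y y∈)))
      ... | divides m S≡ = divides m (*-cancelʳ-≡ _ _ ∥ S ⊓ conjugate x Q ∥
              (trans (sym (∣double-coset∣ S x Q)) (trans (cong (_* ∥ Q ∥) S≡) (lem m q _ ∥ Q ∥))))
        where
        instance
          ∩≢0 : NonZero ∥ S ⊓ conjugate x Q ∥
          ∩≢0 = >-nonZero (∣Sub∣-pos (S ⊓ conjugate x Q))
        lem : ∀ m q r s → m * (q * r) * s ≡ m * (q * s) * r
        lem = solve-∀

  opaque
    -- Class equation: with a trivial centre, every class of nonidentity elements would have size
    -- divisible by q, so q would divide both |S| and |S| - 1.
    QLike⇒center : ∀ {q S} → Prime q → QLike q S → q ∣ ∥ S ∥ → ¬ IsTrivial (center S)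
    QLike⇒center {q} {S} pq ql q∣S triv = ¬prime[1] (subst Prime (∣1⇒≡1 (∣m+n∣m⇒∣n (subst (q ∣_) (trans (#-remove (set S) ε (ε∈ S)) (+-comm 1 (# X))) q∣S) q∣X)) pq)
      where
      X : DSet n
      X = mk (λ x → (x ∈?' S) ×-dec ¬? (x Fin.≟ ε))
      cj : DEquiv n
      cj = record
        { ~? = λ x y → Fin.any? (λ s → (s ∈?' S) ×-dec (s ▷ x Fin.≟ y))
        ; ~refl = λ x → ε , ε∈ S , solve 1 (λ x → :ε :▷ x ⊜ x) refl x
        ; ~sym = λ { {x} (s , s∈ , refl) → s ⁻¹ , ⁻¹∈ S s∈ , ▷-cancelˡ s x }
        ; ~trans = λ { {x} (s , s∈ , refl) (t , t∈ , refl) → t ∙ s , ∙∈ S t∈ s∈ , sym (▷-▷ t s x) } }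
      q∣X : q ∣ # X
      q∣X = ∣-classes cj X q
        (λ { x y (s , s∈ , refl) (x∈ , x≢ε) → ∙∈ S (∙∈ S s∈ x∈) (⁻¹∈ S s∈) ,
             λ e → x≢ε (▷-injective s (trans e (solve 1 (λ s → :ε ⊜ s :▷ :ε) refl s))) })
        cls
        where
        cls : ∀ x → x ∊ X → q ∣ # (mk (DEquiv.~? cj x))
        cls x (x∈ , x≢ε) = *-cancelʳ-∣ ∥ C ∥ (subst (q * ∥ C ∥ ∣_) orbit (ql C (λ _ → proj₁) C≢S))
          where
          cx : Sub
          cx = record
            { set = mk (λ y → x ∙ y Fin.≟ y ∙ x) ; ε∈ = trans (identityʳ x) (sym (identityˡ x))
            ; ∙∈ = λ p p' → sym (comm-∙ (sym p) (sym p')) ; ⁻¹∈ = λ p → sym (comm-⁻¹ (sym p)) }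
          C : Sub
          C = S ⊓ cx
          instance
            C≢0 : NonZero ∥ C ∥
            C≢0 = >-nonZero (∣Sub∣-pos C)
          C≢S : ¬ S ⊆' C
          C≢S le = x≢ε (triv x (x∈ , λ y y∈ → proj₂ (le y y∈)))
          orbit : ∥ S ∥ ≡ # (mk (DEquiv.~? cj x)) * ∥ C ∥
          orbit = trans (sym (*-identityʳ _)) (double-count (set S) (mk (DEquiv.~? cj x))
            (λ s y → (s ∈?' S) ×-dec (s ▷ x Fin.≟ y)) 1 ∥ C ∥
            (λ { s y (s∈ , e) → s∈ , s , s∈ , e })
            (λ s s∈ → trans (#-cong _ (single (s ▷ x)) (λ _ (_ , e) → sym e) (λ _ e → s∈ , sym e)) (#-single _))
            (λ { y (t , t∈ , refl) → #-bij _ _ (t ⁻¹ ∙_) (t ∙_)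
                 (solve 2 (λ t s → t ⁻ · (t · s) ⊜ s) refl t) (solve 2 (λ t s → t · (t ⁻ · s) ⊜ s) refl t)
                 (λ { s (s∈ , e) → ∙∈ S (⁻¹∈ S t∈) s∈ , sym (▷⇒comm (trans (sym (▷-▷ (t ⁻¹) s x)) (trans (cong (t ⁻¹ ▷_) e) (▷-cancelˡ t x)))) })
                 (λ { s (s∈ , c) → ∙∈ S t∈ s∈ , trans (sym (▷-▷ t s x)) (cong (t ▷_) (comm⇒▷ (sym c))) }) }))

  NonAbelian : Sub → Set
  NonAbelian D = ¬ CommuteWith D D

  IsSimple : Sub → Set₁
  IsSimple D = ∀ X → X ⊲ D → ¬ IsTrivial X → D ⊆' X

  center-⊲ : ∀ {D} → center D ⊲ D
  center-⊲ {D} = (λ _ → proj₁) , λ g x g∈ (x∈ , c) → ∙∈ D (∙∈ D g∈ x∈) (⁻¹∈ D g∈) , λ y y∈ →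
    subst (λ z → Commutes z y) (sym (comm⇒▷ (sym (c g g∈)))) (c y y∈)

  opaque
    trivial-center : ∀ {D} → IsSimple D → NonAbelian D → IsTrivial (center D)
    trivial-center {D} simple nonab x x∈ = decidable-stable (x Fin.≟ ε) λ x≢ε →
      nonab (λ y z y∈ z∈ → proj₂ (simple (center D) (center-⊲ {D}) (λ t → x≢ε (t x x∈)) y y∈) z z∈)

  -- Itô: for abelian A, B the commutators [a,b] form a set stable under conjugation by AB,
  -- and they commute pairwise.
  module Itô (D A B : Sub) (simple : IsSimple D) (nonab : NonAbelian D)
             (A⊆D : A ⊆' D) (B⊆D : B ⊆' D)
             (abA : CommuteWith A A) (abB : CommuteWith B B)
             (D⊆AB : ∀ d → d ∈' D → Σ[ a ∈ Fin n ] (a ∈' A × a ⁻¹ ∙ d ∈' B)) where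

    ⁅_⨾_⁆ : Fin n → Fin n → Fin n
    ⁅ a ⨾ b ⁆ = a ∙ b ∙ a ⁻¹ ∙ b ⁻¹

    -- Factoring the inverse of `a' ▷ b` gives `a' ▷ b = b₂ c⁻¹` with `c ∈ A`. Since `c` commutes
    -- with `a`, it drops out of the commutator. The choice of `b₂` is independent of `a`, which
    -- `swap▷` exploits.
    conj-B : ∀ {a' b} → a' ∈' A → b ∈' B → Σ[ b₂ ∈ Fin n ] (b₂ ∈' B × ∀ a → a ∈' A → a' ▷ ⁅ a ⨾ b ⁆ ≡ ⁅ a ⨾ b₂ ⁆)
    conj-B {a'} {b} a'∈ b∈ with D⊆AB ((a' ▷ b) ⁻¹) (⁻¹∈ D (∙∈ D (∙∈ D (A⊆D _ a'∈) (B⊆D _ b∈)) (⁻¹∈ D (A⊆D _ a'∈))))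
    ... | c , c∈ , p = b₂ , ⁻¹∈ B p , λ a a∈ → trans (solve 3 (λ a' a b → a' :▷ (a · b · a ⁻ · b ⁻) ⊜
                (a' :▷ a) · (a' :▷ b) · (a' :▷ a) ⁻ · (a' :▷ b) ⁻) refl a' a b)
           (trans (cong (λ t → t ∙ (a' ▷ b) ∙ t ⁻¹ ∙ (a' ▷ b) ⁻¹) (comm⇒▷ (abA a' a a'∈ a∈)))
           (trans (solve 3 (λ a x c → a · x · a ⁻ · x ⁻ ⊜ a · ((c ⁻ · x ⁻) ⁻) · ((c ⁻) · a ⁻ · c) · (c ⁻ · x ⁻)) refl a (a' ▷ b) c)
           (trans (cong (λ t → a ∙ b₂ ∙ t ∙ (c ⁻¹ ∙ (a' ▷ b) ⁻¹)) (trans (cong (_∙ c) (abA (c ⁻¹) (a ⁻¹) (⁻¹∈ A c∈) (⁻¹∈ A a∈)))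
                      (solve 2 (λ a c → a ⁻ · c ⁻ · c ⊜ a ⁻) refl a c)))
             (solve 3 (λ a x c → a · ((c ⁻ · x ⁻) ⁻) · a ⁻ · (c ⁻ · x ⁻) ⊜ a · (c ⁻ · x ⁻) ⁻ · a ⁻ · (c ⁻ · x ⁻) ⁻ ⁻) refl a (a' ▷ b) c))))
      where
      b₂ : Fin n
      b₂ = (c ⁻¹ ∙ (a' ▷ b) ⁻¹) ⁻¹

    conj-A : ∀ {b' a} → b' ∈' B → a ∈' A → Σ[ a₃ ∈ Fin n ] (a₃ ∈' A × ∀ b → b ∈' B → b' ▷ ⁅ a ⨾ b ⁆ ≡ ⁅ a₃ ⨾ b ⁆)
    conj-A {b'} {a} b'∈ a∈ with D⊆AB (b' ▷ a) (∙∈ D (∙∈ D (B⊆D _ b'∈) (A⊆D _ a∈)) (⁻¹∈ D (B⊆D _ b'∈)))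
    ... | a₃ , a₃∈ , p = a₃ , a₃∈ , λ b b∈ → trans (solve 3 (λ b' a b → b' :▷ (a · b · a ⁻ · b ⁻) ⊜
                (b' :▷ a) · (b' :▷ b) · (b' :▷ a) ⁻ · (b' :▷ b) ⁻) refl b' a b)
           (trans (cong (λ t → (b' ▷ a) ∙ t ∙ (b' ▷ a) ⁻¹ ∙ t ⁻¹) (comm⇒▷ (abB b' b b'∈ b∈)))
           (trans (solve 3 (λ x b c → x · b · x ⁻ · b ⁻ ⊜ c · ((c ⁻ · x) · b · (c ⁻ · x) ⁻) · c ⁻ · b ⁻) refl (b' ▷ a) b a₃)
                  (cong (λ t → a₃ ∙ t ∙ a₃ ⁻¹ ∙ b ⁻¹) (comm⇒▷ (abB (a₃ ⁻¹ ∙ (b' ▷ a)) b p b∈)))))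

    IsComm : Fin n → Set
    IsComm z = Σ[ a ∈ Fin n ] Σ[ b ∈ Fin n ] (a ∈' A × b ∈' B × z ≡ ⁅ a ⨾ b ⁆)

    comm-closedA : ∀ {a' z} → a' ∈' A → IsComm z → IsComm (a' ▷ z)
    comm-closedA a'∈ (a , b , a∈ , b∈ , refl) = let b₂ , b₂∈ , e = conj-B a'∈ b∈ in a , b₂ , a∈ , b₂∈ , e a a∈

    comm-closedB : ∀ {b' z} → b' ∈' B → IsComm z → IsComm (b' ▷ z)
    comm-closedB b'∈ (a , b , a∈ , b∈ , refl) = let a₃ , a₃∈ , e = conj-A b'∈ a∈ in a₃ , b , a₃∈ , b∈ , e b b∈

    comm-closed : ∀ {d z} → d ∈' D → IsComm z → IsComm (d ▷ z)
    comm-closed {d} {z} d∈ cz with D⊆AB d d∈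
    ... | a , a∈ , p = subst IsComm (solve 3 (λ a d z → a :▷ ((a ⁻ · d) :▷ z) ⊜ d :▷ z) refl a d z)
                         (comm-closedA a∈ (comm-closedB p cz))

    -- A changes only the second entry of a commutator and B only the first, so either order leads
    -- to `⁅ a₃ ⨾ b₂ ⁆`.
    swap▷ : ∀ {a' b' z} → a' ∈' A → b' ∈' B → IsComm z → a' ▷ (b' ▷ z) ≡ b' ▷ (a' ▷ z)
    swap▷ {a'} {b'} a'∈ b'∈ (a , b , a∈ , b∈ , refl) with conj-A b'∈ a∈ | conj-B a'∈ b∈
    ... | a₃ , a₃∈ , e | b₂ , b₂∈ , e' = trans (cong (a' ▷_) (e b b∈)) (trans (e' a₃ a₃∈)
            (trans (sym (e b₂ b₂∈)) (cong (b' ▷_) (sym (e' a a∈)))))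

    -- Conjugation by `⁅ a ⨾ b ⁆` is the commutator of two operations which commute on commutators
    -- by `swap▷`.
    comm-comm : ∀ {a b z} → a ∈' A → b ∈' B → IsComm z → Commutes ⁅ a ⨾ b ⁆ z
    comm-comm {a} {b} {z} a∈ b∈ cz = ▷⇒comm (trans
      (solve 3 (λ a b z → (a · b · a ⁻ · b ⁻) :▷ z ⊜ a :▷ (b :▷ ((a ⁻) :▷ ((b ⁻) :▷ z)))) refl a b z)
      (trans (swap▷ a∈ b∈ (comm-closedA (⁻¹∈ A a∈) (comm-closedB (⁻¹∈ B b∈) cz)))
      (solve 3 (λ a b z → b :▷ (a :▷ ((a ⁻) :▷ ((b ⁻) :▷ z))) ⊜ z) refl a b z)))

    E : Sub
    E = record
      { set = mk (λ x → (x ∈?' D) ×-dec Fin.all? (λ a → Fin.all? (λ b → (a ∈?' A) →-dec ((b ∈?' B) →-dec (x ∙ ⁅ a ⨾ b ⁆ Fin.≟ ⁅ a ⨾ b ⁆ ∙ x)))))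
      ; ε∈ = ε∈ D , λ _ _ _ _ → trans (identityˡ _) (sym (identityʳ _))
      ; ∙∈ = λ (p , f) (q , g) → ∙∈ D p q , λ a b a∈ b∈ → comm-∙ (f a b a∈ b∈) (g a b a∈ b∈)
      ; ⁻¹∈ = λ (p , f) → ⁻¹∈ D p , λ a b a∈ b∈ → comm-⁻¹ (f a b a∈ b∈) }

    E⊲D : E ⊲ D
    E⊲D = (λ _ → proj₁) , λ g x g∈ (x∈ , f) → ∙∈ D (∙∈ D g∈ x∈) (⁻¹∈ D g∈) , λ a b a∈ b∈ →
      let a' , b' , a'∈ , b'∈ , e = comm-closed (⁻¹∈ D g∈) (a , b , a∈ , b∈ , refl)
      in subst (Commutes (g ▷ x)) (trans (cong (g ▷_) (sym e)) (▷-cancelʳ g _)) (comm-▷ g (f a' b' a'∈ b'∈))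

    [ab]∈D : ∀ {a b} → a ∈' A → b ∈' B → ⁅ a ⨾ b ⁆ ∈' D
    [ab]∈D a∈ b∈ = ∙∈ D (∙∈ D (∙∈ D (A⊆D _ a∈) (B⊆D _ b∈)) (⁻¹∈ D (A⊆D _ a∈))) (⁻¹∈ D (B⊆D _ b∈))

    AB-commute : ¬ (∀ a b → a ∈' A → b ∈' B → ⁅ a ⨾ b ⁆ ≡ ε)
    AB-commute h = nonab λ x y x∈ y∈ →
      let a , a∈ , p = D⊆AB x x∈ in subst (λ t → Commutes t y) (solve 2 (λ a x → a · (a ⁻ · x) ⊜ x) refl a x)
        (comm-∙ (withA a∈ y∈) (withB p y∈))
      where
      ab : ∀ {a b} → a ∈' A → b ∈' B → Commutes a b
      ab {a} {b} a∈ b∈ = trans (solve 2 (λ a b → a · b ⊜ (a · b · a ⁻ · b ⁻) · (b · a)) refl a b)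
        (trans (cong (_∙ (b ∙ a)) (h a b a∈ b∈)) (identityˡ _))
      withA : ∀ {a y} → a ∈' A → y ∈' D → Commutes a y
      withA {a} {y} a∈ y∈ = let c , c∈ , p = D⊆AB y y∈ in sym (subst (λ t → Commutes t a) (solve 2 (λ c y → c · (c ⁻ · y) ⊜ y) refl c y)
        (comm-∙ (abA c a c∈ a∈) (sym (ab a∈ p))))
      withB : ∀ {b y} → b ∈' B → y ∈' D → Commutes b y
      withB {b} {y} b∈ y∈ = let c , c∈ , p = D⊆AB y y∈ in sym (subst (λ t → Commutes t b) (solve 2 (λ c y → c · (c ⁻ · y) ⊜ y) refl c y)
        (comm-∙ (ab c∈ b∈) (abB _ b p b∈)))

    -- A nontrivial commutator lies in `E`, the centraliser of all of them, so `E = D` by simplicity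
    -- and the commutator is central in D, whose centre is trivial. Thus A and B commute elementwise
    -- and D is abelian.
    impossible : ⊥
    impossible = AB-commute λ a b a∈ b∈ → decidable-stable (⁅ a ⨾ b ⁆ Fin.≟ ε) λ ne →
      ne (trivial-center {D} simple nonab _ ([ab]∈D a∈ b∈ , λ y y∈ → sym (proj₂ (simple E E⊲D
        (λ t → ne (t _ ([ab]∈D a∈ b∈ , λ a' b' a'∈ b'∈ → comm-comm a∈ b∈ (a' , b' , a'∈ , b'∈ , refl)))) y y∈) a b a∈ b∈)))

  -- H normalises D and e, k₀ are such that every subgroup X of D whose H-conjugates are
  -- D-conjugates satisfies |X| ^ e ≡ 1 (mod k₀), whereas |D| ^ e < (k₀ + 1) ^ 3.
  module NoSuchSimple (H D : Sub) (D⊲H : D ⊲ H) (simple : IsSimple D) (nonab : NonAbelian D)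
      (k₀ e : ℕ) (1≤e : 1 ≤ e) (bound : ∥ D ∥ ^ e < suc k₀ * (suc k₀ * suc k₀))
      (congruent : ∀ X → X ⊆' D → (∀ g → g ∈' H → Σ[ d ∈ Fin n ] (d ∈' D × ∀ x → x ∈' X → (d ⁻¹ ∙ g) ▷ x ∈' X)) →
                   k₀ ∣ ∥ X ∥ ^ e ∸ 1) where

    -- `H = D N_H(X)`, the conclusion of a Frattini argument.
    Canonical : Sub → Set
    Canonical X = ∀ g → g ∈' H → Σ[ d ∈ Fin n ] (d ∈' D × ∀ x → x ∈' X → (d ⁻¹ ∙ g) ▷ x ∈' X)

    instance
      e≢0 : NonZero e
      e≢0 = >-nonZero 1≤e

    Big : ℕ → Set
    Big j = suc k₀ ≤ j ^ e

    ^-pos : ∀ {j} → 0 < j → 0 < j ^ e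
    ^-pos {suc j} _ = m^n>0 (suc j) e

    opaque
      one-or-big : ∀ {j} → 0 < j → k₀ ∣ j ^ e ∸ 1 → j ≡ 1 ⊎ Big j
      one-or-big {j} 0<j div with j ^ e in eq
      ... | zero = ⊥-elim (<⇒≢ (^-pos 0<j) (sym eq))
      ... | suc zero = inj₁ ([ (λ e≡0 → ⊥-elim (<⇒≢ 1≤e (sym e≡0))) , id ]′ (m^n≡1⇒n≡0∨m≡1 j e eq))
      ... | suc (suc r) = inj₂ (s≤s (∣⇒≤ div))

    -- This is where the cubic bound is spent: each big factor contributes at least `k₀ + 1` to |D|
    -- ^ e.
    not-three : ∀ {a b c} → ∥ D ∥ ≡ a * (b * c) → Big a → Big b → Big c → ⊥
    not-three {a} {b} {c} eq A B C = <⇒≱ bound (≤-trans (*-mono-≤ A (*-mono-≤ B C))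
      (≤-reflexive (sym (trans (cong (_^ e) eq) (trans (^-distribʳ-* e a (b * c)) (cong (a ^ e *_) (^-distribʳ-* e b c)))))))

    opaque
      quotient-congruent : ∀ {a j} → 0 < a → 0 < j → k₀ ∣ a ^ e ∸ 1 → k₀ ∣ (a * j) ^ e ∸ 1 → k₀ ∣ j ^ e ∸ 1
      quotient-congruent {a} {j} 0<a 0<j p q = ∣∸1-quotient k₀ (a ^ e) (j ^ e) (^-pos 0<a) (^-pos 0<j) p
        (subst (λ t → k₀ ∣ t ∸ 1) (^-distribʳ-* e a j) q)

    D-canonical : Canonical D
    D-canonical g g∈ = ε , ε∈ D , λ x x∈ → proj₂ D⊲H _ x (∙∈ H (⁻¹∈ H (ε∈ H)) g∈) x∈

    record Index (X Y : Sub) : Set where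
      field
        idx : ℕ
        eq  : ∥ Y ∥ ≡ ∥ X ∥ * idx
        pos : 0 < idx
        one⊎big : idx ≡ 1 ⊎ Big idx

    opaque
      index : ∀ {X Y} → X ⊆' Y → k₀ ∣ ∥ X ∥ ^ e ∸ 1 → k₀ ∣ ∥ Y ∥ ^ e ∸ 1 → Index X Y
      index {X} {Y} X⊆Y cX cY with lagrange X Y X⊆Y
      ... | divides i Y≡ = record { idx = i ; eq = Y≡' ; pos = 0<i ; one⊎big = one-or-big 0<i
              (quotient-congruent (∣Sub∣-pos X) 0<i cX (subst (λ t → k₀ ∣ t ^ e ∸ 1) Y≡' cY)) }
        where
        Y≡' : ∥ Y ∥ ≡ ∥ X ∥ * i
        Y≡' = trans Y≡ (*-comm i _)
        0<i : 0 < i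
        0<i = ∣-pos (divides ∥ X ∥ Y≡') (∣Sub∣-pos Y)

    opaque
      index-1 : ∀ {X Y} → X ⊆' Y → (I : Index X Y) → Index.idx I ≡ 1 → Y ⊆' X
      index-1 {X} {Y} X⊆Y I e = ⊆∧≥⇒⊇ {X} {Y} X⊆Y (≤-reflexive (trans (Index.eq I) (trans (cong (∥ X ∥ *_) e) (*-identityʳ _))))

    nontrivial-big : ∀ {X} → k₀ ∣ ∥ X ∥ ^ e ∸ 1 → ¬ IsTrivial X → Big ∥ X ∥
    nontrivial-big {X} c nt = [ (λ o → ⊥-elim (nt (order-1 X o))) , id ]′ (one-or-big (∣Sub∣-pos X) c)

    record QSub (q : ℕ) : Set₁ where
      field
        Q        : Sub
        prim     : PrimeIndex q D Q
        like     : QLike q Q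
        canon    : Canonical Q
        cong-Q   : k₀ ∣ ∥ Q ∥ ^ e ∸ 1
        I        : Index Q D
        abelian  : CommuteWith Q Q
        bigQ     : Big ∥ Q ∥
        bigI     : Big (Index.idx I)

    congD : k₀ ∣ ∥ D ∥ ^ e ∸ 1
    congD = congruent D (λ _ p → p) D-canonical

    opaque
      conjugate-prime : ∀ {q D' Q} h → (∀ x → x ∈' D' → h ▷ x ∈' D') → PrimeIndex q D' Q → PrimeIndex q D' (conjugate h Q)
      conjugate-prime {q} {D'} {Q} h st (Q⊆D , ¬div) = (λ x p → ∈-cong D' (▷-cancelʳ h x) (st _ (Q⊆D _ p))) ,
        λ div → ¬div (subst (λ t → q * t ∣ ∥ D' ∥) (∣conjugate∣ h Q) div)

    opaque
      qlike-conjugate : ∀ {q Q} h → QLike q Q → QLike q (conjugate h Q)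
      qlike-conjugate {q} {Q} h ql R R⊆ ¬⊆ = subst₂ (λ a b → q * a ∣ b) (∣conjugate∣ (h ⁻¹) R) (sym (∣conjugate∣ h Q))
        (ql (conjugate (h ⁻¹) R) (λ x p → ∈-cong Q (solve 2 (λ h x → (h ⁻) :▷ ((h ⁻ ⁻) :▷ x) ⊜ x) refl h x) (R⊆ _ p))
          (λ le → ¬⊆ (λ x p → ∈-cong R (solve 2 (λ h x → (h ⁻ ⁻) :▷ ((h ⁻) :▷ x) ⊜ x) refl h x) (le _ p))))

    opaque
      -- `canon` is the Frattini argument, with conjugacy from `⊆-conjugate`; the centre Z of Q
      -- inherits it. The index |D : Q| is big because Z is nontrivial and the centre of D is
      -- trivial. If Z < Q, then |Z|, |Q : Z| and |D : Q| would be three big factors, so Q is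
      -- abelian.
      qsub : ∀ q → Prime q → q ∣ ∥ D ∥ → (QSub q → ⊥) → ⊥
      qsub q pq q∣D k = minimal-sub (PrimeIndex q D) D ((λ _ p → p) , ¬D) λ Q prim min → k (build Q prim (minimal⇒QLike {q} {D} {Q} pq prim min))
        where
        ¬D : ¬ (q * ∥ D ∥ ∣ ∥ D ∥)
        ¬D div = ¬prime[1] (subst Prime (∣1⇒≡1 (*-cancelʳ-∣ ∥ D ∥ {{>-nonZero (∣Sub∣-pos D)}} (subst (q * ∥ D ∥ ∣_) (sym (*-identityˡ _)) div))) pq)
        build : ∀ Q → PrimeIndex q D Q → QLike q Q → QSub q
        build Q prim like = record { Q = Q ; prim = prim ; like = like ; canon = canon ; cong-Q = cQ ; I = I ; abelian = ab
                                   ; bigQ = bQ ; bigI = bI }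
          where
          canon : Canonical Q
          canon g g∈ with ⊆-conjugate {q} {D} {conjugate g Q} {Q} (qlike-conjugate {q} {Q} g like)
                            (proj₁ (conjugate-prime {q} {D} {Q} g (λ x → proj₂ D⊲H g x g∈) prim)) prim
          ... | d , d∈ , le = d , d∈ , λ x x∈ → ∈-cong Q (▷-▷ (d ⁻¹) g x) (le _ (▷∈conjugate g Q x∈))
          cQ : k₀ ∣ ∥ Q ∥ ^ e ∸ 1
          cQ = congruent Q (proj₁ prim) canon
          I : Index Q D
          I = index {Q} {D} (proj₁ prim) cQ congD
          Z : Sub
          Z = center Q
          Z-nt : ¬ IsTrivial Z
          Z-nt = QLike⇒center {q} {Q} pq like (q∣order {q} {D} {Q} pq prim q∣D)
          Z-canon : Canonical Z
          Z-canon g g∈ with canon g g∈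
          ... | d , d∈ , st = d , d∈ , λ z (z∈ , c) → st z z∈ , λ y y∈ → subst (Commutes _) (▷-cancelʳ _ y)
                  (comm-▷ (d ⁻¹ ∙ g) (c _ (▷-stable⁻¹ (d ⁻¹ ∙ g) Q st y y∈)))
          cZ : k₀ ∣ ∥ Z ∥ ^ e ∸ 1
          cZ = congruent Z (λ x (x∈ , _) → proj₁ prim x x∈) Z-canon
          J : Index Z Q
          J = index {Z} {Q} (λ _ → proj₁) cZ cQ
          bI : Big (Index.idx I)
          bI = [ (λ e → ⊥-elim (Z-nt λ z (z∈ , c) → trivial-center {D} simple nonab z
                  (proj₁ prim z z∈ , λ y y∈ → c y (index-1 {Q} {D} (proj₁ prim) I e y y∈)))) , id ]′ (Index.one⊎big I)
          bQ : Big ∥ Q ∥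
          bQ = nontrivial-big {Q} cQ λ t → Z-nt (λ z (z∈ , _) → t z z∈)
          ab : CommuteWith Q Q
          ab x y x∈ y∈ = [ (λ e → proj₂ (index-1 {Z} {Q} (λ _ → proj₁) J e x x∈) y y∈)
                         , (λ bJ → ⊥-elim (not-three {∥ Z ∥} {Index.idx J} {Index.idx I}
                  (trans (Index.eq I) (trans (cong (_* Index.idx I) (Index.eq J)) (*-assoc ∥ Z ∥ _ _)))
                  (nontrivial-big {Z} cZ Z-nt) bJ bI)) ]′ (Index.one⊎big J)

    opaque
      -- Let S be of least order among the subgroups of A of index prime to r. As A is abelian, S is
      -- canonical together with A. Three big factors exclude S < A, so A itself is `QLike` for r
      -- and lies in a conjugate of R; three big factors again exclude proper containment.
      same-order : ∀ {q r} (A : QSub q) (R : QSub r) → Prime r → r ∣ ∥ QSub.Q A ∥ → (∥ QSub.Q A ∥ ≡ ∥ QSub.Q R ∥ → ⊥) → ⊥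
      same-order {q} {r} A R pr r∣A k = minimal-sub (PrimeIndex r A.Q) A.Q ((λ _ p → p) , ¬A) λ S prim min →
          step S prim (minimal⇒QLike {r} {A.Q} {S} pr prim min)
        where
        module A = QSub A
        module R = QSub R
        ¬A : ¬ (r * ∥ A.Q ∥ ∣ ∥ A.Q ∥)
        ¬A div = ¬prime[1] (subst Prime (∣1⇒≡1 (*-cancelʳ-∣ ∥ A.Q ∥ {{>-nonZero (∣Sub∣-pos A.Q)}} (subst (r * ∥ A.Q ∥ ∣_) (sym (*-identityˡ _)) div))) pr)
        finish : QLike r A.Q → ⊥
        finish like = fin (⊆-conjugate {r} {D} {A.Q} {R.Q} like (proj₁ A.prim) R.prim)
          where
          fin : Σ[ x ∈ Fin n ] (x ∈' D × A.Q ⊆' conjugate x R.Q) → ⊥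
          fin (x , x∈ , le) = [ (λ e → k (sym (trans (sym (∣conjugate∣ x R.Q)) (trans (Index.eq J) (trans (cong (∥ A.Q ∥ *_) e) (*-identityʳ _))))))
              , (λ b → not-three {∥ A.Q ∥} {Index.idx J} {Index.idx R.I}
                    (trans (Index.eq R.I) (trans (cong (_* Index.idx R.I) (trans (sym (∣conjugate∣ x R.Q)) (Index.eq J))) (*-assoc ∥ A.Q ∥ _ _)))
                    A.bigQ b R.bigI) ]′ (Index.one⊎big J)
            where
            J : Index A.Q (conjugate x R.Q)
            J = index {A.Q} {conjugate x R.Q} le A.cong-Q (subst (λ t → k₀ ∣ t ^ e ∸ 1) (sym (∣conjugate∣ x R.Q)) R.cong-Q)
        step : ∀ S → PrimeIndex r A.Q S → QLike r S → ⊥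
        step S prim like = go (Index.one⊎big J)
          where
          S⊆A : S ⊆' A.Q
          S⊆A = proj₁ prim
          S-canon : Canonical S
          S-canon g g∈ with A.canon g g∈
          ... | d , d∈ , st with ⊆-conjugate {r} {A.Q} {conjugate (d ⁻¹ ∙ g) S} {S} (qlike-conjugate {r} {S} (d ⁻¹ ∙ g) like)
                                   (proj₁ (conjugate-prime {r} {A.Q} {S} (d ⁻¹ ∙ g) st prim)) prim
          ...   | x , x∈ , le = d , d∈ , λ s s∈ → ∈-cong S (comm⇒▷ (A.abelian (x ⁻¹) _ (⁻¹∈ A.Q x∈) (st s (S⊆A s s∈))))
                    (le _ (▷∈conjugate (d ⁻¹ ∙ g) S s∈))
          cS : k₀ ∣ ∥ S ∥ ^ e ∸ 1
          cS = congruent S (λ x x∈ → proj₁ A.prim x (S⊆A x x∈)) S-canon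
          J : Index S A.Q
          J = index {S} {A.Q} S⊆A cS A.cong-Q
          S-nt : ¬ IsTrivial S
          S-nt t = ¬prime[1] (subst Prime (∣1⇒≡1 (subst (r ∣_)
            (trans (#-cong (set S) (single ε) t (λ { _ refl → ε∈ S })) (#-single ε)) (q∣order {r} {A.Q} {S} pr prim r∣A))) pr)
          go : Index.idx J ≡ 1 ⊎ Big (Index.idx J) → ⊥
          go (inj₁ e) = finish λ X X⊆ ¬⊆ → subst (r * ∥ X ∥ ∣_) (#-cong (set S) (set A.Q) S⊆A A⊆S)
              (like X (λ x x∈ → A⊆S x (X⊆ x x∈)) (λ le → ¬⊆ (λ x x∈ → le x (A⊆S x x∈))))
            where
              A⊆S : A.Q ⊆' S
              A⊆S = index-1 {S} {A.Q} S⊆A J e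
          go (inj₂ b) = not-three {∥ S ∥} {Index.idx J} {Index.idx A.I}
              (trans (Index.eq A.I) (trans (cong (_* Index.idx A.I) (Index.eq J)) (*-assoc ∥ S ∥ _ _)))
              (nontrivial-big {S} cS S-nt) b A.bigI

    opaque
      factorised : ∀ (A B : Sub) → A ⊆' D → B ⊆' D → Coprime ∥ A ∥ ∥ B ∥ → ∥ D ∥ ≡ ∥ A ∥ * ∥ B ∥ →
                   ∀ d → d ∈' D → Σ[ a ∈ Fin n ] (a ∈' A × a ⁻¹ ∙ d ∈' B)
      factorised A B A⊆D B⊆D cop eq d d∈ = let a , a∈ , p = D⊑ d d∈ in a , a∈ ,
          ∈-cong B (solve 2 (λ a d → :ε ⁻ · a ⁻ · d ⊜ a ⁻ · d) refl a d) p
        where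
        ∩≡1 : ∥ A ⊓ conjugate ε B ∥ ≡ 1
        ∩≡1 = cop (lagrange (A ⊓ conjugate ε B) A (λ _ → proj₁) , lagrange (A ⊓ conjugate ε B) B
          (λ x (_ , q) → ∈-cong B (solve 1 (λ x → (:ε ⁻) :▷ x ⊜ x) refl x) q))
        D⊑ : set D ⊑ double-coset A ε B
        D⊑ = ⊑-antisym-# (double-coset A ε B) (set D)
          (λ { y (a , a∈ , p) → ∈-cong D (solve 2 (λ a y → a · (:ε ⁻ · a ⁻ · y) ⊜ y) refl a y) (∙∈ D (A⊆D a a∈) (B⊆D _ p)) })
          (≤-reflexive (trans eq (trans (∣double-coset∣ A ε B) (trans (cong (# (double-coset A ε B) *_) ∩≡1) (*-identityʳ _)))))

    -- A belongs to a prime of |D| and B to a prime of |D : A|, which makes |A| ≠ |B|. A prime r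
    -- dividing both orders would give both the order of the subgroup belonging to r, so the orders
    -- are coprime. A further factor of |D| besides |A| and |B| would be a third big one; hence D =
    -- A B, against Itô.
    impossible : ⊥
    impossible = qsub q₁ (proj₁ (proj₂ P₁)) (proj₂ (proj₂ P₁)) withA
      where
      1<D : 1 < ∥ D ∥
      1<D = ≤∧≢⇒< (∣Sub∣-pos D) λ e → nonab λ x y x∈ y∈ →
        let t = order-1 D (sym e) in cong₂ _∙_ (trans (t x x∈) (sym (t y y∈))) (trans (t y y∈) (sym (t x x∈)))
      P₁ = prime-divisor ∥ D ∥ 1<D
      q₁ = proj₁ P₁
      withA : QSub q₁ → ⊥
      withA SA = qsub q₂ pq₂ (∣-trans q₂∣i (divides ∥ A.Q ∥ (Index.eq A.I))) withB
        where
        module A = QSub SA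
        i = Index.idx A.I
        1<i : 1 < i
        1<i = ≤∧≢⇒< (Index.pos A.I) λ 1≡i → A-not-D (index-1 {A.Q} {D} (proj₁ A.prim) A.I (sym 1≡i))
          where
          A-not-D : ¬ D ⊆' A.Q
          A-not-D le = nonab λ x y x∈ y∈ → A.abelian x y (le x x∈) (le y y∈)
        P₂ = prime-divisor i 1<i
        q₂ = proj₁ P₂
        pq₂ = proj₁ (proj₂ P₂)
        q₂∣i = proj₂ (proj₂ P₂)
        withB : QSub q₂ → ⊥
        withB SB = go (coprime-divisor cop' (subst (∥ B.Q ∥ ∣_) (Index.eq A.I) (lagrange B.Q D (proj₁ B.prim))))
          where
          module B = QSub SB
          A≢B : ∥ A.Q ∥ ≢ ∥ B.Q ∥
          A≢B e = proj₂ B.prim (subst₂ _∣_ (cong (q₂ *_) e) (trans (*-comm i _) (sym (Index.eq A.I))) (*-monoˡ-∣ ∥ A.Q ∥ q₂∣i))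
          cop : Coprime ∥ A.Q ∥ ∥ B.Q ∥
          cop = no-common-prime⇒coprime (∣Sub∣-pos A.Q) λ r pr r∣A r∣B →
            qsub r pr (∣-trans r∣A (lagrange A.Q D (proj₁ A.prim))) λ R →
            same-order SA R pr r∣A λ e → same-order SB R pr r∣B λ e' → A≢B (trans e (sym e'))
          cop' : Coprime ∥ B.Q ∥ ∥ A.Q ∥
          cop' (p , q) = cop (q , p)
          go : ∥ B.Q ∥ ∣ i → ⊥
          go (divides z i≡) = fin (one-or-big 0<z (quotient-congruent (∣Sub∣-pos B.Q) 0<z B.cong-Q
              (subst (λ t → k₀ ∣ t ^ e ∸ 1) i≡' (quotient-congruent (∣Sub∣-pos A.Q) (Index.pos A.I) A.cong-Q
                (subst (λ t → k₀ ∣ t ^ e ∸ 1) (Index.eq A.I) congD)))))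
            where
            i≡' : i ≡ ∥ B.Q ∥ * z
            i≡' = trans i≡ (*-comm z _)
            0<z : 0 < z
            0<z = ∣-pos (divides ∥ B.Q ∥ i≡') (Index.pos A.I)
            D≡ : ∥ D ∥ ≡ ∥ A.Q ∥ * (∥ B.Q ∥ * z)
            D≡ = trans (Index.eq A.I) (cong (∥ A.Q ∥ *_) i≡')
            fin : z ≡ 1 ⊎ Big z → ⊥
            fin (inj₂ b) = not-three {∥ A.Q ∥} {∥ B.Q ∥} {z} D≡ A.bigQ B.bigQ b
            fin (inj₁ z≡1) = Itô.impossible D A.Q B.Q simple nonab (proj₁ A.prim) (proj₁ B.prim) A.abelian B.abelian
              (factorised A.Q B.Q (proj₁ A.prim) (proj₁ B.prim) cop
                (trans D≡ (cong (∥ A.Q ∥ *_) (trans (cong (∥ B.Q ∥ *_) z≡1) (*-identityʳ _)))))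

  -- Simple groups do not act on four points

  module SmallDegree (T : Sub) (simple : IsSimple T) (nonab : NonAbelian T) where
    record ActionOn (m : ℕ) : Set where
      field
        F   : Fin n → Fin m → Fin m
        F-∙ : ∀ s t → s ∈' T → t ∈' T → ∀ x → F (s ∙ t) x ≡ F s (F t x)
        F-ε : ∀ x → F ε x ≡ x

      F⁻¹ : ∀ t → t ∈' T → ∀ x → F (t ⁻¹) (F t x) ≡ x
      F⁻¹ t t∈ x = trans (sym (F-∙ _ _ (⁻¹∈ T t∈) t∈ x)) (trans (cong (λ u → F u x) (inverseˡ t)) (F-ε x))

      F-injective : ∀ t → t ∈' T → InjectiveFun (F t)
      F-injective t t∈ a b e = trans (sym (F⁻¹ t t∈ a)) (trans (cong (F (t ⁻¹)) e) (F⁻¹ t t∈ b))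

      kernel : Sub
      kernel = record
        { set = mk (λ t → (t ∈?' T) ×-dec identity? (F t)) ; ε∈ = ε∈ T , F-ε
        ; ∙∈ = λ (s∈ , p) (t∈ , q) → ∙∈ T s∈ t∈ , λ x → trans (F-∙ _ _ s∈ t∈ x) (trans (cong (F _) (q x)) (p x))
        ; ⁻¹∈ = λ {t} (t∈ , p) → ⁻¹∈ T t∈ , λ x → trans (cong (F (t ⁻¹)) (sym (p x))) (F⁻¹ t t∈ x) }

      kernel⊲ : kernel ⊲ T
      kernel⊲ = (λ _ → proj₁) , λ g t g∈ (t∈ , p) → ∙∈ T (∙∈ T g∈ t∈) (⁻¹∈ T g∈) , λ x →
        trans (F-∙ _ _ (∙∈ T g∈ t∈) (⁻¹∈ T g∈) x) (trans (F-∙ _ _ g∈ t∈ _) (trans (cong (F g) (p _))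
          (trans (sym (F-∙ _ _ g∈ (⁻¹∈ T g∈) x)) (trans (cong (λ u → F u x) (inverseʳ g)) (F-ε x)))))

      Trivially Faithfully : Set
      Trivially = ∀ t → t ∈' T → Identity (F t)
      Faithfully = ∀ t → t ∈' T → Identity (F t) → t ≡ ε

      dichotomy : Trivially ⊎ Faithfully
      dichotomy with Fin.all? (λ x → (x ∈?' kernel) →-dec (x Fin.≟ ε))
      ... | yes tr = inj₂ (λ t t∈ p → tr t (t∈ , p))
      ... | no ¬tr = inj₁ (λ t t∈ → proj₂ (simple kernel kernel⊲ ¬tr t t∈))

      not-commuting : Faithfully → (∀ s t → s ∈' T → t ∈' T → ∀ x → F s (F t x) ≡ F t (F s x)) → ⊥
      not-commuting faithful comm = nonab λ s t s∈ t∈ → trans (solve 2 (λ s t → s · t ⊜ (t · s) · ((t · s) ⁻ · (s · t))) refl s t)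
        (trans (cong (t ∙ s ∙_) (faithful _ (∙∈ T (⁻¹∈ T (∙∈ T t∈ s∈)) (∙∈ T s∈ t∈)) λ x →
          trans (F-∙ _ _ (⁻¹∈ T (∙∈ T t∈ s∈)) (∙∈ T s∈ t∈) x) (trans (cong (F _) (trans (F-∙ _ _ s∈ t∈ x) (trans (comm s t s∈ t∈ x) (sym (F-∙ _ _ t∈ s∈ x)))))
            (F⁻¹ _ (∙∈ T t∈ s∈) x)))) (identityʳ _))

    module Descend {m : ℕ} (p : Fin (suc m) → Fin (suc m) → Fin m) (p0 : ∀ j → p zero (suc j) ≡ j)
                   (check : Compat-check p) (kernel-comm : Kernel-abelian p) (A : ActionOn (suc m)) where
      open ActionOn A

      tab-injective : ∀ (f : Fin (suc m) → Fin (suc m)) → InjectiveFun f → InjectiveFun (lookup (tabulate f))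
      tab-injective f inj a b e = inj a b (trans (sym (lookup∘tabulate f a)) (trans e (lookup∘tabulate f b)))

      compatible : ∀ t → t ∈' T → Compatible p (F t)
      compatible t t∈ a b ne = subst₂ _≡_ (cong₂ p (lt a) (lt b)) (cong₂ p (lt zero) (lt _))
          (check (tabulate (F t)) (tab-injective (F t) (F-injective t t∈)) a b ne)
        where
        lt : ∀ x → lookup (tabulate (F t)) x ≡ F t x
        lt = lookup∘tabulate (F t)

      lower : ActionOn m
      lower = record
        { F = λ t → induced p (F t)
        ; F-∙ = λ s t s∈ t∈ j → trans (cong₂ p (F-∙ s t s∈ t∈ zero) (F-∙ s t s∈ t∈ (suc j)))
                  (compatible s s∈ (F t zero) (F t (suc j)) (λ e → 0≢s (F-injective t t∈ _ _ e)))
        ; F-ε = λ j → trans (cong₂ p (F-ε zero) (F-ε (suc j))) (p0 j) }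
        where
        0≢s : ∀ {j : Fin m} → ¬ (zero {m} ≡ suc j)
        0≢s ()

      -- By simplicity the lower action is trivial or faithful. If it were trivial, T would act
      -- through the abelian kernel.
      faithful-lower : Faithfully → ActionOn.Faithfully lower
      faithful-lower faithful = [ (λ tr → ⊥-elim (not-commuting faithful (λ s t s∈ t∈ x → comm s t s∈ t∈ tr x))) , id ]′ (ActionOn.dichotomy lower)
        where
        comm : ∀ s t → s ∈' T → t ∈' T → ActionOn.Trivially lower → ∀ x → F s (F t x) ≡ F t (F s x)
        comm s t s∈ t∈ tr x = subst₂ _≡_ (trans (ls _) (cong (F s) (lt x))) (trans (lt _) (cong (F t) (ls x)))
            (kernel-comm (tabulate (F s)) (tab-injective (F s) (F-injective s s∈) , λ j → trans (cong₂ p (ls zero) (ls (suc j))) (tr s s∈ j))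
                    (tabulate (F t)) (tab-injective (F t) (F-injective t t∈) , λ j → trans (cong₂ p (lt zero) (lt (suc j))) (tr t t∈ j)) x)
          where
          ls : ∀ x → lookup (tabulate (F s)) x ≡ F s x
          ls = lookup∘tabulate (F s)
          lt : ∀ x → lookup (tabulate (F t)) x ≡ F t x
          lt = lookup∘tabulate (F t)

    no-degree-4 : (A : ActionOn 4) → ActionOn.Faithfully A → ⊥
    no-degree-4 A faithful = ActionOn.not-commuting D₃.lower (D₃.faithful-lower (D₄.faithful-lower faithful)) comm
      where
      module D₄ = Descend pairing (λ _ → refl) pairing-compat pairing-kernel A
      module D₃ = Descend orientation (λ _ → refl) orientation-compat orientation-kernel D₄.lower
      open ActionOn D₃.lower
      tab-injective : ∀ (f : Fin 2 → Fin 2) → InjectiveFun f → InjectiveFun (lookup (tabulate f))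
      tab-injective f inj a b e = inj a b (trans (sym (lookup∘tabulate f a)) (trans e (lookup∘tabulate f b)))
      only-zero : ∀ (j : Fin 1) → zero ≡ j
      only-zero zero = refl
      comm : ∀ s t → s ∈' T → t ∈' T → ∀ x → F s (F t x) ≡ F t (F s x)
      comm s t s∈ t∈ x = subst₂ _≡_ (trans (ls _) (cong (F s) (lt x))) (trans (lt _) (cong (F t) (ls x)))
            (Sym2-abelian (tabulate (F s)) (tab-injective (F s) (F-injective s s∈) , only-zero)
                          (tabulate (F t)) (tab-injective (F t) (F-injective t t∈) , only-zero) x)
          where
          ls : ∀ x → lookup (tabulate (F s)) x ≡ F s x
          ls = lookup∘tabulate (F s)
          lt : ∀ x → lookup (tabulate (F t)) x ≡ F t x
          lt = lookup∘tabulate (F t)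

  -- Group actions, orbits and commuting normal subgroups

  module Orbits {v : ℕ} (A : Action G v) where
    open Action A

    act⁻¹ : ∀ g x → act (g ⁻¹) (act g x) ≡ x
    act⁻¹ g x = trans (sym (act-∙ _ _ x)) (trans (cong (λ h → act h x) (inverseˡ g)) (act-ε x))

    act-act⁻¹ : ∀ g x → act g (act (g ⁻¹) x) ≡ x
    act-act⁻¹ g x = trans (sym (act-∙ _ _ x)) (trans (cong (λ h → act h x) (inverseʳ g)) (act-ε x))

    act-injective : ∀ g {x y} → act g x ≡ act g y → x ≡ y
    act-injective g {x} {y} e = trans (sym (act⁻¹ g x)) (trans (cong (act (g ⁻¹)) e) (act⁻¹ g y))

    act-▷ : ∀ g h x → act (g ▷ h) (act g x) ≡ act g (act h x)
    act-▷ g h x = trans (sym (act-∙ _ _ x)) (trans (cong (λ t → act t x) (solve 2 (λ g h → (g :▷ h) · g ⊜ g · h) refl g h)) (act-∙ g h x))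

    stabilizer : Fin v → Sub
    stabilizer x = record
      { set = mk (λ g → act g x Fin.≟ x) ; ε∈ = act-ε x
      ; ∙∈ = λ {g} {h} p q → trans (act-∙ g h x) (trans (cong (act g) q) p)
      ; ⁻¹∈ = λ {g} p → trans (cong (act (g ⁻¹)) (sym p)) (act⁻¹ g x) }

    orbit : Sub → Fin v → DSet v
    orbit H x = mk (λ y → Fin.any? (λ h → (h ∈?' H) ×-dec (act h x Fin.≟ y)))

    x∊orbit : ∀ H x → x ∊ orbit H x
    x∊orbit H x = ε , ε∈ H , act-ε x

    opaque
      orbit-stabilizer : ∀ H x → ∥ H ∥ ≡ # (orbit H x) * ∥ H ⊓ stabilizer x ∥
      orbit-stabilizer H x = trans (sym (*-identityʳ _)) (double-count (set H) (orbit H x)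
        (λ h y → (h ∈?' H) ×-dec (act h x Fin.≟ y)) 1 ∥ H ⊓ stabilizer x ∥
        (λ { h y (h∈ , e) → h∈ , h , h∈ , e })
        (λ h h∈ → trans (#-cong _ (single (act h x)) (λ _ (_ , e) → sym e) (λ _ e → h∈ , sym e)) (#-single _))
        (λ { y (t , t∈ , refl) → #-bij _ _ (t ⁻¹ ∙_) (t ∙_)
             (solve 2 (λ t s → t ⁻ · (t · s) ⊜ s) refl t) (solve 2 (λ t s → t · (t ⁻ · s) ⊜ s) refl t)
             (λ { s (s∈ , e) → ∙∈ H (⁻¹∈ H t∈) s∈ , trans (act-∙ _ _ x) (trans (cong (act (t ⁻¹)) e) (act⁻¹ t x)) })
             (λ { s (s∈ , e) → ∙∈ H t∈ s∈ , trans (act-∙ _ _ x) (cong (act t) e) }) }))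

    orbits : Sub → DEquiv v
    orbits H = record
      { ~? = λ x → mem? (orbit H x) ; ~refl = x∊orbit H
      ; ~sym = λ { {x} (h , h∈ , refl) → h ⁻¹ , ⁻¹∈ H h∈ , act⁻¹ h x }
      ; ~trans = λ { {x} (h , h∈ , refl) (k , k∈ , refl) → k ∙ h , ∙∈ H k∈ h∈ , act-∙ k h x } }

    TransitiveOn : Sub → Fin v → Set
    TransitiveOn H x = ∀ y → Σ[ h ∈ Fin n ] (h ∈' H × act h x ≡ y)

    -- K i are pairwise commuting normal subgroups of N with N = K i × C_N(K i), and together
    -- they generate N (here: nothing but ε commutes with all of them).
    record Family (N : Sub) (α : Fin v) (b : ℕ) : Set₁ where
      field
        K       : Fin b → Sub
        K⊆N     : ∀ i → K i ⊆' N
        commute : ∀ {i j} → i ≢ j → CommuteWith (K i) (K j)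

      C : Fin b → Sub
      C i = centralizer N (K i)

      field
        K∩C     : ∀ i x → x ∈' K i → x ∈' C i → x ≡ ε
        K·C     : ∀ i x → x ∈' N → Σ[ t ∈ Fin n ] (t ∈' K i × t ⁻¹ ∙ x ∈' C i)
        joint   : ∀ x → x ∈' N → (∀ i → x ∈' C i) → x ≡ ε
        permute : ∀ g → g ∈' stabilizer α → ∀ i → Σ[ j ∈ Fin b ] (∀ x → x ∈' K i → g ▷ x ∈' K j)

      K⊆C : ∀ {i j} → i ≢ j → K i ⊆' C j
      K⊆C {i} {j} i≢j x x∈ = K⊆N i x x∈ , λ y y∈ → commute i≢j x y x∈ y∈

      K-normal : ∀ i g x → g ∈' N → x ∈' K i → g ▷ x ∈' K i
      K-normal i g x g∈ x∈ with K·C i g g∈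
      ... | t , t∈ , _ , c = ∈-cong (K i) (trans (cong (t ▷_) (sym (comm⇒▷ (c x x∈)))) (solve 3 (λ t g x → t :▷ ((t ⁻ · g) :▷ x) ⊜ g :▷ x) refl t g x))
                               (∙∈ (K i) (∙∈ (K i) t∈ x∈) (⁻¹∈ (K i) t∈))

      -- `W` contains the components of its elements, the i-th ones forming `X i`. `Y j` is the part
      -- of `W` whose first j components are trivial; each step splits off one factor of order f,
      -- and `joint` ends the chain at the trivial group.
      module Count (W : Sub) (W⊆N : W ⊆' N) (X : Fin b → Sub) (X⊆K : ∀ i → X i ⊆' K i) (X⊆W : ∀ i → X i ⊆' W)
                   (factor : ∀ i w → w ∈' W → Σ[ t ∈ Fin n ] (t ∈' X i × t ⁻¹ ∙ w ∈' C i))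
                   (f : ℕ) (∣X∣ : ∀ i → ∥ X i ∥ ≡ f) where
        Y : ℕ → Sub
        Y j = W ⊓ record
          { set = mk (λ x → Fin.all? (λ i → (toℕ i <? j) →-dec (x ∈?' C i)))
          ; ε∈ = λ i _ → ε∈ (C i) ; ∙∈ = λ p q i l → ∙∈ (C i) (p i l) (q i l) ; ⁻¹∈ = λ p i l → ⁻¹∈ (C i) (p i l) }

        opaque
          step : ∀ j → j < b → ∥ Y j ∥ ≡ f * ∥ Y (suc j) ∥
          step j j<b = trans (∣factor∣ (Y j) (X i) (Y (suc j)) X⊆Y
              (λ { x (x∈ , p) → x∈ , λ i' l → p i' (m<n⇒m<1+n l) })
              (λ { x x∈ (_ , p) → K∩C i x (X⊆K i x x∈) (p i (≤-reflexive (cong suc toℕi))) })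
              (λ { w (w∈ , p) → let t , t∈ , q = factor i w w∈ in t , t∈ ,
                    (∙∈ W (⁻¹∈ W (X⊆W i t t∈)) w∈ , λ i' l → case i' (Fin._≟_ i i') t∈ q p l) }))
              (cong (_* ∥ Y (suc j) ∥) (∣X∣ i))
            where
            i : Fin b
            i = fromℕ< j<b
            toℕi : toℕ i ≡ j
            toℕi = Fin.toℕ-fromℕ< j<b
            X⊆Y : X i ⊆' Y j
            X⊆Y x x∈ = X⊆W i x x∈ , λ i' l → K⊆C (λ e → <-irrefl (trans (sym (cong toℕ e)) toℕi) l) x (X⊆K i x x∈)
            case : ∀ i' → Dec (i ≡ i') → ∀ {t w} → t ∈' X i → t ⁻¹ ∙ w ∈' C i → (∀ i'' → toℕ i'' < j → w ∈' C i'') → toℕ i' < suc j → t ⁻¹ ∙ w ∈' C i'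
            case i' (yes refl) t∈ q p l = q
            case i' (no ne) t∈ q p l = ∙∈ (C i') (⁻¹∈ (C i') (K⊆C ne _ (X⊆K i _ t∈)))
              (p i' (≤∧≢⇒< (s≤s⁻¹ l) (λ e → ne (Fin.toℕ-injective (trans toℕi (sym e))))))

          steps : ∀ j → j ≤ b → ∥ W ∥ ≡ f ^ j * ∥ Y j ∥
          steps zero _ = trans (#-cong (set W) (set (Y 0)) (λ x x∈ → x∈ , λ i ()) (λ _ → proj₁)) (sym (*-identityˡ _))
          steps (suc j) l = trans (steps j (<⇒≤ l)) (trans (cong (f ^ j *_) (step j l)) (lem (f ^ j) f _))
            where
            lem : ∀ a f y → a * (f * y) ≡ f * a * y
            lem = solve-∀

          order : ∥ W ∥ ≡ f ^ b
          order = trans (steps b ≤-refl) (trans (cong (f ^ b *_) (trans (#-cong (set (Y b)) (single ε)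
            (λ { x (x∈ , p) → joint x (W⊆N x x∈) (λ i → p i (Fin.toℕ<n i)) }) (λ { x refl → ε∈ (Y b) })) (#-single ε))) (*-identityʳ _))

    -- Minimal normal subgroups

    module Structure (α : Fin v) where
      St : Sub
      St = stabilizer α

      Invariant : Sub → Set
      Invariant M = ∀ g x → x ∈' M → g ▷ x ∈' M

      -- `split` says that N_α contains the components of its elements, so that the orbits of the
      -- `K i` are the lines of a grid. A `K i` may be a product of several simple groups; `T` is
      -- one simple factor, kept for lines of four points.
      record GridData : Set₁ where
        field
          N : Sub
          b : ℕ
          family : Family N α b
        open Family family public
        field
          2≤b   : 2 ≤ b
          N-transitive : TransitiveOn N α
          split : ∀ i a c → a ∈' K i → c ∈' C i → a ∙ c ∈' St → a ∈' St
          moved : ∀ i → ¬ K i ⊆' St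
          conjugates : ∀ i j → Σ[ g ∈ Fin n ] (g ∈' St × (∀ x → x ∈' K i → g ▷ x ∈' K j) × (∀ x → x ∈' K j → g ⁻¹ ▷ x ∈' K i))
          permuteAll : ∀ g i → Σ[ j ∈ Fin b ] (∀ x → x ∈' K i → g ▷ x ∈' K j)
          T : Sub
          T-simple : IsSimple T
          T-nonab : NonAbelian T
          i₀ : Fin b
          T⊆K : T ⊆' K i₀

      -- `D∩C` and `D·C` say that projection to any `K i` maps D isomorphically onto it. The `K i`
      -- may be nonconjugate, because the pair N, C_G(N) has to fit as well.
      record DiagData : Set₁ where
        field
          N : Sub
          m : ℕ
          family : Family N α m
        open Family family public
        D : Sub
        D = N ⊓ St
        field
          2≤m   : 2 ≤ m
          N-transitive : TransitiveOn N α
          N-invariant  : ∀ g x → g ∈' St → x ∈' N → g ▷ x ∈' N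
          D∩C   : ∀ i x → x ∈' D → x ∈' C i → x ≡ ε
          D·C   : ∀ i x → x ∈' N → Σ[ d ∈ Fin n ] (d ∈' D × d ⁻¹ ∙ x ∈' C i)
          i₁ : Fin m
          K-simple : IsSimple (K i₁)
          K-nonab  : NonAbelian (K i₁)

      trivial? : ∀ H → Dec (IsTrivial H)
      trivial? H = Fin.all? (λ x → (x ∈?' H) →-dec (x Fin.≟ ε))

      witness : ∀ {H} → ¬ IsTrivial H → Σ[ x ∈ Fin n ] (x ∈' H × x ≢ ε)
      witness {H} nt with Fin.any? (λ x → (x ∈?' H) ×-dec ¬? (x Fin.≟ ε))
      ... | yes p = p
      ... | no ¬p = ⊥-elim (nt λ x x∈ → decidable-stable (x Fin.≟ ε) λ ne → ¬p (x , x∈ , ne))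

      ⋂ : (Fin n → Sub) → Sub
      ⋂ F = record { set = mk (λ x → Fin.all? (λ g → x ∈?' F g)) ; ε∈ = λ g → ε∈ (F g)
                   ; ∙∈ = λ p q g → ∙∈ (F g) (p g) (q g) ; ⁻¹∈ = λ p g → ⁻¹∈ (F g) (p g) }

      ⊓-⊲ : ∀ {K L N} → K ⊲ N → L ⊲ N → (K ⊓ L) ⊲ N
      ⊓-⊲ (a , f) (b , g) = (λ x (p , _) → a x p) , λ h x h∈ (p , q) → f h x h∈ p , g h x h∈ q

      disjoint⇒commute : ∀ {K L N} → K ⊲ N → L ⊲ N → IsTrivial (K ⊓ L) → CommuteWith K L
      disjoint⇒commute {K} {L} (K⊆N , kn) (L⊆N , ln) t x y x∈ y∈ =
        trans (solve 2 (λ x y → x · y ⊜ (x · y · x ⁻ · y ⁻) · (y · x)) refl x y)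
          (trans (cong (_∙ (y ∙ x)) (t (x ∙ y ∙ x ⁻¹ ∙ y ⁻¹)
            (∈-cong K (solve 2 (λ x y → x · (y :▷ (x ⁻)) ⊜ x · y · x ⁻ · y ⁻) refl x y) (∙∈ K x∈ (kn y (x ⁻¹) (L⊆N y y∈) (⁻¹∈ K x∈))) ,
             ∙∈ L (ln x y (K⊆N x x∈) y∈) (⁻¹∈ L y∈)))) (identityˡ _))

      centralizer-▷ : ∀ N K L h → (∀ x → x ∈' N → h ▷ x ∈' N) → (∀ y → y ∈' L → h ⁻¹ ▷ y ∈' K) →
                      ∀ x → x ∈' centralizer N K → h ▷ x ∈' centralizer N L
      centralizer-▷ N K L h hN hK x (x∈ , c) = hN x x∈ , λ y y∈ → subst (Commutes (h ▷ x)) (▷-cancelʳ h y) (comm-▷ h (c _ (hK y y∈)))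

      centralizer-⊲ : ∀ {N K} → K ⊲ N → centralizer N K ⊲ N
      centralizer-⊲ {N} {K} (K⊆N , kn) = (λ _ → proj₁) , λ g x g∈ → centralizer-▷ N K K g
        (λ y y∈ → ∙∈ N (∙∈ N g∈ y∈) (⁻¹∈ N g∈)) (λ y → kn (g ⁻¹) y (⁻¹∈ N g∈)) x

      conjugate-⊲ : ∀ g {N K} → Invariant N → K ⊲ N → conjugate g K ⊲ N
      conjugate-⊲ g {N} {K} inv (K⊆N , kn) = (λ x p → ∈-cong N (▷-cancelʳ g x) (inv g _ (K⊆N _ p))) ,
        λ h x h∈ p → ∈-cong K (solve 3 (λ g h x → ((g ⁻) :▷ h) :▷ ((g ⁻) :▷ x) ⊜ (g ⁻) :▷ (h :▷ x)) refl g h x) (kn (g ⁻¹ ▷ h) _ (inv (g ⁻¹) h h∈) p)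

      -- X ↦ K i₁ ∩ X C matches the normal subgroups of D with those of K i₁.
      module DiagonalFactor (dd : DiagData) where
        open DiagData dd

        K₁ C₁ : Sub
        K₁ = K i₁
        C₁ = C i₁

        C₁⊲ : C₁ ⊲ N
        C₁⊲ = centralizer-⊲ {N} {K₁} (K⊆N i₁ , K-normal i₁)

        ▷-via-D : ∀ h d t → d ⁻¹ ∙ h ∈' C₁ → t ∈' K₁ → h ▷ t ≡ d ▷ t
        ▷-via-D h d t c t∈ = trans (solve 3 (λ a h t → h :▷ t ⊜ a :▷ ((a ⁻ · h) :▷ t)) refl d h t) (cong (d ▷_) (comm⇒▷ (proj₂ c t t∈)))

        D-nonab : NonAbelian D
        D-nonab ab = K-nonab λ t₁ t₂ t₁∈ t₂∈ →
          let d₁ , d₁∈ , c₁ = D·C i₁ t₁ (K⊆N i₁ t₁ t₁∈)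
              d₂ , d₂∈ , c₂ = D·C i₁ t₂ (K⊆N i₁ t₂ t₂∈)
              w = d₂ ⁻¹ ∙ t₂
              e : t₂ ⁻¹ ∙ (d₁ ▷ t₂) ≡ w ⁻¹ ∙ (d₁ ▷ w)
              e = trans (solve 3 (λ y t d → t ⁻ · (y :▷ t) ⊜ (d ⁻ · t) ⁻ · d ⁻ · (y :▷ d) · (y :▷ (d ⁻ · t))) refl d₁ t₂ d₂)
                    (trans (cong (λ u → w ⁻¹ ∙ d₂ ⁻¹ ∙ u ∙ (d₁ ▷ w)) (comm⇒▷ (ab d₁ d₂ d₁∈ d₂∈)))
                      (solve 3 (λ w d z → w ⁻ · d ⁻ · d · z ⊜ w ⁻ · z) refl w d₂ (d₁ ▷ w)))
              z≡ε = K∩C i₁ (t₂ ⁻¹ ∙ (d₁ ▷ t₂)) (∙∈ K₁ (⁻¹∈ K₁ t₂∈) (K-normal i₁ d₁ t₂ (proj₁ d₁∈) t₂∈))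
                      (∈-cong C₁ (sym e) (∙∈ C₁ (⁻¹∈ C₁ c₂) (proj₂ C₁⊲ d₁ _ (proj₁ d₁∈) c₂)))
          in ▷⇒comm (trans (▷-via-D t₁ d₁ t₂ c₁ t₂∈) (trans (solve 2 (λ t w → w ⊜ t · (t ⁻ · w)) refl t₂ (d₁ ▷ t₂)) (trans (cong (t₂ ∙_) z≡ε) (identityʳ t₂))))

        D-simple : IsSimple D
        D-simple X (X⊆D , xn) nt d d∈ = back (K·C i₁ d (proj₁ d∈))
          where
          Im : Sub
          Im = K₁ ⊓ product X C₁ (λ h x h∈ → proj₂ C₁⊲ h x (proj₁ (X⊆D h h∈)))
          Im⊲ : Im ⊲ K₁
          Im⊲ = (λ _ → proj₁) , λ h t h∈ (t∈ , x , x∈ , c) →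
            let a , a∈ , c' = D·C i₁ h (K⊆N i₁ h h∈)
            in ∙∈ K₁ (∙∈ K₁ h∈ t∈) (⁻¹∈ K₁ h∈) , a ▷ x , xn a x a∈ x∈ ,
               ∈-cong C₁ (trans (solve 3 (λ a d t → a :▷ (d ⁻ · t) ⊜ (a :▷ d) ⁻ · (a :▷ t)) refl a x t) (cong ((a ▷ x) ⁻¹ ∙_) (sym (▷-via-D h a t c' t∈))))
                 (proj₂ C₁⊲ a _ (proj₁ a∈) c)
          Im-nt : ¬ IsTrivial Im
          Im-nt tr = nt λ x x∈ →
            let t , t∈ , c = K·C i₁ x (proj₁ (X⊆D x x∈))
                t≡ε = tr t (t∈ , x , x∈ , ∈-cong C₁ (solve 2 (λ t d → (t ⁻ · d) ⁻ ⊜ d ⁻ · t) refl t x) (⁻¹∈ C₁ c))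
            in D∩C i₁ x (X⊆D x x∈) (∈-cong C₁ (trans (cong (λ u → u ⁻¹ ∙ x) t≡ε) (solve 1 (λ d → :ε ⁻ · d ⊜ d) refl x)) c)
          back : Σ[ t ∈ Fin n ] (t ∈' K₁ × t ⁻¹ ∙ d ∈' C₁) → d ∈' X
          back (t , t∈ , c) =
            let _ , x , x∈ , c' = K-simple Im Im⊲ Im-nt t t∈
                e = D∩C i₁ (x ⁻¹ ∙ d) (∙∈ D (⁻¹∈ D (X⊆D x x∈)) d∈)
                      (∈-cong C₁ (solve 3 (λ d t x → (d ⁻ · t) · (t ⁻ · x) ⊜ d ⁻ · x) refl x t d) (∙∈ C₁ c' c))
            in ∈-cong X (trans (sym (trans (cong (x ∙_) e) (identityʳ x))) (solve 2 (λ d a → d · (d ⁻ · a) ⊜ a) refl x d)) x∈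

      -- N is a minimal normal subgroup of the whole group; T is a normal subgroup of N of least
      -- order, so N is generated by the pairwise commuting conjugates of T.
      module MinimalNormal (prim : ∀ L → (∀ g x → g ∈' St → x ∈' L → g ▷ x ∈' L) → L ⊆' St ⊎ TransitiveOn L α)
        (N : Sub) (inv : Invariant N) (minN : ∀ M → Invariant M → M ⊆' N → ¬ IsTrivial M → N ⊆' M)
        (nonabN : NonAbelian N) (transN : TransitiveOn N α)
        (T : Sub) (T⊲N : T ⊲ N) (T-nt : ¬ IsTrivial T) (minT : ∀ L → L ⊲ N × ¬ IsTrivial L → ∥ T ∥ ≤ ∥ L ∥)
        (T≢N : ¬ N ⊆' T) where

        Tᵍ : Fin n → Sub
        Tᵍ g = conjugate g T

        Cᴺ : Sub → Sub
        Cᴺ K = centralizer N K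

        T⊲ : ∀ g → Tᵍ g ⊲ N
        T⊲ g = conjugate-⊲ g {N} {T} inv T⊲N

        opaque
          -- The intersection is normal in N. If nontrivial, it has at least the order of T and is
          -- the whole conjugate; if trivial, the two normal subgroups commute.
          T-dichotomy : ∀ {K} → K ⊲ N → ∀ g → Tᵍ g ⊆' K ⊎ CommuteWith (Tᵍ g) K
          T-dichotomy {K} K⊲ g with trivial? (Tᵍ g ⊓ K)
          ... | yes t = inj₂ (disjoint⇒commute {Tᵍ g} {K} {N} (T⊲ g) K⊲ t)
          ... | no nt = inj₁ λ x x∈ → proj₂ (⊆∧≥⇒⊇ {Tᵍ g ⊓ K} {Tᵍ g} (λ _ → proj₁)
                  (≤-trans (≤-reflexive (∣conjugate∣ g T)) (minT (Tᵍ g ⊓ K) (⊓-⊲ {Tᵍ g} {K} {N} (T⊲ g) K⊲ , nt))) x x∈)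

          -- The intersection of all conjugates of L is normal in the whole group and contains T, so
          -- it contains N by minimality.
          generated : ∀ L → L ⊆' N → (∀ g → Tᵍ g ⊆' L) → N ⊆' L
          generated L L⊆N T⊆L x x∈ = ∈-cong L (solve 1 (λ x → :ε ⁻ :▷ x ⊜ x) refl x) (minN core coreInv
              (λ y p → L⊆N y (∈-cong L (solve 1 (λ x → :ε ⁻ :▷ x ⊜ x) refl y) (p ε)))
              (λ t → T-nt λ y y∈ → t y λ g → T⊆L (g ⁻¹) _ (▷∈conjugate (g ⁻¹) T y∈)) x x∈ ε)
            where
            core : Sub
            core = ⋂ (λ g → conjugate g L)
            coreInv : Invariant core
            coreInv h y p g = ∈-cong L (solve 3 (λ g h y → ((h ⁻ · g) ⁻) :▷ y ⊜ (g ⁻) :▷ (h :▷ y)) refl g h y) (p (h ⁻¹ ∙ g))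

          Z-trivial : ∀ x → x ∈' N → (∀ g → ∀ y → y ∈' Tᵍ g → Commutes x y) → x ≡ ε
          Z-trivial x x∈ c = decidable-stable (x Fin.≟ ε) λ ne → nonabN λ y z y∈ z∈ →
              proj₂ (minN (center N) (λ g → centralizer-▷ N N N g (inv g) (inv (g ⁻¹))) (λ _ → proj₁)
                (λ t → ne (t x (x∈ , λ w w∈ → proj₂ (generated L (λ _ → proj₁) (λ g w p → proj₁ (T⊲ g) w p , c g w p) w w∈)))) y y∈) z z∈
            where
            L : Sub
            L = N ⊓ record { set = mk (λ y → x ∙ y Fin.≟ y ∙ x) ; ε∈ = trans (identityʳ x) (sym (identityˡ x))
              ; ∙∈ = λ p p' → sym (comm-∙ (sym p) (sym p')) ; ⁻¹∈ = λ p → sym (comm-⁻¹ (sym p)) }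

          -- Each conjugate of T lies in K or centralises K, so the product of K and its centraliser
          -- contains all of them and is N by `generated`.
          factor : ∀ {K} → K ⊲ N → ∀ x → x ∈' N → Σ[ t ∈ Fin n ] (t ∈' K × t ⁻¹ ∙ x ∈' Cᴺ K)
          factor {K} K⊲ = generated P (λ { x (k , k∈ , c) → ∈-cong N (solve 2 (λ k x → k · (k ⁻ · x) ⊜ x) refl k x) (∙∈ N (proj₁ K⊲ k k∈) (proj₁ c)) })
              (λ g x x∈ → [ (λ le → x , le x x∈ , ∈-cong (Cᴺ K) (sym (inverseˡ x)) (ε∈ (Cᴺ K)))
                          , (λ cm → ε , ε∈ K , ∈-cong (Cᴺ K) (solve 1 (λ x → x ⊜ :ε ⁻ · x) refl x) (proj₁ (T⊲ g) x x∈ , λ y y∈ → cm x y x∈ y∈)) ]′ (T-dichotomy {K} K⊲ g))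
            where
            P : Sub
            P = product K (Cᴺ K) (λ h x h∈ → proj₂ (centralizer-⊲ {N} {K} K⊲) h x (proj₁ K⊲ h h∈))

          K∩Cᴺ : ∀ {K} → K ⊲ N → ∀ x → x ∈' K → x ∈' Cᴺ K → x ≡ ε
          K∩Cᴺ {K} K⊲ x x∈ (xN , c) = Z-trivial x xN λ g y y∈ →
            [ (λ le → c y (le y y∈)) , (λ cm → sym (cm y x y∈ x∈)) ]′ (T-dichotomy {K} K⊲ g)

        T-nonab : NonAbelian T
        T-nonab ab = T-nt λ x x∈ → K∩Cᴺ {T} T⊲N x x∈ (proj₁ T⊲N x x∈ , λ y y∈ → ab x y x∈ y∈)

        Tᵍ-nonab : ∀ g → NonAbelian (Tᵍ g)
        Tᵍ-nonab g ab = T-nonab λ x y x∈ y∈ → subst₂ Commutes (▷-cancelˡ g x) (▷-cancelˡ g y)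
          (comm-▷ (g ⁻¹) (ab (g ▷ x) (g ▷ y) (▷∈conjugate g T x∈) (▷∈conjugate g T y∈)))

        ⊲T⇒⊲N : ∀ {g X} → X ⊲ Tᵍ g → X ⊲ N
        ⊲T⇒⊲N {g} {X} (X⊆T , xn) = (λ x p → proj₁ (T⊲ g) x (X⊆T x p)) , λ h x h∈ p →
          let t , t∈ , _ , c = factor {Tᵍ g} (T⊲ g) h h∈
          in ∈-cong X (trans (cong (t ▷_) (sym (comm⇒▷ (c x (X⊆T x p))))) (solve 3 (λ t h x → t :▷ ((t ⁻ · h) :▷ x) ⊜ h :▷ x) refl t h x)) (xn t x t∈ p)

        Tᵍ-least : ∀ g X → X ⊲ N → X ⊆' Tᵍ g → ¬ IsTrivial X → Tᵍ g ⊆' X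
        Tᵍ-least g X X⊲ X⊆ nt = ⊆∧≥⇒⊇ {X} {Tᵍ g} X⊆ (≤-trans (≤-reflexive (∣conjugate∣ g T)) (minT X (X⊲ , nt)))

        Tᵍ-simple : ∀ g → IsSimple (Tᵍ g)
        Tᵍ-simple g X X⊲ nt = Tᵍ-least g X (⊲T⇒⊲N {g} {X} X⊲) (proj₁ X⊲) nt

        N-factor-T : ∀ g h → h ∈' N → Σ[ t ∈ Fin n ] (t ∈' Tᵍ g × t ⁻¹ ∙ h ∈' Cᴺ (Tᵍ g))
        N-factor-T g = factor {Tᵍ g} (T⊲ g)

        module _ {K : Sub} (K⊲ : K ⊲ N) where
          contains-T : ¬ IsTrivial K → Σ[ g ∈ Fin n ] Tᵍ g ⊆' K
          contains-T nt with Fin.any? (λ g → ⊆?' (Tᵍ g) K)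
          ... | yes p = p
          ... | no none = ⊥-elim (nt λ x x∈ → Z-trivial x (proj₁ K⊲ x x∈) λ g y y∈ →
                  [ (λ le → ⊥-elim (none (g , le))) , (λ cm → sym (cm y x y∈ x∈)) ]′ (T-dichotomy {K} K⊲ g))

        Cᴺ-shift : ∀ s g x → x ∈' Cᴺ (Tᵍ (s ⁻¹ ∙ g)) → s ▷ x ∈' Cᴺ (Tᵍ g)
        Cᴺ-shift s g = centralizer-▷ N (Tᵍ (s ⁻¹ ∙ g)) (Tᵍ g) s (inv s)
          (λ y p → ∈-cong T (solve 3 (λ s g y → (g ⁻) :▷ y ⊜ ((s ⁻ · g) ⁻) :▷ ((s ⁻) :▷ y)) refl s g y) p)

        -- The conjugates under St of a normal subgroup K of N, without repetitions.
        module Conjugates (K : Sub) (K⊲ : K ⊲ N) (K-nt : ¬ IsTrivial K)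
          (K-dichotomy : ∀ s → s ∈' St → K ⊆' conjugate s K ⊎ CommuteWith K (conjugate s K)) where

          Kˢ : Fin n → Sub
          Kˢ s = conjugate s K

          -- Elements outside G_α are sent to `ε`, so that an equivalence on the whole index set has
          -- the G_α-conjugates of K as its classes.
          σ : Fin n → Fin n
          σ g with g ∈?' St
          ... | yes _ = g
          ... | no _ = ε

          σ∈ : ∀ g → σ g ∈' St
          σ∈ g with g ∈?' St
          ... | yes p = p
          ... | no _ = ε∈ St

          σ-id : ∀ g → g ∈' St → σ g ≡ g
          σ-id g g∈ with g ∈?' St
          ... | yes _ = refl
          ... | no ¬p = ⊥-elim (¬p g∈)

          E : DEquiv n
          E = record
            { ~? = λ g h → ⊆?' (Kˢ (σ g)) (Kˢ (σ h)) ×-dec ⊆?' (Kˢ (σ h)) (Kˢ (σ g))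
            ; ~refl = λ _ → (λ _ p → p) , (λ _ p → p) ; ~sym = swap
            ; ~trans = λ (p , q) (p' , q') → (λ x → p' x ∘ p x) , (λ x → q x ∘ q' x) }

          module Q = Quotient (quotient E)

          b : ℕ
          b = Q.size

          s : Fin b → Fin n
          s i = σ (Q.rep i)

          Kᵢ : Fin b → Sub
          Kᵢ i = Kˢ (s i)

          K⊲ᵢ : ∀ i → Kᵢ i ⊲ N
          K⊲ᵢ i = conjugate-⊲ (s i) {N} {K} inv K⊲

          locate : ∀ t → t ∈' St → Σ[ i ∈ Fin b ] (Kˢ t ⊆' Kᵢ i × Kᵢ i ⊆' Kˢ t)
          locate t t∈ = Q.cls t , subst (λ u → Kˢ u ⊆' Kᵢ i × Kᵢ i ⊆' Kˢ u) (σ-id t t∈) (Q.exact {t} {Q.rep i} (sym (Q.cls-rep i)))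
            where
            i : Fin b
            i = Q.cls t

          pair-dichotomy : ∀ s t → s ∈' St → t ∈' St → Kˢ s ⊆' Kˢ t ⊎ CommuteWith (Kˢ s) (Kˢ t)
          pair-dichotomy s t s∈ t∈ = [ (λ le → inj₁ λ x p → ∈-cong K (eq x) (le _ p))
              , (λ cm → inj₂ λ x y x∈ y∈ → subst₂ Commutes (▷-cancelʳ s x) (▷-cancelʳ s y)
                   (comm-▷ s (cm (s ⁻¹ ▷ x) (s ⁻¹ ▷ y) x∈ (∈-cong K (sym (eq y)) y∈)))) ]′
              (K-dichotomy (s ⁻¹ ∙ t) (∙∈ St (⁻¹∈ St s∈) t∈))
            where
            eq : ∀ x → (s ⁻¹ ∙ t) ⁻¹ ▷ (s ⁻¹ ▷ x) ≡ t ⁻¹ ▷ x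
            eq = solve 3 (λ s t x → ((s ⁻ · t) ⁻) :▷ ((s ⁻) :▷ x) ⊜ (t ⁻) :▷ x) refl s t

          -- Conjugation by N is trivial on the conjugates of K and St is a supplement of N.
          every-conjugate : ∀ g → Σ[ i ∈ Fin b ] (Kˢ g ⊆' Kᵢ i)
          every-conjugate g =
            let m , m∈ , e = transN (act g α)
                t = m ⁻¹ ∙ g
                t∈ = trans (act-∙ _ _ α) (trans (cong (act (m ⁻¹)) (sym e)) (act⁻¹ m α))
                i , le , _ = locate t t∈
            in i , λ x p → le x (∈-cong K (solve 3 (λ m g x → (((g ⁻) :▷ m) :▷ ((g ⁻) :▷ x)) ⊜ ((m ⁻ · g) ⁻) :▷ x) refl m g x)
                 (proj₂ K⊲ (g ⁻¹ ▷ m) _ (inv (g ⁻¹) m m∈) p))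

          permuteAll : ∀ g i → Σ[ j ∈ Fin b ] (∀ x → x ∈' Kᵢ i → g ▷ x ∈' Kᵢ j)
          permuteAll g i = let j , le = every-conjugate (g ∙ s i) in j , λ x p → le _
              (∈-cong K (solve 3 (λ g s x → (s ⁻) :▷ x ⊜ ((g · s) ⁻) :▷ (g :▷ x)) refl g (s i) x) p)

          family : Family N α b
          family = record
            { K = Kᵢ ; K⊆N = λ i → proj₁ (K⊲ᵢ i)
            ; commute = λ {i} {j} i≢j → [ (λ le → ⊥-elim (i≢j (trans (sym (Q.cls-rep i)) (trans (Q.sound
                 (le , ⊆∧≥⇒⊇ {Kᵢ i} {Kᵢ j} le (≤-reflexive (trans (∣conjugate∣ (s j) K) (sym (∣conjugate∣ (s i) K)))))) (Q.cls-rep j))))) , id ]′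
                 (pair-dichotomy (s i) (s j) (σ∈ _) (σ∈ _))
            ; K∩C = λ i → K∩Cᴺ {Kᵢ i} (K⊲ᵢ i) ; K·C = λ i → factor {Kᵢ i} (K⊲ᵢ i)
            ; joint = λ x x∈ c → Z-trivial x x∈ λ g y y∈ →
                 let g₀ , T⊆K = contains-T {K} K⊲ K-nt
                     i , le = every-conjugate (g ∙ g₀ ⁻¹)
                 in proj₂ (c i) y (le y (T⊆K _ (∈-cong T (solve 3 (λ g g₀ y → (g ⁻) :▷ y ⊜ (g₀ ⁻) :▷ (((g · g₀ ⁻) ⁻) :▷ y)) refl g g₀ y) y∈)))
            ; permute = λ g _ i → permuteAll g i }

          i₀ : Fin b
          i₀ = Q.cls ε

          2≤b : ¬ N ⊆' K → 2 ≤ b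
          2≤b ¬le = go b refl
            where
            same : ∀ {c} → b ≡ c → c ≤ 1 → (i j : Fin b) → i ≡ j
            same refl le i j = Fin.toℕ-injective (trans (small i) (sym (small j)))
              where
              small : ∀ (i : Fin b) → toℕ i ≡ 0
              small i = n≤0⇒n≡0 (s≤s⁻¹ (≤-trans (Fin.toℕ<n i) le))
            go : ∀ c → b ≡ c → 2 ≤ c
            go (suc (suc _)) _ = s≤s (s≤s z≤n)
            go zero e = ⊥-elim (Fin.¬Fin0 (subst Fin e i₀))
            go (suc zero) e = ⊥-elim (¬le (generated K (proj₁ K⊲) λ g x x∈ →
              let g₀ , T⊆K = contains-T {K} K⊲ K-nt
                  i , le = every-conjugate (g ∙ g₀ ⁻¹)
                  j , _ , le' = locate ε (ε∈ St)
              in ∈-cong K (solve 1 (λ x → (:ε ⁻) :▷ x ⊜ x) refl x) (le' x (subst (λ u → x ∈' Kᵢ u) (same e (s≤s z≤n) i j)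
                   (le x (T⊆K _ (∈-cong T (solve 3 (λ g g₀ y → (g ⁻) :▷ y ⊜ (g₀ ⁻) :▷ (((g · g₀ ⁻) ⁻) :▷ y)) refl g g₀ x) x∈)))))))

          gridData : ¬ N ⊆' K → ¬ K ⊆' St → (∀ a c → a ∈' K → c ∈' Cᴺ K → a ∙ c ∈' St → a ∈' St) → GridData
          gridData K≢N K⊈St split = record
            { N = N ; b = b ; family = family ; 2≤b = 2≤b K≢N ; N-transitive = transN
            ; split = λ i a c a∈ c∈ ac∈ → ∈-cong St (▷-cancelʳ (s i) a) (inSt (s i) (σ∈ _) (split (s i ⁻¹ ▷ a) (s i ⁻¹ ▷ c) a∈
                (centralizer-▷ N (Kᵢ i) K (s i ⁻¹) (inv _) (λ y y∈ → ∈-cong K (solve 2 (λ s y → y ⊜ (s ⁻) :▷ ((s ⁻ ⁻) :▷ y)) refl (s i) y) y∈) c c∈)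
                (∈-cong St (▷-∙ _ a c) (inSt (s i ⁻¹) (⁻¹∈ St (σ∈ _)) ac∈))))
            ; moved = λ i le → K⊈St λ x x∈ → ∈-cong St (▷-cancelˡ (s i) x) (inSt (s i ⁻¹) (⁻¹∈ St (σ∈ _)) (le _ (▷∈conjugate (s i) K x∈)))
            ; conjugates = λ i j → s j ∙ s i ⁻¹ , ∙∈ St (σ∈ _) (⁻¹∈ St (σ∈ _)) ,
                (λ x p → ∈-cong K (solve 3 (λ s t x → (s ⁻) :▷ x ⊜ (t ⁻) :▷ ((t · s ⁻) :▷ x)) refl (s i) (s j) x) p) ,
                (λ x p → ∈-cong K (solve 3 (λ s t x → (t ⁻) :▷ x ⊜ (s ⁻) :▷ (((t · s ⁻) ⁻) :▷ x)) refl (s i) (s j) x) p)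
            ; permuteAll = permuteAll
            ; T = Tᵍ g₀ ; T-simple = Tᵍ-simple g₀ ; T-nonab = Tᵍ-nonab g₀
            ; i₀ = proj₁ (locate ε (ε∈ St))
            ; T⊆K = λ x x∈ → proj₁ (proj₂ (locate ε (ε∈ St))) x (∈-cong K (solve 1 (λ x → x ⊜ (:ε ⁻) :▷ x) refl x) (T⊆K x x∈)) }
            where
            g₀ : Fin n
            g₀ = proj₁ (contains-T {K} K⊲ K-nt)
            T⊆K : Tᵍ g₀ ⊆' K
            T⊆K = proj₂ (contains-T {K} K⊲ K-nt)
            inSt : ∀ g → g ∈' St → ∀ {x} → x ∈' St → g ▷ x ∈' St
            inSt g g∈ x∈ = ∙∈ St (∙∈ St g∈ x∈) (⁻¹∈ St g∈)

        Nα : Sub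
        Nα = N ⊓ St

        St-▷ : ∀ g {x} → g ∈' St → x ∈' St → g ▷ x ∈' St
        St-▷ g g∈ x∈ = ∙∈ St (∙∈ St g∈ x∈) (⁻¹∈ St g∈)

        ⊲∧⊆St⇒trivial : ∀ {K} → K ⊲ N → K ⊆' St → IsTrivial K
        ⊲∧⊆St⇒trivial {K} K⊲ le x x∈ = faithful x λ y → let m , m∈ , e = transN y in
          trans (cong (act x) (sym e)) (trans (cong (λ t → act t (act m α)) (sym (▷-cancelʳ m x)))
            (trans (act-▷ m _ α) (trans (cong (act m) (le _ (proj₂ K⊲ (m ⁻¹) x (⁻¹∈ N m∈) x∈))) e)))

        -- N_α C_N(T^g); its intersection over all g is the product of the projections of N_α.
        Proj : Fin n → Sub
        Proj g = product Nα (Cᴺ (Tᵍ g)) (λ h x (h∈ , _) → proj₂ (centralizer-⊲ {N} {Tᵍ g} (T⊲ g)) h x h∈)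

        L : Sub
        L = N ⊓ ⋂ Proj

        Nα⊆L : Nα ⊆' L
        Nα⊆L x x∈ = proj₁ x∈ , λ g → x , x∈ , ∈-cong (Cᴺ (Tᵍ g)) (sym (inverseˡ x)) (ε∈ (Cᴺ (Tᵍ g)))

        L-invariant : ∀ s x → s ∈' St → x ∈' L → s ▷ x ∈' L
        L-invariant s x s∈ (x∈ , p) = inv s x x∈ , λ g → let a , (a∈ , aS) , c = p (s ⁻¹ ∙ g) in
          s ▷ a , (inv s a a∈ , St-▷ s s∈ aS) ,
          ∈-cong (Cᴺ (Tᵍ g)) (solve 3 (λ s a x → s :▷ (a ⁻ · x) ⊜ (s :▷ a) ⁻ · (s :▷ x)) refl s a x) (Cᴺ-shift s g _ c)

        module ProductCase (L⊆St : L ⊆' St) where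
          -- It suffices that `a` lies in every `Proj g`. A conjugate of T inside T sees `a` as it
          -- sees `a ∙ c`, an element of N_α; a conjugate that commutes with T does not see `a` at
          -- all.
          split : ∀ a c → a ∈' T → c ∈' Cᴺ T → a ∙ c ∈' St → a ∈' St
          split a c a∈ (c∈ , cT) ac∈ = L⊆St a (aN , λ g → [ (λ le → a ∙ c , (∙∈ N aN c∈ , ac∈) ,
                ∈-cong (Cᴺ (Tᵍ g)) (solve 2 (λ a c → c ⁻ ⊜ (a · c) ⁻ · a) refl a c)
                  (⁻¹∈ (Cᴺ (Tᵍ g)) (c∈ , λ y y∈ → cT y (le y y∈))))
              , (λ cm → ε , ε∈ Nα , ∈-cong (Cᴺ (Tᵍ g)) (solve 1 (λ x → x ⊜ :ε ⁻ · x) refl a) (aN , λ y y∈ → sym (cm y a y∈ a∈))) ]′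
              (T-dichotomy {T} T⊲N g))
            where
            aN : a ∈' N
            aN = proj₁ T⊲N a a∈

          grid : GridData
          grid = Conjugates.gridData T T⊲N T-nt
            (λ s _ → [ (λ le → inj₁ (⊆∧≥⇒⊇ {conjugate s T} {T} le (≤-reflexive (sym (∣conjugate∣ s T))))) , (λ cm → inj₂ (λ x y x∈ y∈ → sym (cm y x y∈ x∈))) ]′ (T-dichotomy {T} T⊲N s))
            T≢N (λ le → T-nt (⊲∧⊆St⇒trivial {T} T⊲N le)) split

        -- `t` and `d` agree modulo the centraliser of the factor, so `t⁻¹ (y ▷ t)` lies both in the
        -- factor and in its centraliser.
        commutes-lift : ∀ g y t d → y ∈' N → t ∈' Tᵍ g → d ⁻¹ ∙ t ∈' Cᴺ (Tᵍ g) → Commutes y d → Commutes y t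
        commutes-lift g y t d y∈ t∈ c yd = ▷⇒comm (trans (solve 2 (λ t w → w ⊜ t · (t ⁻ · w)) refl t (y ▷ t)) (trans (cong (t ∙_) z≡ε) (identityʳ t)))
          where
          C' : Sub
          C' = Cᴺ (Tᵍ g)
          e : t ⁻¹ ∙ (y ▷ t) ≡ (d ⁻¹ ∙ t) ⁻¹ ∙ (y ▷ (d ⁻¹ ∙ t))
          e = trans (solve 3 (λ y t d → t ⁻ · (y :▷ t) ⊜ (d ⁻ · t) ⁻ · d ⁻ · (y :▷ d) · (y :▷ (d ⁻ · t))) refl y t d)
                (trans (cong (λ u → (d ⁻¹ ∙ t) ⁻¹ ∙ d ⁻¹ ∙ u ∙ (y ▷ (d ⁻¹ ∙ t))) (comm⇒▷ yd))
                  (solve 3 (λ w d z → w ⁻ · d ⁻ · d · z ⊜ w ⁻ · z) refl (d ⁻¹ ∙ t) d (y ▷ (d ⁻¹ ∙ t))))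
          z≡ε : t ⁻¹ ∙ (y ▷ t) ≡ ε
          z≡ε = K∩Cᴺ {Tᵍ g} (T⊲ g) (t ⁻¹ ∙ (y ▷ t)) (∙∈ (Tᵍ g) (⁻¹∈ (Tᵍ g) t∈) (proj₂ (T⊲ g) y t y∈ t∈))
                  (∈-cong C' (sym e) (∙∈ C' (⁻¹∈ C' c) (proj₂ (centralizer-⊲ {N} {Tᵍ g} (T⊲ g)) y _ y∈ c)))

        commutator-trivial : ∀ {y d} → y ∙ d ∙ y ⁻¹ ∙ d ⁻¹ ≡ ε → Commutes y d
        commutator-trivial {y} {d} e = trans (solve 2 (λ x y → x · y ⊜ (x · y · x ⁻ · y ⁻) · (y · x)) refl y d) (trans (cong (_∙ (d ∙ y)) e) (identityˡ _))

        -- N_α projects onto every factor. `K` is the product of a set of factors that N_α links by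
        -- one diagonal, found as a least normal subgroup of N with nontrivial stabiliser. `K = N`
        -- is the diagonal case; otherwise the conjugates of K are the directions of a grid.
        module SubdirectCase (onto : ∀ g x → x ∈' N → x ∈' Proj g)
          (K : Sub) (K⊲ : K ⊲ N) (KS-nt : ¬ IsTrivial (K ⊓ St)) (minK : ∀ M → M ⊲ N × ¬ IsTrivial (M ⊓ St) → ∥ K ∥ ≤ ∥ M ∥) where

          D : Sub
          D = K ⊓ St

          K-nt : ¬ IsTrivial K
          K-nt t = KS-nt λ x (x∈ , _) → t x x∈

          small : ∀ M → M ⊲ N → M ⊆' K → ¬ K ⊆' M → IsTrivial (M ⊓ St)
          small M M⊲ M⊆K ¬K⊆ = decidable-stable (trivial? (M ⊓ St)) λ nt → ¬K⊆ (⊆∧≥⇒⊇ {M} {K} M⊆K (minK M (M⊲ , nt)))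

          module _ (g : Fin n) (T⊆K : Tᵍ g ⊆' K) where
            C' : Sub
            C' = Cᴺ (Tᵍ g)

            C'⊲ : C' ⊲ N
            C'⊲ = centralizer-⊲ {N} {Tᵍ g} (T⊲ g)

            -- T^g is nonabelian and lies in K, so K ∩ C' is smaller than K and minimality applies.
            -- Consequently D injects into T^g.
            K∩C'∩St : IsTrivial ((K ⊓ C') ⊓ St)
            K∩C'∩St = small (K ⊓ C') (⊓-⊲ {K} {C'} {N} K⊲ C'⊲) (λ _ → proj₁) λ le →
              Tᵍ-nonab g λ x y x∈ y∈ → proj₂ (proj₂ (le x (T⊆K x x∈))) y y∈

            Im : Sub
            Im = Tᵍ g ⊓ product D C' (λ h x (h∈ , _) → proj₂ C'⊲ h x (proj₁ K⊲ h h∈))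

            -- By `onto`, every element of N acts on T^g like an element of N_α, and N_α normalises
            -- D. So the projection of D to T^g is normal in N, and it fills T^g by minimality of T.
            Im⊲ : Im ⊲ N
            Im⊲ = (λ x (p , _) → proj₁ (T⊲ g) x p) , λ h t h∈ (t∈ , d , (dK , dS) , c) →
              let a , (aN , aS) , (cN , c') = onto g h h∈
                  e : h ▷ t ≡ a ▷ t
                  e = trans (solve 3 (λ a h t → h :▷ t ⊜ a :▷ ((a ⁻ · h) :▷ t)) refl a h t) (cong (a ▷_) (comm⇒▷ (c' t t∈)))
              in proj₂ (T⊲ g) h t h∈ t∈ , a ▷ d , (proj₂ K⊲ a d aN dK , St-▷ a aS dS) ,
                 ∈-cong C' (trans (solve 3 (λ a d t → a :▷ (d ⁻ · t) ⊜ (a :▷ d) ⁻ · (a :▷ t)) refl a d t) (cong ((a ▷ d) ⁻¹ ∙_) (sym e))) (proj₂ C'⊲ a _ aN c)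

            Im-nt : ¬ IsTrivial Im
            Im-nt tr = KS-nt λ d (dK , dS) →
              let t , t∈ , c = N-factor-T g d (proj₁ K⊲ d dK)
                  t≡ε = tr t (t∈ , d , (dK , dS) , ∈-cong C' (solve 2 (λ t d → (t ⁻ · d) ⁻ ⊜ d ⁻ · t) refl t d) (⁻¹∈ C' c))
              in K∩C'∩St d ((dK , ∈-cong C' (trans (cong (λ u → u ⁻¹ ∙ d) t≡ε) (solve 1 (λ d → :ε ⁻ · d ⊜ d) refl d)) c) , dS)

            lift : ∀ t → t ∈' Tᵍ g → Σ[ d ∈ Fin n ] (d ∈' D × d ⁻¹ ∙ t ∈' C')
            lift t t∈ = proj₂ (Tᵍ-least g Im Im⊲ (λ _ → proj₁) Im-nt t t∈)

            liftN : ∀ x → x ∈' N → Σ[ d ∈ Fin n ] (d ∈' D × d ⁻¹ ∙ x ∈' C')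
            liftN x x∈ = let t , t∈ , c = N-factor-T g x x∈
                             d , d∈ , c' = lift t t∈
                         in d , d∈ , ∈-cong C' (solve 3 (λ d t x → (d ⁻ · t) · (t ⁻ · x) ⊜ d ⁻ · x) refl d t x) (∙∈ C' c' c)

            commutes-T : ∀ y → y ∈' N → (∀ d → d ∈' D → Commutes y d) → ∀ t → t ∈' Tᵍ g → Commutes y t
            commutes-T y y∈ cD t t∈ = let d , d∈ , c = lift t t∈ in commutes-lift g y t d y∈ t∈ c (cD d d∈)

          g₀ : Fin n
          g₀ = proj₁ (contains-T {K} K⊲ K-nt)

          T₀⊆K : Tᵍ g₀ ⊆' K
          T₀⊆K = proj₂ (contains-T {K} K⊲ K-nt)

          -- Choose `d ∈ D` with the same component as `a ∙ c` in one factor, and put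
          -- `y = d⁻¹ (a ∙ c)`. Commutators of `y` with D lie in K, fix α and centralise that
          -- factor, so they vanish. As D projects onto each factor inside K, `y` centralises K,
          -- whence `d⁻¹ a` lies in K and in its centraliser: `a = d`.
          split : ∀ a c → a ∈' K → c ∈' Cᴺ K → a ∙ c ∈' St → a ∈' St
          split a c a∈ c∈ ac∈ = go (liftN g₀ T₀⊆K (a ∙ c) xN)
            where
            xN : a ∙ c ∈' N
            xN = ∙∈ N (proj₁ K⊲ a a∈) (proj₁ c∈)
            C₀ : Sub
            C₀ = Cᴺ (Tᵍ g₀)
            go : Σ[ d ∈ Fin n ] (d ∈' D × d ⁻¹ ∙ (a ∙ c) ∈' C₀) → a ∈' St
            go (d , (dK , dS) , yC) = ∈-cong St (trans (sym (trans (cong (d ∙_) d⁻a≡ε) (identityʳ d))) (solve 2 (λ d a → d · (d ⁻ · a) ⊜ a) refl d a)) dS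
              where
              y : Fin n
              y = d ⁻¹ ∙ (a ∙ c)
              yN : y ∈' N
              yN = ∙∈ N (⁻¹∈ N (proj₁ K⊲ d dK)) xN
              yS : y ∈' St
              yS = ∙∈ St (⁻¹∈ St dS) ac∈
              y-D : ∀ d' → d' ∈' D → Commutes y d'
              y-D d' (d'K , d'S) = commutator-trivial (K∩C'∩St g₀ T₀⊆K (y ∙ d' ∙ y ⁻¹ ∙ d' ⁻¹)
                  ((∙∈ K (proj₂ K⊲ y d' yN d'K) (⁻¹∈ K d'K) ,
                    ∈-cong C₀ (solve 2 (λ y d → y · (d :▷ (y ⁻)) ⊜ y · d · y ⁻ · d ⁻) refl y d')
                      (∙∈ C₀ yC (proj₂ (centralizer-⊲ {N} {Tᵍ g₀} (T⊲ g₀)) d' _ (proj₁ K⊲ d' d'K) (⁻¹∈ C₀ yC)))) ,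
                   ∙∈ St (St-▷ y yS d'S) (⁻¹∈ St d'S)))
              F : Σ[ k ∈ Fin n ] (k ∈' K × k ⁻¹ ∙ y ∈' Cᴺ K)
              F = factor {K} K⊲ y yN
              k : Fin n
              k = proj₁ F
              k≡ε : k ≡ ε
              k≡ε = Z-trivial k (proj₁ K⊲ k (proj₁ (proj₂ F))) λ g t t∈ →
                  [ (λ le → subst (λ u → Commutes u t) (solve 2 (λ k y → y · (k ⁻ · y) ⁻ ⊜ k) refl k y)
                      (comm-∙ (commutes-T g le y yN y-D t t∈) (comm-⁻¹ (proj₂ (proj₂ (proj₂ F)) t (le t t∈)))))
                  , (λ cm → sym (cm t k t∈ (proj₁ (proj₂ F)))) ]′ (T-dichotomy {K} K⊲ g)
              yCK : y ∈' Cᴺ K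
              yCK = ∈-cong (Cᴺ K) (trans (cong (λ u → u ⁻¹ ∙ y) k≡ε) (solve 1 (λ d → :ε ⁻ · d ⊜ d) refl y)) (proj₂ (proj₂ F))
              d⁻a≡ε : d ⁻¹ ∙ a ≡ ε
              d⁻a≡ε = K∩Cᴺ {K} K⊲ (d ⁻¹ ∙ a) (∙∈ K (⁻¹∈ K dK) a∈)
                (∈-cong (Cᴺ K) (solve 3 (λ d a c → d ⁻ · (a · c) · c ⁻ ⊜ d ⁻ · a) refl d a c) (∙∈ (Cᴺ K) yCK (⁻¹∈ (Cᴺ K) c∈)))

          -- If K and its conjugate share a factor but differ, their intersection meets G_α
          -- trivially by minimality. Then the two stabilisers commute, yet both project onto the
          -- shared factor, which would be abelian.
          K-dichotomy : ∀ s → s ∈' St → K ⊆' conjugate s K ⊎ CommuteWith K (conjugate s K)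
          K-dichotomy s s∈ with trivial? (K ⊓ conjugate s K)
          ... | yes t = inj₂ (disjoint⇒commute {K} {conjugate s K} {N} K⊲ (conjugate-⊲ s {N} {K} inv K⊲) t)
          ... | no nt = inj₁ λ x x∈ → decidable-stable (x ∈?' conjugate s K) λ x∉ → contra (λ le → x∉ (proj₂ (le x x∈)))
            where
            Kˢ : Sub
            Kˢ = conjugate s K
            M⊲ : (K ⊓ Kˢ) ⊲ N
            M⊲ = ⊓-⊲ {K} {Kˢ} {N} K⊲ (conjugate-⊲ s {N} {K} inv K⊲)
            g : Fin n
            g = proj₁ (contains-T {K ⊓ Kˢ} M⊲ nt)
            T⊆K : Tᵍ g ⊆' K
            T⊆K x x∈ = proj₁ (proj₂ (contains-T {K ⊓ Kˢ} M⊲ nt) x x∈)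
            T⊆Kˢ : Tᵍ (s ⁻¹ ∙ g) ⊆' K
            T⊆Kˢ x x∈ = ∈-cong K (▷-cancelˡ s x) (proj₂ (proj₂ (contains-T {K ⊓ Kˢ} M⊲ nt) (s ▷ x)
              (∈-cong T (solve 3 (λ s g x → ((s ⁻ · g) ⁻) :▷ x ⊜ (g ⁻) :▷ (s :▷ x)) refl s g x) x∈)))
            liftˢ : ∀ t → t ∈' Tᵍ g → Σ[ d ∈ Fin n ] (d ∈' (Kˢ ⊓ St) × d ⁻¹ ∙ t ∈' Cᴺ (Tᵍ g))
            liftˢ t t∈ = let d , (dK , dS) , c = lift (s ⁻¹ ∙ g) T⊆Kˢ (s ⁻¹ ▷ t)
                               (∈-cong T (solve 3 (λ s g x → (g ⁻) :▷ x ⊜ ((s ⁻ · g) ⁻) :▷ ((s ⁻) :▷ x)) refl s g t) t∈)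
                         in s ▷ d , (▷∈conjugate s K dK , St-▷ s s∈ dS) ,
                            ∈-cong (Cᴺ (Tᵍ g)) (solve 3 (λ s d t → s :▷ (d ⁻ · ((s ⁻) :▷ t)) ⊜ (s :▷ d) ⁻ · t) refl s d t) (Cᴺ-shift s g _ c)
            contra : ¬ K ⊆' (K ⊓ Kˢ) → ⊥
            contra ¬le = Tᵍ-nonab g λ t₁ t₂ t₁∈ t₂∈ →
                let d , (dK , dS) , c = lift g T⊆K t₁ t₁∈
                    d' , (d'K , d'S) , c' = liftˢ t₂ t₂∈
                    dN = proj₁ K⊲ d dK
                    d'N = proj₁ (conjugate-⊲ s {N} {K} inv K⊲) d' d'K
                in subst (λ u → Commutes u t₂) (solve 2 (λ d t → d · (d ⁻ · t) ⊜ t) refl d t₁)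
                     (comm-∙ (commutes-lift g d t₂ d' dN t₂∈ c' (commutator-trivial (small (K ⊓ Kˢ) M⊲ (λ _ → proj₁) ¬le (d ∙ d' ∙ d ⁻¹ ∙ d' ⁻¹)
                        ((∈-cong K (solve 2 (λ y d → y · (d :▷ (y ⁻)) ⊜ y · d · y ⁻ · d ⁻) refl d d') (∙∈ K dK (proj₂ K⊲ d' _ d'N (⁻¹∈ K dK))) ,
                          ∙∈ Kˢ (proj₂ (conjugate-⊲ s {N} {K} inv K⊲) d d' dN d'K) (⁻¹∈ Kˢ d'K)) ,
                         ∙∈ St (St-▷ d dS d'S) (⁻¹∈ St d'S)))))
                       (proj₂ c t₂ t₂∈))

          module KC = Conjugates K K⊲ K-nt K-dichotomy

          grid : ¬ N ⊆' K → GridData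
          grid K≢N = KC.gridData K≢N (λ le → K-nt (⊲∧⊆St⇒trivial {K} K⊲ le)) split

          module TC = Conjugates T T⊲N T-nt
            (λ s _ → [ (λ le → inj₁ (⊆∧≥⇒⊇ {conjugate s T} {T} le (≤-reflexive (sym (∣conjugate∣ s T))))) , (λ cm → inj₂ (λ x y x∈ y∈ → sym (cm y x y∈ x∈))) ]′ (T-dichotomy {T} T⊲N s))

          diag : N ⊆' K → DiagData
          diag N⊆K = record
            { N = N ; m = TC.b ; family = TC.family ; 2≤m = TC.2≤b T≢N ; N-transitive = transN ; N-invariant = λ g x _ → inv g x
            ; D∩C = λ i x (xN , xS) xC → K∩C'∩St (TC.s i) (T⊆K i) x ((N⊆K x xN , xC) , xS)
            ; D·C = λ i x x∈ → let d , (dK , dS) , c = liftN (TC.s i) (T⊆K i) x x∈ in d , (proj₁ K⊲ d dK , dS) , c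
            ; i₁ = TC.i₀ ; K-simple = Tᵍ-simple (TC.s TC.i₀) ; K-nonab = Tᵍ-nonab (TC.s TC.i₀) }
            where
            T⊆K : ∀ i → Tᵍ (TC.s i) ⊆' K
            T⊆K i x x∈ = N⊆K x (proj₁ (T⊲ (TC.s i)) x x∈)

        grid-or-diag : (GridData → ⊥) → (DiagData → ⊥) → ⊥
        grid-or-diag ¬grid ¬diag = [ (λ le → ¬grid (ProductCase.grid λ x x∈ → le x x∈)) , subdirect ]′ (prim L L-invariant)
          where
          subdirect : TransitiveOn L α → ⊥
          subdirect tr = minimal-sub (λ K → K ⊲ N × ¬ IsTrivial (K ⊓ St)) N (((λ _ p → p) , λ g x _ → inv g x) , Nα-nt) λ K (K⊲ , nt) min →
              cases K K⊲ nt min (⊆?' N K)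
            where
            -- Transitivity of L gives N = L N_α, and both lie in `Proj g`.
            onto : ∀ g x → x ∈' N → x ∈' Proj g
            onto g x x∈ = let l , l∈ , e = tr (act x α) in ∈-cong (Proj g) (solve 2 (λ d a → d · (d ⁻ · a) ⊜ a) refl l x)
              (∙∈ (Proj g) (proj₂ l∈ g) (proj₂ (Nα⊆L (l ⁻¹ ∙ x) (∙∈ N (⁻¹∈ N (proj₁ l∈)) x∈ ,
                 trans (act-∙ _ _ α) (trans (cong (act (l ⁻¹)) (sym e)) (act⁻¹ l α)))) g))
            Nα-nt : ¬ IsTrivial (N ⊓ St)
            Nα-nt t = Tᵍ-nonab ε λ x y x∈ y∈ → let a , a∈ , _ , c = onto ε x (proj₁ (T⊲ ε) x x∈) in
              subst (λ u → Commutes u y) (trans (cong (λ u → u ⁻¹ ∙ x) (t a a∈)) (solve 1 (λ d → :ε ⁻ · d ⊜ d) refl x)) (c y y∈)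
            cases : ∀ K → (K⊲ : K ⊲ N) → (nt : ¬ IsTrivial (K ⊓ St)) → (∀ M → M ⊲ N × ¬ IsTrivial (M ⊓ St) → ∥ K ∥ ≤ ∥ M ∥) → Dec (N ⊆' K) → ⊥
            cases K K⊲ nt min (yes p) = ¬diag (SubdirectCase.diag onto K K⊲ nt min p)
            cases K K⊲ nt min (no ¬p) = ¬grid (SubdirectCase.grid onto K K⊲ nt min ¬p)

      -- Counting flags

      module Counting {k l : ℕ} (Δ : FlagDesign v k l G A) where
        open FlagDesign Δ

        blocksThrough : Fin v → DSet v
        blocksThrough x = mk (I? x)

        opaque
          flags-through : ∀ x → # (blocksThrough x) * (k ∸ 1) ≡ (v ∸ 1) * l
          flags-through x = trans (double-count (blocksThrough x) others (λ B y → (I? x B ×-dec I? y B) ×-dec ¬? (y Fin.≟ x)) (k ∸ 1) l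
              (λ B y ((xB , yB) , ne) → xB , refl , ne)
              (λ B xB → trans (#-cong _ (mk (λ y → I? y B ×-dec ¬? (y Fin.≟ x))) (λ y ((_ , yB) , ne) → yB , ne) (λ y (yB , ne) → (xB , yB) , ne))
                 (cong (_∸ 1) (trans (sym (#-remove (mk (λ y → I? y B)) x xB)) (block-size B))))
              (λ y (_ , ne) → trans (#-cong _ (mk (λ B → I? x B ×-dec I? y B)) (λ B (p , _) → p) (λ B p → p , ne)) (pair-blocks (ne ∘ sym))))
            (cong (_* l) (cong (_∸ 1) (trans (sym (#-remove full x refl)) (#-full v))))
            where
            others : DSet v
            others = mk (λ y → mem? full y ×-dec ¬? (y Fin.≟ x))

          -- By `flags-through` the number r of blocks on a point is constant; counting flags gives
          -- v r = v k, as there are v blocks.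
          replication : ∀ x → # (blocksThrough x) ≡ k
          replication x = *-cancelˡ-≡ r k v {{>-nonZero (≤-<-trans z≤n k<v)}} (trans (cong (_* r) (sym (#-full v)))
            (trans (double-count full full (λ y B → I? y B) r k (λ _ _ _ → refl , refl) (λ y _ → same y) (λ B _ → block-size B))
            (cong (_* k) (#-full v))))
            where
            r : ℕ
            r = # (blocksThrough x)
            same : ∀ y → # (blocksThrough y) ≡ r
            same y = *-cancelʳ-≡ _ _ (k ∸ 1) {{>-nonZero (m<n⇒0<n∸m 2≤k)}} (trans (flags-through y) (sym (flags-through x)))

          parameters : Fin v → k * (k ∸ 1) ≡ (v ∸ 1) * l
          parameters x = trans (cong (_* (k ∸ 1)) (sym (replication x))) (flags-through x)

          block-through : ∀ x → Σ[ B ∈ Fin v ] I x B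
          block-through x with Fin.any? (I? x)
          ... | yes p = p
          ... | no ¬p = ⊥-elim (<⇒≢ (≤-trans (s≤s z≤n) 2≤k) (trans (sym (#-empty (blocksThrough x) (λ B p → ¬p (B , p)))) (replication x)))

        G-transitive : ∀ x y → Σ[ g ∈ Fin n ] act g x ≡ y
        G-transitive x y = let B , p = block-through x ; C , q = block-through y ; g , e , _ = flag p q in g , e

        -- For a G_α-invariant weight f, the weight of B ∖ α is the same for all blocks B through α.
        module Weighted (α : Fin v) (f : Fin v → ℕ) (f-inv : ∀ g x → act g α ≡ α → f (act g x) ≡ f x) where
          S : Fin v → ℕ
          S B = sum (λ x → ind (I? x B ×-dec ¬? (x Fin.≟ α)) * f x)

          total : ℕ
          total = sum (λ x → ind (¬? (x Fin.≟ α)) * f x)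

          opaque
            S-const : ∀ {B C} → I α B → I α C → S B ≡ S C
            S-const {B} {C} αB αC with flag αB αC
            ... | g , gα , to , fro = sym (trans (sum-bij _ (act g) (act (g ⁻¹)) (act-act⁻¹ g) (act⁻¹ g)) (sum-cong-≗ λ x →
                    cong₂ _*_ (ind-cong (I? (act g x) C ×-dec ¬? (act g x Fin.≟ α)) (I? x B ×-dec ¬? (x Fin.≟ α))
                      (λ (p , ne) → fro x p , λ { refl → ne gα }) (λ (p , ne) → to x p , λ e → ne (act-injective g (trans e (sym gα))))) (f-inv g x gα)))

            -- Sum over the k blocks through α, all of the same weight: each point other than α lies
            -- on λ of them.
            weighted : ∀ {B} → I α B → k * S B ≡ l * total
            weighted {B} αB = begin
              k * S B                                        ≡⟨ cong (_* S B) (replication α) ⟨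
              # (blocksThrough α) * S B                      ≡⟨ *-distribʳ-sum (S B) _ ⟩
              sum (λ C → ind (I? α C) * S B)                 ≡⟨ sum-cong-≗ (λ C → same C) ⟩
              sum (λ C → sum (λ x → ind (I? α C) * (ind (I? x C ×-dec ¬? (x Fin.≟ α)) * f x))) ≡⟨ ∑-comm _ ⟩
              sum (λ x → sum (λ C → ind (I? α C) * (ind (I? x C ×-dec ¬? (x Fin.≟ α)) * f x))) ≡⟨ sum-cong-≗ col ⟩
              sum (λ x → l * (ind (¬? (x Fin.≟ α)) * f x))   ≡⟨ *-distribˡ-sum l _ ⟨
              l * total                                      ∎
              where
              open ≡-Reasoning
              same : ∀ C → ind (I? α C) * S B ≡ sum (λ x → ind (I? α C) * (ind (I? x C ×-dec ¬? (x Fin.≟ α)) * f x))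
              same C with I? α C
              ... | yes p = trans (cong (ind (yes p) *_) (S-const αB p)) (*-distribˡ-sum (ind (yes p)) _)
              ... | no ¬p = trans (cong (_* S B) (ind-no (no ¬p) ¬p)) (sym (sum-0 _ (λ x → cong (_* (ind (I? x C ×-dec ¬? (x Fin.≟ α)) * f x)) (ind-no (no ¬p) ¬p))))
              lem : ∀ a i j f → a * (i * j * f) ≡ (a * i) * (j * f)
              lem = solve-∀
              col : ∀ x → sum (λ C → ind (I? α C) * (ind (I? x C ×-dec ¬? (x Fin.≟ α)) * f x)) ≡ l * (ind (¬? (x Fin.≟ α)) * f x)
              col x = trans (sum-cong-≗ (λ C → trans (cong (λ t → ind (I? α C) * (t * f x)) (ind-× (I? x C) (¬? (x Fin.≟ α)))) (trans (lem (ind (I? α C)) (ind (I? x C)) (ind (¬? (x Fin.≟ α))) (f x))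
                        (cong (_* (ind (¬? (x Fin.≟ α)) * f x)) (sym (ind-× (I? α C) (I? x C)))))))
                     (trans (sym (*-distribʳ-sum (ind (¬? (x Fin.≟ α)) * f x) (λ C → ind (I? α C ×-dec I? x C)))) (fin (x Fin.≟ α)))
                where
                fin : Dec (x ≡ α) → # (mk (λ C → I? α C ×-dec I? x C)) * (ind (¬? (x Fin.≟ α)) * f x) ≡ l * (ind (¬? (x Fin.≟ α)) * f x)
                fin (no ne) = cong (_* (ind (¬? (x Fin.≟ α)) * f x)) (pair-blocks (ne ∘ sym))
                fin (yes e) = trans (cong (λ t → # (mk (λ C → I? α C ×-dec I? x C)) * (t * f x)) z) (trans (*-zeroʳ (# (mk (λ C → I? α C ×-dec I? x C))))
                    (sym (trans (cong (λ t → l * (t * f x)) z) (*-zeroʳ l))))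
                  where
                  z : ind (¬? (x Fin.≟ α)) ≡ 0
                  z = ind-no (¬? (x Fin.≟ α)) (λ ne → ne e)

        opaque
          invariant-set : ∀ α (Γ : DSet v) → ¬ α ∊ Γ → (∀ g x → act g α ≡ α → x ∊ Γ → act g x ∊ Γ) →
                          ∀ {B} → I α B → k * # (mk (λ x → I? x B ×-dec mem? Γ x)) ≡ l * # Γ
          invariant-set α Γ α∉ inv {B} αB = trans (cong (k *_) (sym (sum-cong-≗ inB))) (trans (weighted αB) (cong (l *_) (sum-cong-≗ out)))
            where
            open Weighted α (λ x → ind (mem? Γ x)) (λ g x gα → ind-cong (mem? Γ (act g x)) (mem? Γ x)
              (λ p → subst (_∊ Γ) (act⁻¹ g x) (inv (g ⁻¹) _ (trans (cong (act (g ⁻¹)) (sym gα)) (act⁻¹ g α)) p)) (inv g x gα))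
            inB : ∀ x → ind (I? x B ×-dec ¬? (x Fin.≟ α)) * ind (mem? Γ x) ≡ ind (I? x B ×-dec mem? Γ x)
            inB x = trans (sym (ind-× (I? x B ×-dec ¬? (x Fin.≟ α)) (mem? Γ x))) (ind-cong ((I? x B ×-dec ¬? (x Fin.≟ α)) ×-dec mem? Γ x) (I? x B ×-dec mem? Γ x)
              (λ ((p , _) , q) → p , q) (λ (p , q) → (p , λ { refl → α∉ q }) , q))
            out : ∀ x → ind (¬? (x Fin.≟ α)) * ind (mem? Γ x) ≡ ind (mem? Γ x)
            out x = trans (sym (ind-× (¬? (x Fin.≟ α)) (mem? Γ x))) (ind-cong (¬? (x Fin.≟ α) ×-dec mem? Γ x) (mem? Γ x) proj₂ (λ q → (λ { refl → α∉ q }) , q))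

        record Reduced : Set where
          field
            k₀ l₀ gcd₀ : ℕ
            k≡ : k ≡ k₀ * gcd₀
            l≡ : l ≡ l₀ * gcd₀
            cop : Coprime k₀ l₀
            0<gcd₀ : 0 < gcd₀

        reduced : Reduced
        reduced = record { k₀ = k / d ; l₀ = l / d ; gcd₀ = d ; k≡ = sym (m/n*n≡m (gcd[m,n]∣m k l)) ; l≡ = sym (m/n*n≡m (gcd[m,n]∣n k l))
                         ; cop = coprime-/gcd k l ; 0<gcd₀ = n≢0⇒n>0 (≢-nonZero⁻¹ d) }
          where
          d : ℕ
          d = gcd k l
          instance
            d≢0 : NonZero d
            d≢0 = ≢-nonZero (gcd[m,n]≢0 k l (inj₁ (λ e → case (subst (2 ≤_) e 2≤k))))
              where
              case : ¬ (2 ≤ 0)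
              case ()

        open Reduced reduced

        opaque
          k∣lx⇒k₀∣x : ∀ x → k ∣ l * x → k₀ ∣ x
          k∣lx⇒k₀∣x x div = coprime-divisor cop (*-cancelʳ-∣ gcd₀ {{>-nonZero 0<gcd₀}} (subst₂ _∣_ k≡ (trans (cong (_* x) l≡) (lem l₀ gcd₀ x)) div))
            where
            lem : ∀ a g x → a * g * x ≡ a * x * g
            lem = solve-∀

          -- The parameter equation makes k divide λ (v - 1), so k₀ divides v - 1.
          k₀-coprime : Fin v → ∀ {d} → d ∣ k₀ → d ∣ v → d ≡ 1
          k₀-coprime x {d} d∣k₀ d∣v = ∣1⇒≡1 (∣m+n∣m⇒∣n (subst (d ∣_) (sym (m∸n+n≡m (≤-trans (s≤s z≤n) k<v))) d∣v)
            (∣-trans d∣k₀ (k∣lx⇒k₀∣x (v ∸ 1) (subst (k ∣_) (trans (parameters x) (*-comm (v ∸ 1) l)) (m∣m*n (k ∸ 1))))))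

          l<k : Fin v → l < k
          l<k x = *-cancelʳ-< k l k (≤-<-trans lk≤ (*-monoʳ-< k {{>-nonZero (≤-trans (s≤s z≤n) 2≤k)}} (∸-monoʳ-< {k} {1} {0} (s≤s z≤n) (≤-trans (s≤s z≤n) 2≤k))))
            where
            lk≤ : l * k ≤ k * (k ∸ 1)
            lk≤ = ≤-trans (≤-reflexive (*-comm l k)) (≤-trans (*-monoˡ-≤ l (∸-monoˡ-≤ {suc k} {v} 1 k<v)) (≤-reflexive (sym (parameters x))))

          v-bound : Fin v → v < suc k₀ * (suc k₀ * suc k₀)
          v-bound x = subst (_< suc k₀ * (suc k₀ * suc k₀)) (m+[n∸m]≡n (≤-trans (s≤s z≤n) k<v)) (cubic-bound k₀ l₀ gcd₀ (v ∸ 1) 0<gcd₀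
              (∣-pos {l₀} (divides gcd₀ (trans l≡ (*-comm l₀ gcd₀))) 1≤l)
              (*-cancelʳ-< gcd₀ l₀ k₀ (subst₂ _<_ l≡ k≡ (l<k x)))
              (subst₂ (λ k l → l * l < k + 2 * l) k≡ l≡ large)
              (subst₂ (λ k l → k * (k ∸ 1) ≡ (v ∸ 1) * l) k≡ l≡ (parameters x)))

        -- N_α is a simple group D which maps isomorphically onto every K i.  For X ≤ D the
        -- product X̂ of the images of X has |X|^(m-1) points in its orbit of α.
        module Diagonal (dd : DiagData) where
          open DiagData dd
          open DiagonalFactor dd using (D-simple; D-nonab)

          e : ℕ
          e = m ∸ 1

          m≡ : m ≡ suc e
          m≡ = sym (m+[n∸m]≡n {1} {m} (≤-trans (s≤s z≤n) 2≤m))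

          C⊲ : ∀ i → C i ⊲ N
          C⊲ i = centralizer-⊲ {N} {K i} (K⊆N i , K-normal i)

          D⊲St : D ⊲ St
          D⊲St = (λ _ → proj₂) , λ g x g∈ (xN , xS) → N-invariant g x g∈ xN , ∙∈ St (∙∈ St g∈ xS) (⁻¹∈ St g∈)

          -- `P i = X C_i` restricts the i-th component to the image of X, and `hat` imposes this
          -- for all i.
          module Hat (X : Sub) (X⊆D : X ⊆' D) where
            P : Fin m → Sub
            P i = product X (C i) (λ h x h∈ → proj₂ (C⊲ i) h x (proj₁ (X⊆D h h∈)))

            C⊆P : ∀ i → C i ⊆' P i
            C⊆P i x x∈ = ε , ε∈ X , ∈-cong (C i) (solve 1 (λ x → x ⊜ :ε ⁻ · x) refl x) x∈

            X⊆P : ∀ i → X ⊆' P i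
            X⊆P i x x∈ = x , x∈ , ∈-cong (C i) (sym (inverseˡ x)) (ε∈ (C i))

            hat : Sub
            hat = N ⊓ record { set = mk (λ x → Fin.all? (λ i → x ∈?' P i)) ; ε∈ = λ i → ε∈ (P i)
                             ; ∙∈ = λ p q i → ∙∈ (P i) (p i) (q i) ; ⁻¹∈ = λ p i → ⁻¹∈ (P i) (p i) }

            Xᵢ : Fin m → Sub
            Xᵢ i = K i ⊓ P i

            factorP : ∀ i w → w ∈' N → w ∈' P i → Σ[ t ∈ Fin n ] (t ∈' Xᵢ i × t ⁻¹ ∙ w ∈' C i)
            factorP i w wN w∈ = let t , t∈ , c = K·C i w wN in t , (t∈ , ∈-cong (P i) (solve 2 (λ t w → w · (t ⁻ · w) ⁻ ⊜ t) refl t w)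
              (∙∈ (P i) w∈ (⁻¹∈ (P i) (C⊆P i _ c)))) , c

            P⊆N : ∀ i → P i ⊆' N
            P⊆N i x (h , h∈ , c) = ∈-cong N (solve 2 (λ h x → h · (h ⁻ · x) ⊜ x) refl h x) (∙∈ N (proj₁ (X⊆D h h∈)) (proj₁ c))

            opaque
              -- Both groups are complements of `C i` in `P i`.
              ∣Xᵢ∣ : ∀ i → ∥ Xᵢ i ∥ ≡ ∥ X ∥
              ∣Xᵢ∣ i = *-cancelʳ-≡ _ _ ∥ C i ∥ {{>-nonZero (∣Sub∣-pos (C i))}} (trans
                (sym (∣factor∣ (P i) (Xᵢ i) (C i) (λ _ → proj₂) (C⊆P i) (λ x (p , _) q → K∩C i x p q) (λ w w∈ → factorP i w (P⊆N i w w∈) w∈)))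
                (∣factor∣ (P i) X (C i) (X⊆P i) (C⊆P i) (λ x p q → D∩C i x (X⊆D x p) q) (λ w w∈ → w∈)))

              ∣hat∣ : ∥ hat ∥ ≡ ∥ X ∥ ^ m
              ∣hat∣ = Count.order hat (λ _ → proj₁) Xᵢ (λ i _ → proj₁)
                (λ i x (xK , xP) → K⊆N i x xK , λ j → [ (λ { refl → xP }) , (λ ne → C⊆P j x (K⊆C ne x xK)) ]′ (dec i j))
                (λ i w (wN , wP) → factorP i w wN (wP i)) ∥ X ∥ ∣Xᵢ∣
                where
                dec : ∀ (i j : Fin m) → i ≡ j ⊎ i ≢ j
                dec i j with i Fin.≟ j
                ... | yes p = inj₁ p
                ... | no p = inj₂ p

              ∣hat∩St∣ : ∥ hat ⊓ St ∥ ≡ ∥ X ∥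
              ∣hat∩St∣ = #-cong (set (hat ⊓ St)) (set X)
                (λ x ((xN , xP) , xS) → let h , h∈ , c = xP i₁ in
                   ∈-cong X (trans (sym (trans (cong (h ∙_) (D∩C i₁ (h ⁻¹ ∙ x) (∙∈ D (⁻¹∈ D (X⊆D h h∈)) (xN , xS)) c)) (identityʳ h)))
                     (solve 2 (λ d a → d · (d ⁻ · a) ⊜ a) refl h x)) h∈)
                (λ x x∈ → (proj₁ (X⊆D x x∈) , λ i → X⊆P i x x∈) , proj₂ (X⊆D x x∈))

            Δ' : DSet v
            Δ' = orbit hat α

            opaque
              ∣Δ'∣ : # Δ' ≡ ∥ X ∥ ^ e
              ∣Δ'∣ = *-cancelʳ-≡ _ _ ∥ X ∥ {{>-nonZero (∣Sub∣-pos X)}} (trans (cong (# Δ' *_) (sym ∣hat∩St∣))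
                (trans (sym (orbit-stabilizer hat α)) (trans ∣hat∣ (trans (cong (∥ X ∥ ^_) m≡) (*-comm ∥ X ∥ (∥ X ∥ ^ e))))))

              Δ'-stable : ∀ h → h ∈' St → (∀ x → x ∈' X → h ▷ x ∈' X) → ∀ y → y ∊ Δ' → act h y ∊ Δ'
              Δ'-stable h h∈ st y (x , (xN , xP) , refl) = h ▷ x , (N-invariant h x h∈ xN , inP) ,
                  trans (cong (act (h ▷ x)) (sym h∈)) (act-▷ h x α)
                where
                inP : ∀ j → h ▷ x ∈' P j
                inP j = let i , hK = permute (h ⁻¹) (⁻¹∈ St h∈) j
                            x₀ , x₀∈ , c = xP i
                        in h ▷ x₀ , st x₀ x₀∈ , ∈-cong (C j) (solve 3 (λ s a x → s :▷ (a ⁻ · x) ⊜ (s :▷ a) ⁻ · (s :▷ x)) refl h x₀ x)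
                             (centralizer-▷ N (K i) (K j) h (λ y → N-invariant h y h∈) hK _ c)

          opaque
            v≡ : v ≡ ∥ D ∥ ^ e
            v≡ = trans (sym (#-full v)) (trans (#-cong full (Hat.Δ' D (λ _ p → p))
              (λ y _ → let h , h∈ , eq = N-transitive y in h , (h∈ , λ i → D·C i h h∈) , eq) (λ _ _ → refl)) (Hat.∣Δ'∣ D (λ _ p → p)))

          1≤e : 1 ≤ e
          1≤e = ∸-monoˡ-≤ {2} {m} 1 2≤m

          k₀-coprime-D : Coprime k₀ ∥ D ∥
          k₀-coprime-D {d} (d∣k₀ , d∣D) = k₀-coprime α d∣k₀ (subst (d ∣_) (sym v≡) (∣-trans d∣D (D∣ e 1≤e)))
            where
            D∣ : ∀ e → 1 ≤ e → ∥ D ∥ ∣ ∥ D ∥ ^ e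
            D∣ (suc e) _ = m∣m*n (∥ D ∥ ^ e)

          -- Weight each point by the number of `d ∈ D` with the point in `d Δ'`. Since X is
          -- canonical, G_α permutes these translates, so the weight is invariant; counting overlaps
          -- with multiplicity makes the total off α exactly |D| (|X| ^ e - 1). Flag counting makes
          -- k₀ divide it, and k₀ is prime to |D|.
          congruent : ∀ X → X ⊆' D → (∀ g → g ∈' St → Σ[ d ∈ Fin n ] (d ∈' D × ∀ x → x ∈' X → (d ⁻¹ ∙ g) ▷ x ∈' X)) →
                      k₀ ∣ ∥ X ∥ ^ e ∸ 1
          congruent X X⊆D canon = coprime-divisor k₀-coprime-D (k∣lx⇒k₀∣x _ (subst (k ∣_) (cong (l *_) total≡) (divides (S B) (trans (sym (weighted αB)) (*-comm k _)))))
            where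
            open Hat X X⊆D
            f? : ∀ β d → Dec (d ∈' D × act (d ⁻¹) β ∊ Δ')
            f? β d = (d ∈?' D) ×-dec mem? Δ' (act (d ⁻¹) β)
            f : Fin v → ℕ
            f β = # (mk (f? β))
            f-inv : ∀ g β → act g α ≡ α → f (act g β) ≡ f β
            f-inv g β gα = #-bij _ _ (λ d → g ⁻¹ ∙ d ∙ g ∙ d₀) (λ d → g ∙ d ∙ d₀ ⁻¹ ∙ g ⁻¹)
                (solve 3 (λ g d₀ d → g ⁻ · (g · d · d₀ ⁻ · g ⁻) · g · d₀ ⊜ d) refl g d₀) (solve 3 (λ g d₀ d → g · (g ⁻ · d · g · d₀) · d₀ ⁻ · g ⁻ ⊜ d) refl g d₀)
                (λ d (d∈ , p) → ∙∈ D (∈-cong D (solve 2 (λ g d → (g ⁻) :▷ d ⊜ g ⁻ · d · g) refl g d) (proj₂ D⊲St (g ⁻¹) d g⁻∈ d∈)) d₀∈ ,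
                   subst (_∊ Δ') (trans (cong (act h) (sym (act-∙ _ _ β))) (trans (sym (act-∙ _ _ β))
                     (cong (λ t → act t β) (solve 3 (λ g d₀ d → d₀ ⁻ · g ⁻ · (d ⁻ · g) ⊜ (g ⁻ · d · g · d₀) ⁻) refl g d₀ d)))) (Δ'-stable h h∈ st _ p))
                (λ d (d∈ , p) → ∈-cong D (solve 3 (λ g d₀ d → g :▷ (d · d₀ ⁻) ⊜ g · d · d₀ ⁻ · g ⁻) refl g d₀ d) (proj₂ D⊲St g _ gα (∙∈ D d∈ (⁻¹∈ D d₀∈))) ,
                   subst (_∊ Δ') (trans (sym (act-∙ _ _ β)) (trans (cong (λ t → act t β) (solve 3 (λ g d₀ d → (d₀ ⁻ · g ⁻) ⁻ · d ⁻ ⊜ (g · d · d₀ ⁻ · g ⁻) ⁻ · g) refl g d₀ d)) (act-∙ _ _ β)))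
                     (Δ'-stable (h ⁻¹) (⁻¹∈ St h∈) (▷-stable⁻¹ h X st) _ p))
              where
              g⁻∈ : g ⁻¹ ∈' St
              g⁻∈ = ⁻¹∈ St gα
              d₀ : Fin n
              d₀ = proj₁ (canon (g ⁻¹) g⁻∈)
              d₀∈ : d₀ ∈' D
              d₀∈ = proj₁ (proj₂ (canon (g ⁻¹) g⁻∈))
              h : Fin n
              h = d₀ ⁻¹ ∙ g ⁻¹
              h∈ : h ∈' St
              h∈ = ∙∈ St (⁻¹∈ St (proj₂ d₀∈)) g⁻∈
              st : ∀ x → x ∈' X → h ▷ x ∈' X
              st = proj₂ (proj₂ (canon (g ⁻¹) g⁻∈))
            open Weighted α f f-inv
            B : Fin v
            B = proj₁ (block-through α)
            αB : I α B
            αB = proj₂ (block-through α)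
            row : ∀ d → sum (λ β → ind (¬? (β Fin.≟ α)) * ind (f? β d)) ≡ ind (d ∈?' D) * (∥ X ∥ ^ e ∸ 1)
            row d = trans (sum-cong-≗ (λ β → sym (ind-× (¬? (β Fin.≟ α)) (f? β d)))) (fin (d ∈?' D))
              where
              Δ° : DSet v
              Δ° = mk (λ β → mem? Δ' β ×-dec ¬? (β Fin.≟ α))
              fin : (dec : Dec (d ∈' D)) → # (mk (λ β → ¬? (β Fin.≟ α) ×-dec f? β d)) ≡ ind dec * (∥ X ∥ ^ e ∸ 1)
              fin (no ¬p) = trans (#-empty _ (λ β (_ , p , _) → ¬p p)) (sym (cong (_* (∥ X ∥ ^ e ∸ 1)) (ind-no (no ¬p) ¬p)))
              fin (yes p) = trans (#-bij _ Δ° (act (d ⁻¹)) (act d) (act⁻¹ d) (act-act⁻¹ d)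
                   (λ β (ne , _ , q) → q , λ e → ne (trans (sym (act-act⁻¹ d β)) (trans (cong (act d) e) (proj₂ p))))
                   (λ β (q , ne) → (λ e → ne (act-injective d (trans e (sym (proj₂ p))))) , p , subst (_∊ Δ') (sym (act⁻¹ d β)) q))
                 (trans (cong (_∸ 1) (trans (sym (#-remove Δ' α (x∊orbit hat α))) ∣Δ'∣)) (sym (trans (cong (_* (∥ X ∥ ^ e ∸ 1)) (ind-yes (yes p) p)) (*-identityˡ _))))
            total≡ : total ≡ ∥ D ∥ * (∥ X ∥ ^ e ∸ 1)
            total≡ = trans (sum-cong-≗ (λ β → *-distribˡ-sum (ind (¬? (β Fin.≟ α))) (λ d → ind (f? β d)))) (trans (∑-comm _) (trans (sum-cong-≗ row) (sym (*-distribʳ-sum _ _))))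

          impossible : ⊥
          impossible = NoSuchSimple.impossible St D D⊲St D-simple D-nonab k₀ e 1≤e (subst (_< suc k₀ * (suc k₀ * suc k₀)) v≡ (v-bound α)) congruent

        -- The grid case

        module Grid (gd : GridData) where
          open GridData gd
          line : Fin b → Fin v → DSet v
          line i = orbit (K i)

          shift-line : ∀ g {i j} → (∀ a → a ∈' K i → g ▷ a ∈' K j) → ∀ {x y} → y ∊ line i x → act g y ∊ line j (act g x)
          shift-line g hK {x} (a , a∈ , refl) = g ▷ a , hK a a∈ , act-▷ g a x

          shift-N : ∀ {m} → m ∈' N → ∀ i a → a ∈' K i → m ▷ a ∈' K i
          shift-N m∈ i a = K-normal i _ a m∈

          ∣line∣-shift : ∀ g {i j} → (∀ a → a ∈' K i → g ▷ a ∈' K j) → (∀ a → a ∈' K j → g ⁻¹ ▷ a ∈' K i) → ∀ x → # (line i x) ≡ # (line j (act g x))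
          ∣line∣-shift g {i} {j} to fro x = #-bij (line i x) (line j (act g x)) (act g) (act (g ⁻¹)) (act-act⁻¹ g) (act⁻¹ g) (λ y → shift-line g to)
            (λ y p → subst (λ z → act (g ⁻¹) y ∊ line i z) (act⁻¹ g x) (shift-line (g ⁻¹) fro p))

          w : ℕ
          w = # (line i₀ α)

          opaque
            line-size : ∀ i x → # (line i x) ≡ w
            line-size i x = let m , m∈ , e = N-transitive x ; g , g∈ , to , fro = conjugates i₀ i in
              trans (cong (λ z → # (line i z)) (sym e)) (trans (sym (∣line∣-shift m (shift-N m∈ i) (shift-N (⁻¹∈ N m∈) i) α))
                (sym (trans (∣line∣-shift g to fro α) (cong (λ z → # (line i z)) g∈))))

            ∣K∣ : ∀ i → ∥ K i ∥ ≡ ∥ K i₀ ∥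
            ∣K∣ i = let g , g∈ , to , fro = conjugates i i₀ in #-bij _ _ (g ▷_) (g ⁻¹ ▷_) (▷-cancelʳ g) (▷-cancelˡ g) to fro

            ∣K∩St∣ : ∀ i → ∥ K i ⊓ St ∥ ≡ ∥ K i₀ ⊓ St ∥
            ∣K∩St∣ i = let g , g∈ , to , fro = conjugates i i₀ in #-bij _ _ (g ▷_) (g ⁻¹ ▷_) (▷-cancelʳ g) (▷-cancelˡ g)
              (λ x (p , q) → to x p , ∙∈ St (∙∈ St g∈ q) (⁻¹∈ St g∈))
              (λ x (p , q) → fro x p , ∙∈ St (∙∈ St (⁻¹∈ St g∈) q) (⁻¹∈ St (⁻¹∈ St g∈)))

            -- Both |N| and |N_α| are b-th powers, of the orders of K and of its stabiliser; for N_α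
            -- this is `split`.
            v≡w^b : v ≡ w ^ b
            v≡w^b = *-cancelʳ-≡ v (w ^ b) (f' ^ b) {{m^n≢0 f' b {{>-nonZero (∣Sub∣-pos (K i₀ ⊓ St))}}}} (begin
                v * f' ^ b                        ≡⟨ cong₂ _*_ orbitN ∣Nα∣ ⟨
                # (orbit N α) * ∥ N ⊓ St ∥       ≡⟨ orbit-stabilizer N α ⟨
                ∥ N ∥                            ≡⟨ Count.order N (λ _ p → p) K (λ _ _ p → p) K⊆N K·C ∥ K i₀ ∥ ∣K∣ ⟩
                ∥ K i₀ ∥ ^ b                     ≡⟨ cong (_^ b) (orbit-stabilizer (K i₀) α) ⟩
                (w * f') ^ b                      ≡⟨ ^-distribʳ-* b w f' ⟩
                w ^ b * f' ^ b                    ∎)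
              where
              open ≡-Reasoning
              f' : ℕ
              f' = ∥ K i₀ ⊓ St ∥
              orbitN : # (orbit N α) ≡ v
              orbitN = trans (#-cong (orbit N α) full (λ _ _ → refl) (λ y _ → N-transitive y)) (#-full v)
              ∣Nα∣ : ∥ N ⊓ St ∥ ≡ f' ^ b
              ∣Nα∣ = Count.order (N ⊓ St) (λ _ → proj₁) (λ i → K i ⊓ St) (λ _ _ → proj₁) (λ i x (p , q) → K⊆N i x p , q)
                (λ i x (xN , xS) → let t , t∈ , c = K·C i x xN in t ,
                   (t∈ , split i t (t ⁻¹ ∙ x) t∈ c (∈-cong St (solve 2 (λ t x → x ⊜ t · (t ⁻ · x)) refl t x) xS)) , c) f' ∣K∩St∣

            -- If `a x = c x` with `a ∈ K i` and `c ∈ K j`, then `a⁻¹ c` fixes x, and `split`,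
            -- transported from α to x, shows that `a` fixes x too.
            meet : ∀ {i j} → i ≢ j → ∀ {x y} → y ∊ line i x → y ∊ line j x → y ≡ x
            meet {i} {j} i≢j {x} (a , a∈ , refl) (c , c∈ , e) with N-transitive x
            ... | m , m∈ , refl = trans (cong (λ t → act t (act m α)) (sym (▷-cancelʳ m a)))
                  (trans (act-▷ m (m ⁻¹ ▷ a) α) (cong (act m) (∈-cong St (solve 1 (λ x → x ⁻ ⁻ ⊜ x) refl _) (⁻¹∈ St a⁻∈))))
              where
              a⁻∈ : (m ⁻¹ ▷ a) ⁻¹ ∈' St
              a⁻∈ = split i _ (m ⁻¹ ▷ c) (⁻¹∈ (K i) (shift-N (⁻¹∈ N m∈) i a a∈)) (K⊆C (i≢j ∘ sym) _ (shift-N (⁻¹∈ N m∈) j c c∈))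
                (trans (cong (λ t → act t α) (solve 3 (λ m a c → ((m ⁻) :▷ a) ⁻ · ((m ⁻) :▷ c) ⊜ (m ⁻ · (a ⁻ · (c · m)))) refl m a c))
                  (trans (act-∙ _ _ α) (trans (cong (act (m ⁻¹)) (trans (act-∙ _ _ α) (trans (cong (act (a ⁻¹)) (trans (act-∙ _ _ α) e)) (act⁻¹ a (act m α))))) (act⁻¹ m α))))

            other-point : ∀ i x → Σ[ y ∈ Fin v ] (y ∊ line i x × y ≢ x)
            other-point i x = let m , m∈ , e = N-transitive x in find m m∈ e (Fin.any? (λ a → (a ∈?' K i) ×-dec ¬? (a ∈?' St)))
              where
              find : ∀ m → m ∈' N → act m α ≡ x → Dec (Σ[ a ∈ Fin n ] (a ∈' K i × ¬ a ∈' St)) → Σ[ y ∈ Fin v ] (y ∊ line i x × y ≢ x)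
              find m m∈ refl (yes (a , a∈ , ne)) = act m (act a α) , shift-line m (shift-N m∈ i) (a , a∈ , refl) , λ e → ne (act-injective m e)
              find m m∈ e (no none) = ⊥-elim (moved i λ a a∈ → decidable-stable (a ∈?' St) λ ne → none (a , a∈ , ne))

            1<w : 1 < w
            1<w = let y , y∈ , ne = other-point i₀ α in
              subst (_< w) (#-single α) (#-strict (single α) (line i₀ α) (λ { _ refl → x∊orbit (K i₀) α }) y y∈ ne)

          u : ℕ
          u = w ∸ 1

          w≡ : w ≡ suc u
          w≡ = sym (m+[n∸m]≡n (<⇒≤ 1<w))

          Γ : Fin v → DSet v
          Γ x = mk (λ y → ¬? (y Fin.≟ x) ×-dec Fin.any? (λ i → mem? (line i x) y))

          opaque
            ∣Γ∣ : ∀ x → # (Γ x) ≡ b * u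
            ∣Γ∣ x = sym (trans (cong (_* u) (sym (#-full b))) (trans (double-count full (Γ x) (λ i y → mem? (line i x) y ×-dec ¬? (y Fin.≟ x)) u 1
              (λ i y (p , ne) → refl , ne , i , p)
              (λ i _ → cong (_∸ 1) (trans (sym (#-remove (line i x) x (x∊orbit (K i) x))) (line-size i x)))
              (λ { y (ne , i , p) → trans (#-cong _ (single i) (λ j (q , _) → decidable-stable (j Fin.≟ i) λ j≢i → ne (meet j≢i q p)) (λ { j refl → p , ne })) (#-single i) }))
              (*-identityʳ _)))

            Γ-shift : ∀ g {x y} → y ∊ Γ x → act g y ∊ Γ (act g x)
            Γ-shift g {x} (ne , i , p) = let j , hK = permuteAll g i in (λ e → ne (act-injective g e)) , j , shift-line g hK p

          a : Fin v → Fin v → ℕ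
          a x B = # (mk (λ y → I? y B ×-dec mem? (Γ x) y))

          opaque
            incidence : ∀ x B → I x B → k * a x B ≡ l * (b * u)
            incidence x B xB = trans (invariant-set x (Γ x) (λ (ne , _) → ne refl) (λ g y gx p → subst (λ z → act g y ∊ Γ z) gx (Γ-shift g p)) xB) (cong (l *_) (∣Γ∣ x))

          B₀ : Fin v
          B₀ = proj₁ (block-through α)

          αB₀ : I α B₀
          αB₀ = proj₂ (block-through α)

          a₀ : ℕ
          a₀ = a α B₀

          opaque
            a-const : ∀ x B → I x B → a x B ≡ a₀
            a-const x B xB = *-cancelˡ-≡ _ _ k {{>-nonZero (≤-trans (s≤s z≤n) 2≤k)}} (trans (incidence x B xB) (sym (incidence α B₀ αB₀)))

            arithmetic : b ≡ 2 × GridArithmetic.Exceptional u k a₀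
            arithmetic = GridArithmetic.exceptional b u k l a₀ 2≤b (∸-monoˡ-≤ {2} {w} 1 1<w) 2≤k (GridArithmetic.equations b u k l a₀
              (≤-trans (s≤s z≤n) 2≤b) (∸-monoˡ-≤ {2} {w} 1 1<w) 2≤k 1≤l (incidence α B₀ αB₀)
              (trans (parameters α) (cong (λ z → (z ∸ 1) * l) (trans v≡w^b (cong (_^ b) w≡)))) large)

          module FourPoints (w≡4 : w ≡ 4) where
            X : DSet v
            X = line i₀ α

            E : Enumeration X
            E = enumerate X

            module E = Enumeration E
            open SmallDegree T T-simple T-nonab using (ActionOn; no-degree-4)

            T-stable : ∀ t → t ∈' T → ∀ y → y ∊ X → act t y ∊ X
            T-stable t t∈ y (c , c∈ , refl) = t ∙ c , ∙∈ (K i₀) (T⊆K t t∈) c∈ , act-∙ t c α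

            F : Fin n → Fin E.size → Fin E.size
            F t j with mem? X (act t (E.to j))
            ... | yes p = proj₁ (E.from _ p)
            -- A default that concerns only elements outside T, since T preserves the line.
            ... | no _ = j

            to-F : ∀ t → t ∈' T → ∀ j → E.to (F t j) ≡ act t (E.to j)
            to-F t t∈ j with mem? X (act t (E.to j))
            ... | yes p = proj₂ (E.from _ p)
            ... | no ¬p = ⊥-elim (¬p (T-stable t t∈ _ (E.to∊ j)))

            action : ActionOn E.size
            action = record
              { F = F
              ; F-∙ = λ s t s∈ t∈ j → E.inj (trans (to-F (s ∙ t) (∙∈ T s∈ t∈) j) (trans (act-∙ s t _) (sym (trans (to-F s s∈ (F t j)) (cong (act s) (to-F t t∈ j))))))
              ; F-ε = λ j → E.inj (trans (to-F ε (ε∈ T) j) (act-ε _)) }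

            -- Every point is the image of a point of the line under an element centralising `K i₀`,
            -- hence commuting with `t`.
            faithful-on-line : ActionOn.Faithfully action
            faithful-on-line t t∈ fix = faithful t λ y → let m , m∈ , e = N-transitive y in trans (cong (act t) (sym e)) (trans (fixes m m∈) e)
              where
              fixX : ∀ y → y ∊ X → act t y ≡ y
              fixX y y∈ = let j , e = E.from y y∈ in subst (λ z → act t z ≡ z) e (trans (sym (to-F t t∈ j)) (cong E.to (fix j)))
              fixes : ∀ m → m ∈' N → act t (act m α) ≡ act m α
              fixes m m∈ = let c , c∈ , cC = K·C i₀ m m∈
                               d = c ⁻¹ ∙ m
                               m≡ : m ≡ d ∙ c
                               m≡ = trans (solve 2 (λ c m → m ⊜ c · (c ⁻ · m)) refl c m) (sym (proj₂ cC c c∈))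
                           in trans (cong (λ z → act t (act z α)) m≡) (trans (cong (act t) (act-∙ d c α)) (trans (sym (act-∙ t d _))
                                (trans (cong (λ z → act z (act c α)) (sym (proj₂ cC t (T⊆K t t∈)))) (trans (act-∙ d t _)
                                  (trans (cong (act d) (fixX _ (c , c∈ , refl))) (trans (sym (act-∙ d c α)) (cong (λ z → act z α) (sym m≡))))))))

            impossible : ⊥
            impossible = subst (λ s → (A : ActionOn s) → ActionOn.Faithfully A → ⊥)
              (sym (trans (enumeration-size X E) w≡4)) no-degree-4 action faithful-on-line

          module TwoDirections (i j : Fin b) (i≢j : i ≢ j) (only : ∀ x → x ≡ i ⊎ x ≡ j) (b≡2 : b ≡ 2) where
            r : Fin b → Fin v → Fin v → ℕ
            r i x B = # (mk (λ y → I? y B ×-dec mem? (line i x) y))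

            opaque
              r-sum : ∀ x B → I x B → r i x B + r j x B ≡ a₀ + 2
              r-sum x B xB = trans (cong₂ _+_ (off i) (off j)) (trans (lem _ _) (cong (_+ 2) (trans (sym parts) (a-const x B xB))))
                where
                r° : Fin b → DSet v
                r° i = mk (λ y → (I? y B ×-dec mem? (line i x) y) ×-dec ¬? (y Fin.≟ x))
                off : ∀ i → r i x B ≡ suc (# (r° i))
                off i = #-remove (mk (λ y → I? y B ×-dec mem? (line i x) y)) x (xB , x∊orbit (K i) x)
                lem : ∀ p q → suc p + suc q ≡ (p + q) + 2
                lem = solve-∀
                parts : a x B ≡ # (r° i) + # (r° j)
                parts = trans (#-split (mk (λ y → I? y B ×-dec mem? (Γ x) y)) (line i x)) (cong₂ _+_
                  (#-cong _ (r° i) (λ { y ((yB , ne , _) , p) → (yB , p) , ne }) (λ { y ((yB , p) , ne) → (yB , ne , i , p) , p }))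
                  (#-cong _ (r° j) (λ { y ((yB , ne , i' , p) , ¬p) → (yB , [ (λ { refl → ⊥-elim (¬p p) }) , (λ { refl → p }) ]′ (only i')) , ne })
                                   (λ { y ((yB , p) , ne) → (yB , ne , j , p) , λ q → ne (meet i≢j q p) })))

              r-pos : ∀ i x B → I x B → 0 < r i x B
              r-pos i x B xB = #-pos (mk (λ y → I? y B ×-dec mem? (line i x) y)) x (xB , x∊orbit (K i) x)

              permute⁻¹ : ∀ g {i j} → (∀ x → x ∈' K i → g ▷ x ∈' K j) → ∀ x → x ∈' K j → g ⁻¹ ▷ x ∈' K i
              permute⁻¹ g {i} {j} hK = ⊆∧≥⇒⊇ {conjugate g (K i)} {K j} (λ x p → ∈-cong (K j) (▷-cancelʳ g x) (hK _ p))
                (≤-reflexive (trans (∣K∣ j) (sym (trans (∣conjugate∣ g (K i)) (∣K∣ i)))))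

              distinct-images : ∀ g {i' j'} → (∀ x → x ∈' K i → g ▷ x ∈' K i') → (∀ x → x ∈' K j → g ▷ x ∈' K j') → i' ≢ j'
              distinct-images g hi hj refl = let y , (c , c∈ , e) , ne = other-point j α in
                ne (meet i≢j (c , ∈-cong (K i) (▷-cancelˡ g c) (permute⁻¹ g hi _ (hj c c∈)) , e) (c , c∈ , e))

              r-shift : ∀ g x B C → (∀ z → I z B → I (act g z) C) → (∀ z → I (act g z) C → I z B) → ∀ {i i'} → (∀ x → x ∈' K i → g ▷ x ∈' K i') →
                        r i x B ≡ r i' (act g x) C
              r-shift g x B C to fro {i} {i'} hK = #-bij _ _ (act g) (act (g ⁻¹)) (act-act⁻¹ g) (act⁻¹ g)
                (λ y (yB , p) → to y yB , shift-line g hK p)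
                (λ y (yC , p) → fro _ (subst (λ z → I z C) (sym (act-act⁻¹ g y)) yC) ,
                   subst (λ z → act (g ⁻¹) y ∊ line i z) (act⁻¹ g x) (shift-line (g ⁻¹) (permute⁻¹ g hK) p))

            P : ℕ
            P = r i α B₀ * r j α B₀

            opaque
              -- An element carrying one flag to another may exchange the two directions, so only
              -- the sum and the product of the two line sizes are constant.
              r-product : ∀ x B → I x B → r i x B * r j x B ≡ P
              r-product x B xB with flag αB₀ xB
              ... | g , refl , to , fro = go (permuteAll g i) (permuteAll g j)
                where
                go : Σ[ i' ∈ Fin b ] (∀ x → x ∈' K i → g ▷ x ∈' K i') → Σ[ j' ∈ Fin b ] (∀ x → x ∈' K j → g ▷ x ∈' K j') →
                     r i (act g α) B * r j (act g α) B ≡ P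
                go (i' , hi) (j' , hj) with only i' | only j' | distinct-images g hi hj
                ... | inj₁ refl | inj₂ refl | _ = sym (cong₂ _*_ (r-shift g α B₀ B to fro hi) (r-shift g α B₀ B to fro hj))
                ... | inj₂ refl | inj₁ refl | _ = trans (*-comm (r i (act g α) B) _) (sym (cong₂ _*_ (r-shift g α B₀ B to fro hi) (r-shift g α B₀ B to fro hj)))
                ... | inj₁ refl | inj₁ refl | ne = ⊥-elim (ne refl)
                ... | inj₂ refl | inj₂ refl | ne = ⊥-elim (ne refl)

            -- The number of lines of direction p that meet B₀; q is the other direction.
            module Meeting (p q : Fin b) (rsum : ∀ x → I x B₀ → r p x B₀ + r q x B₀ ≡ a₀ + 2) (rprod : ∀ x → I x B₀ → r p x B₀ * r q x B₀ ≡ P) where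
              module Q = Quotient (quotient (orbits (K p)))

              Meets : DSet Q.size
              Meets = mk (λ c → Fin.any? (λ x → I? x B₀ ×-dec (c Fin.≟ Q.cls x)))

              opaque
                lines≤ : # Meets ≤ w
                lines≤ = ≤-trans (#-mono Meets full (λ _ _ → refl)) (≤-reflexive (trans (#-full _) size≡))
                  where
                  size≡ : Q.size ≡ w
                  size≡ = *-cancelʳ-≡ Q.size w w {{>-nonZero (<⇒≤ 1<w)}} (trans (cong (_* w) (sym (#-full Q.size)))
                    (trans (double-count full full (λ c x → c Fin.≟ Q.cls x) w 1 (λ _ _ _ → refl , refl)
                      (λ c _ → trans (#-cong _ (line p (Q.rep c)) (λ x e → Q.exact (trans (Q.cls-rep c) e)) (λ x m → trans (sym (Q.cls-rep c)) (Q.sound m))) (line-size p (Q.rep c)))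
                      (λ x _ → #-single (Q.cls x)))
                    (trans (*-identityʳ _) (trans (#-full v) (trans v≡w^b (trans (cong (w ^_) b≡2) (cong (w *_) (*-identityʳ w))))))))

                -- A line of direction p that meets B₀ does so in `r p` points. Along it `r p` is
                -- constant, hence so is `r q`, the sum being constant. So the line contributes
                -- `r p * r q = P`.
                total : sum (λ x → ind (I? x B₀) * r q x B₀) ≡ # Meets * P
                total = trans (sum-fibresʷ Q.cls _) (trans (sum-cong-≗ fibre) (sym (*-distribʳ-sum P _)))
                  where
                  fibre : ∀ c → sum (λ x → ind (c Fin.≟ Q.cls x) * (ind (I? x B₀) * r q x B₀)) ≡ ind (mem? Meets c) * P
                  fibre c with mem? Meets c
                  ... | no ¬m = trans (sum-0 _ (λ x → trans (sym (*-assoc (ind (c Fin.≟ Q.cls x)) _ _)) (cong (_* r q x B₀) (trans (sym (ind-× (c Fin.≟ Q.cls x) (I? x B₀)))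
                          (ind-no ((c Fin.≟ Q.cls x) ×-dec I? x B₀) (λ (e , xB) → ¬m (x , xB , e))))))) (sym (cong (_* P) (ind-no (no ¬m) ¬m)))
                  ... | yes m@(x₀ , x₀B , refl) = trans (sum-cong-≗ term) (trans (sym (*-distribʳ-sum (r q x₀ B₀) _)) (trans (cong (_* r q x₀ B₀) same)
                          (trans (rprod x₀ x₀B) (sym (trans (cong (_* P) (ind-yes (yes m) m)) (*-identityˡ P))))))
                    where
                    on-line : ∀ x → I x B₀ → Q.cls x₀ ≡ Q.cls x → r q x B₀ ≡ r q x₀ B₀
                    on-line x xB e = +-cancelˡ-≡ (r p x₀ B₀) _ _ (trans (cong (_+ r q x B₀) (#-cong (mk (λ y → I? y B₀ ×-dec mem? (line p x₀) y)) (mk (λ y → I? y B₀ ×-dec mem? (line p x) y))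
                        (λ y (yB , pr) → yB , DEquiv.~trans (orbits (K p)) (Q.exact (sym e)) pr) (λ y (yB , pr) → yB , DEquiv.~trans (orbits (K p)) (Q.exact e) pr)))
                      (trans (rsum x xB) (sym (rsum x₀ x₀B))))
                    term : ∀ x → ind (Q.cls x₀ Fin.≟ Q.cls x) * (ind (I? x B₀) * r q x B₀) ≡ ind ((Q.cls x₀ Fin.≟ Q.cls x) ×-dec I? x B₀) * r q x₀ B₀
                    term x = trans (sym (*-assoc (ind (Q.cls x₀ Fin.≟ Q.cls x)) _ _)) (trans (cong (_* r q x B₀) (sym (ind-× (Q.cls x₀ Fin.≟ Q.cls x) (I? x B₀))))
                      (fin ((Q.cls x₀ Fin.≟ Q.cls x) ×-dec I? x B₀)))
                      where
                      fin : (d : Dec (Q.cls x₀ ≡ Q.cls x × I x B₀)) → ind d * r q x B₀ ≡ ind d * r q x₀ B₀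
                      fin (yes (e , xB)) = cong (ind (yes (e , xB)) *_) (on-line x xB e)
                      fin (no ¬d) = trans (cong (_* r q x B₀) (ind-no (no ¬d) ¬d)) (sym (cong (_* r q x₀ B₀) (ind-no (no ¬d) ¬d)))
                    same : # (mk (λ x → (Q.cls x₀ Fin.≟ Q.cls x) ×-dec I? x B₀)) ≡ r p x₀ B₀
                    same = #-cong _ (mk (λ y → I? y B₀ ×-dec mem? (line p x₀) y)) (λ x (e , xB) → xB , Q.exact e) (λ x (xB , pr) → Q.sound pr , xB)

            module M₁ = Meeting i j (λ x → r-sum x B₀) (λ x → r-product x B₀)
            module M₂ = Meeting j i (λ x xB → trans (+-comm (r j x B₀) _) (r-sum x B₀ xB)) (λ x xB → trans (*-comm (r j x B₀) _) (r-product x B₀ xB))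

            opaque
              -- Sum `r i + r j = a₀ + 2` over the k points of B₀ and apply `total` in both
              -- directions.
              lines-meeting : k * (a₀ + 2) ≡ P * (# M₁.Meets + # M₂.Meets)
              lines-meeting = begin
                k * (a₀ + 2)                                           ≡⟨ cong (_* (a₀ + 2)) (block-size B₀) ⟨
                # (mk (λ x → I? x B₀)) * (a₀ + 2)                      ≡⟨ *-distribʳ-sum (a₀ + 2) _ ⟩
                sum (λ x → ind (I? x B₀) * (a₀ + 2))                   ≡⟨ sum-cong-≗ (λ x → fin x (I? x B₀)) ⟩
                sum (λ x → ind (I? x B₀) * r j x B₀ + ind (I? x B₀) * r i x B₀) ≡⟨ ∑-distrib-+ _ _ ⟩
                sum (λ x → ind (I? x B₀) * r j x B₀) + sum (λ x → ind (I? x B₀) * r i x B₀) ≡⟨ cong₂ _+_ M₁.total M₂.total ⟩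
                # M₁.Meets * P + # M₂.Meets * P                        ≡⟨ lem P (# M₁.Meets) (# M₂.Meets) ⟩
                P * (# M₁.Meets + # M₂.Meets)                          ∎
                where
                open ≡-Reasoning
                lem : ∀ p x y → x * p + y * p ≡ p * (x + y)
                lem = solve-∀
                fin : ∀ x (d : Dec (I x B₀)) → ind d * (a₀ + 2) ≡ ind d * r j x B₀ + ind d * r i x B₀
                fin x (yes p) = trans (cong (ind (yes p) *_) (trans (sym (r-sum x B₀ p)) (+-comm (r i x B₀) _))) (*-distribˡ-+ (ind (yes p)) _ _)
                fin x (no ¬p) = trans (cong (_* (a₀ + 2)) z) (sym (cong₂ _+_ (cong (_* r j x B₀) z) (cong (_* r i x B₀) z)))
                  where
                  z : ind (no ¬p) ≡ 0
                  z = ind-no (no ¬p) ¬p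

            impossible : GridArithmetic.LineCheck k a₀ (suc u) → ⊥
            impossible check = check (r i α B₀) (r j α B₀) (# M₁.Meets + # M₂.Meets) (r-pos i α B₀ αB₀) (r-pos j α B₀ αB₀) (r-sum α B₀ αB₀) lines-meeting
              (≤-trans (+-mono-≤ M₁.lines≤ M₂.lines≤) (≤-reflexive (trans (cong (w +_) (sym (+-identityʳ w))) (cong (2 *_) w≡))))

          impossible : ⊥
          impossible with u ≟ 3
          ... | yes u≡3 = FourPoints.impossible (trans w≡ (cong suc u≡3))
          ... | no u≢3 = let i , j , ne , only = two-elements (proj₁ arithmetic) in
                  TwoDirections.impossible i j ne only (proj₁ arithmetic) (GridArithmetic.no-lines u≢3 (proj₂ arithmetic))

        -- The primitive case

        module PrimitiveCase (prim : ∀ L → (∀ g x → g ∈' St → x ∈' L → g ▷ x ∈' L) → L ⊆' St ⊎ TransitiveOn L α) where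

          invariant⇒transitive : ∀ M → Invariant M → ¬ IsTrivial M → TransitiveOn M α
          invariant⇒transitive M inv nt = [ (λ le → ⊥-elim (nt λ x x∈ → faithful x λ y → let g , e = G-transitive α y in
              trans (cong (act x) (sym e)) (trans (cong (λ t → act t (act g α)) (sym (▷-cancelʳ g x))) (trans (act-▷ g _ α) (trans (cong (act g) (le _ (inv (g ⁻¹) x x∈))) e))))) , id ]′
            (prim M (λ g x _ → inv g x))

          semiregular : ∀ M → TransitiveOn M α → ∀ x → (∀ y → y ∈' M → Commutes x y) → ∀ β → act x β ≡ β → x ≡ ε
          semiregular M tr x c β fix = faithful x λ y →
            let m , m∈ , e = tr β ; m' , m'∈ , e' = tr y
                h = m' ∙ m ⁻¹
                hβ : act h β ≡ y
                hβ = trans (act-∙ _ _ β) (trans (cong (act m') (trans (cong (act (m ⁻¹)) (sym e)) (act⁻¹ m α))) e')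
            in trans (cong (act x) (sym hβ)) (trans (sym (act-∙ x h β)) (trans (cong (λ t → act t β) (c h (∙∈ M m'∈ (⁻¹∈ M m∈)))) (trans (act-∙ h x β) (trans (cong (act h) fix) hβ))))

          module _ (N : Sub) (inv : Invariant N) (N-nt : ¬ IsTrivial N) (minN : ∀ M → Invariant M → M ⊆' N → ¬ IsTrivial M → N ⊆' M) where

            transN : TransitiveOn N α
            transN = invariant⇒transitive N inv N-nt

            -- As N is abelian, its elements killed by p form a subgroup normal in G; it is
            -- nontrivial for a suitable p, so by minimality it is N.
            elementary : CommuteWith N N → Σ[ p ∈ ℕ ] (Prime p × ∀ x → x ∈' N → pow x p ≡ ε)
            elementary ab = let x , x∈ , ne = witness {N} N-nt
                                p , pr , y , y∈ , y≢ε , e = prime-order N x x∈ ne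
                            in p , pr , λ z z∈ → proj₂ (minN (torsion p) (λ g x (x∈ , e) → inv g x x∈ , trans (sym (pow-▷ g x p)) (trans (cong (g ▷_) e) (solve 1 (λ g → g :▷ :ε ⊜ :ε) refl g)))
                                 (λ _ → proj₁) (λ t → y≢ε (t y (y∈ , e))) z z∈)
              where
              torsion : ℕ → Sub
              torsion p = record
                { set = mk (λ x → (x ∈?' N) ×-dec (pow x p Fin.≟ ε)) ; ε∈ = ε∈ N , pow-ε p
                ; ∙∈ = λ {x} {y} (x∈ , e) (y∈ , e') → ∙∈ N x∈ y∈ , trans (pow-∙ (ab x y x∈ y∈) p) (trans (cong₂ _∙_ e e') (identityˡ ε))
                ; ⁻¹∈ = λ {x} (x∈ , e) → ⁻¹∈ N x∈ , trans (sym (identityˡ _)) (trans (cong (_∙ pow (x ⁻¹) p) (sym e))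
                     (trans (sym (pow-∙ (ab x (x ⁻¹) x∈ (⁻¹∈ N x∈)) p)) (trans (cong (λ t → pow t p) (inverseʳ x)) (pow-ε p)))) }

            module _ (nonab : NonAbelian N) where

              simple : IsSimple N
              simple X X⊲ nt x x∈ = decidable-stable (x ∈?' X) λ x∉ → minimal-sub (λ L → L ⊲ N × ¬ IsTrivial L) X (X⊲ , nt) λ T (T⊲ , T-nt) minT →
                MinimalNormal.grid-or-diag prim N inv minN nonab transN T T⊲ T-nt minT
                  (λ le → <⇒≱ (#-strict (set X) (set N) (proj₁ X⊲) x x∈ x∉) (≤-trans (#-mono (set N) (set T) le) (minT X (X⊲ , nt))))
                  Grid.impossible Diagonal.impossible

              Cent : Sub
              Cent = centralizer whole N

              Cent-inv : Invariant Cent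
              Cent-inv g = centralizer-▷ whole N N g (λ _ _ → refl) (λ y → inv (g ⁻¹) y)

              -- If N had a nontrivial centralizer, both would be regular and N × C_G(N) would be diagonal.
              centralizer-trivial : IsTrivial Cent
              centralizer-trivial x x∈ = decidable-stable (x Fin.≟ ε) λ ne → Diagonal.impossible (diagData (λ t → ne (t x x∈)))
                where
                diagData : ¬ IsTrivial Cent → DiagData
                diagData C-nt = record
                  { N = NC ; m = 2 ; family = family ; 2≤m = ≤-refl
                  ; N-transitive = λ y → let m , m∈ , e = transN y in m , N⊆NC m m∈ , e
                  ; N-invariant = λ g x _ (m , m∈ , c) → g ▷ m , inv g m m∈ , ∈-cong Cent (solve 3 (λ s a x → s :▷ (a ⁻ · x) ⊜ (s :▷ a) ⁻ · (s :▷ x)) refl g m x) (Cent-inv g _ c)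
                  ; D∩C = λ { zero x (_ , xS) (_ , c) → semiregular N transN x c α xS ; (suc zero) x (_ , xS) (_ , c) → semiregular Cent transC x c α xS }
                  ; D·C = λ { zero x x∈ → D·M Cent transC C⊆NC {N} (λ z z∈ → C⊆NC z z∈ , proj₂ z∈) x x∈
                            ; (suc zero) x x∈ → D·M N transN N⊆NC {Cent} (λ z z∈ → N⊆NC z z∈ , λ y y∈ → sym (proj₂ y∈ z z∈)) x x∈ }
                  ; i₁ = zero ; K-simple = simple ; K-nonab = nonab }
                  where
                  transC : TransitiveOn Cent α
                  transC = invariant⇒transitive Cent Cent-inv C-nt
                  NC : Sub
                  NC = product N Cent (λ h x _ → Cent-inv h x)
                  N⊆NC : N ⊆' NC
                  N⊆NC x x∈ = x , x∈ , ∈-cong Cent (sym (inverseˡ x)) (ε∈ Cent)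
                  C⊆NC : Cent ⊆' NC
                  C⊆NC x x∈ = ε , ε∈ N , ∈-cong Cent (solve 1 (λ x → x ⊜ :ε ⁻ · x) refl x) x∈
                  K : Fin 2 → Sub
                  K zero = N
                  K (suc zero) = Cent
                  N∩C : ∀ x → x ∈' N → (∀ y → y ∈' N → Commutes x y) → x ≡ ε
                  N∩C x x∈ c = trivial-center {N} simple nonab x (x∈ , c)
                  -- Take `m ∈ N` moving α to the same point as `x`. Then `m⁻¹ x` centralises the
                  -- transitive group `Cent` and fixes α, so `x = m` lies in the centre of N.
                  C-center : ∀ x → x ∈' Cent → (∀ y → y ∈' Cent → Commutes x y) → x ≡ ε
                  C-center x x∈ c =
                    let m , m∈ , e = transN (act x α)
                        z≡ε = semiregular Cent transC (m ⁻¹ ∙ x) (λ y y∈ → comm-∙ (comm-⁻¹ (sym (proj₂ y∈ m m∈))) (c y y∈)) α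
                                (trans (act-∙ _ _ α) (trans (cong (act (m ⁻¹)) (sym e)) (act⁻¹ m α)))
                        x≡m : x ≡ m
                        x≡m = trans (solve 2 (λ m x → x ⊜ m · (m ⁻ · x)) refl m x) (trans (cong (m ∙_) z≡ε) (identityʳ m))
                    in N∩C x (∈-cong N (sym x≡m) m∈) (proj₂ x∈)
                  joint : ∀ x → x ∈' NC → (∀ i → x ∈' centralizer NC (K i)) → x ≡ ε
                  joint x (m , m∈ , c) h = C-center x (∈-cong Cent (trans (cong (λ z → z ⁻¹ ∙ x) m≡ε) (solve 1 (λ d → :ε ⁻ · d ⊜ d) refl x)) c) (proj₂ (h (suc zero)))
                    where
                    m≡ε : m ≡ ε
                    m≡ε = N∩C m m∈ (λ y y∈ → subst (λ z → Commutes z y) (solve 2 (λ m x → x · (m ⁻ · x) ⁻ ⊜ m) refl m x)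
                            (comm-∙ (proj₂ (h zero) y y∈) (comm-⁻¹ (proj₂ c y y∈))))
                  family : Family NC α 2
                  family = record
                    { K = K
                    ; K⊆N = λ { zero → N⊆NC ; (suc zero) → C⊆NC }
                    ; commute = λ { {zero} {zero} ne → ⊥-elim (ne refl) ; {zero} {suc zero} _ → λ x y x∈ y∈ → sym (proj₂ y∈ x x∈)
                                  ; {suc zero} {zero} _ → λ x y x∈ y∈ → proj₂ x∈ y y∈ ; {suc zero} {suc zero} ne → ⊥-elim (ne refl) }
                    ; K∩C = λ { zero x x∈ (_ , c) → N∩C x x∈ c ; (suc zero) x x∈ (_ , c) → C-center x x∈ c }
                    ; K·C = λ { zero x (m , m∈ , c) → m , m∈ , C⊆NC _ c , proj₂ c
                              ; (suc zero) x (m , m∈ , c) → m ⁻¹ ∙ x , c , subst (λ z → z ∈' NC × (∀ y → y ∈' Cent → Commutes z y))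
                                   (trans (trans (solve 2 (λ m c → m ⊜ c ⁻ · (c · m)) refl m (m ⁻¹ ∙ x)) (cong ((m ⁻¹ ∙ x) ⁻¹ ∙_) (proj₂ c m m∈)))
                                          (solve 2 (λ m x → (m ⁻ · x) ⁻ · (m · (m ⁻ · x)) ⊜ (m ⁻ · x) ⁻ · x) refl m x))
                                   (N⊆NC m m∈ , λ y y∈ → sym (proj₂ y∈ m m∈)) }
                    ; joint = joint
                    ; permute = λ { g _ zero → zero , inv g ; g _ (suc zero) → suc zero , Cent-inv g } }
                  -- Some `m ∈ M` takes α to `x⁻¹ α`; then `d = x m` fixes α, and `d⁻¹ x = m⁻¹` lies
                  -- in M.
                  D·M : ∀ M → TransitiveOn M α → M ⊆' NC → ∀ {K'} → (∀ z → z ∈' M → z ∈' centralizer NC K') →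
                        ∀ x → x ∈' NC → Σ[ d ∈ Fin n ] (d ∈' (NC ⊓ St) × d ⁻¹ ∙ x ∈' centralizer NC K')
                  D·M M tr M⊆ {K'} M⊆C x x∈ = let m , m∈ , e = tr (act (x ⁻¹) α) in x ∙ m ,
                    (∙∈ NC x∈ (M⊆ m m∈) , trans (act-∙ x m α) (trans (cong (act x) e) (act-act⁻¹ x α))) ,
                    ∈-cong (centralizer NC K') (solve 2 (λ x m → m ⁻ ⊜ (x · m) ⁻ · x) refl x m) (⁻¹∈ (centralizer NC K') (M⊆C m m∈))

        -- The imprimitive case

        module Classes (c d : ℕ) (cls : Fin v → Fin d) (cls-size : ∀ i → # (mk (λ x → i Fin.≟ cls x)) ≡ c)
          (cls-inv : ∀ g x y → cls x ≡ cls y → cls (act g x) ≡ cls (act g y)) (1<c : 1 < c) (1<d : 1 < d) where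
          v≡ : v ≡ c * d
          v≡ = trans (sym (#-full v)) (trans (sum-fibres full cls) (trans (sum-cong-≗ (λ i → trans (#-cong (mk (λ x → mem? full x ×-dec (i Fin.≟ cls x))) (mk (λ x → i Fin.≟ cls x)) (λ _ → proj₂) (λ _ p → refl , p)) (cls-size i)))
                 (trans (sum-const d c) (*-comm d c))))

          meet : Fin v → Fin d → DSet v
          meet B i = mk (λ y → I? y B ×-dec (i Fin.≟ cls y))

          same-class : ∀ x B → I x B → k * (# (meet B (cls x)) ∸ 1) ≡ l * (c ∸ 1)
          same-class x B xB = trans (cong (k *_) (trans (cong (_∸ 1) (#-remove (meet B (cls x)) x (xB , refl)))
                (#-cong (mk (λ y → mem? (meet B (cls x)) y ×-dec ¬? (y Fin.≟ x))) (mk (λ y → I? y B ×-dec mem? Γ y)) (λ y ((yB , e) , ne) → yB , e , ne) (λ y (yB , e , ne) → (yB , e) , ne))))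
              (trans (invariant-set x Γ (λ (_ , ne) → ne refl)
                 (λ g y gx (e , ne) → trans (cong cls (sym gx)) (cls-inv g x y e) , λ e' → ne (act-injective g (trans e' (sym gx)))) xB)
               (cong (l *_) (cong (_∸ 1) (trans (sym (#-remove (mk (λ y → cls x Fin.≟ cls y)) x refl)) (cls-size (cls x))))))
            where
            Γ : DSet v
            Γ = mk (λ y → (cls x Fin.≟ cls y) ×-dec ¬? (y Fin.≟ x))

          B₀ : Fin v
          B₀ = proj₁ (block-through α)

          αB₀ : I α B₀
          αB₀ = proj₂ (block-through α)

          ℓ : ℕ
          ℓ = # (meet B₀ (cls α))

          meet-pos : ∀ x B → I x B → 0 < # (meet B (cls x))
          meet-pos x B xB = #-pos (meet B (cls x)) x (xB , refl)

          meet-ℓ : ∀ x B → I x B → # (meet B (cls x)) ≡ ℓ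
          meet-ℓ x B xB = trans (sym (m+[n∸m]≡n (meet-pos x B xB))) (trans (cong suc (*-cancelˡ-≡ _ _ k {{>-nonZero (≤-trans (s≤s z≤n) 2≤k)}} (trans (same-class x B xB) (sym (same-class α B₀ αB₀)))))
            (m+[n∸m]≡n (meet-pos α B₀ αB₀)))

          meet-0-or-ℓ : ∀ B i → # (meet B i) ≡ 0 ⊎ # (meet B i) ≡ ℓ
          meet-0-or-ℓ B i with Fin.any? (mem? (meet B i))
          ... | no ¬p = inj₁ (#-empty (meet B i) (λ x p → ¬p (x , p)))
          ... | yes (x , xB , refl) = inj₂ (meet-ℓ x B xB)

          ℓ∣meet : ∀ B i → ℓ ∣ # (meet B i)
          ℓ∣meet B i = [ (λ e → subst (ℓ ∣_) (sym e) (ℓ ∣0)) , (λ e → ∣-reflexive (sym e)) ]′ (meet-0-or-ℓ B i)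

          ℓ∣k : ℓ ∣ k
          ℓ∣k = subst (ℓ ∣_) (trans (sym (sum-fibres (mk (λ x → I? x B₀)) cls)) (block-size B₀)) (sum-∣ _ ℓ (ℓ∣meet B₀))

          -- Counting the pairs (y, B) with α ∈ B and y ∈ B, for y in another class.
          ℓ∣cl : ℓ ∣ c * l
          ℓ∣cl = subst (ℓ ∣_) pairs (sum-∣ (λ B → # (mk (λ y → I? α B ×-dec mem? (meet B j) y))) ℓ row)
            where
            other : Σ[ j ∈ Fin d ] j ≢ cls α
            other = let j , _ , ne = #>1 (full {d}) (cls α) refl (subst (1 <_) (sym (#-full d)) 1<d) in j , ne
            j : Fin d
            j = proj₁ other
            row : ∀ B → ℓ ∣ # (mk (λ y → I? α B ×-dec mem? (meet B j) y))
            row B = go (I? α B)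
              where
              go : (dec : Dec (I α B)) → ℓ ∣ # (mk (λ y → dec ×-dec mem? (meet B j) y))
              go (yes p) = subst (ℓ ∣_) (#-cong (meet B j) (mk (λ y → yes p ×-dec mem? (meet B j) y)) (λ y q → p , q) (λ y (_ , q) → q)) (ℓ∣meet B j)
              go (no ¬p) = subst (ℓ ∣_) (sym (#-empty (mk (λ y → no ¬p ×-dec mem? (meet B j) y)) (λ y (q , _) → ¬p q))) (ℓ ∣0)
            J : DSet v
            J = mk (λ y → j Fin.≟ cls y)
            col : ∀ y → # (mk (λ B → I? α B ×-dec mem? (meet B j) y)) ≡ ind (mem? J y) * l
            col y = go (mem? J y)
              where
              go : (dec : Dec (j ≡ cls y)) → # (mk (λ B → I? α B ×-dec mem? (meet B j) y)) ≡ ind dec * l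
              go (yes p) = trans (#-cong (mk (λ B → I? α B ×-dec mem? (meet B j) y)) (mk (λ B → I? α B ×-dec I? y B)) (λ B (a , b , _) → a , b) (λ B (a , b) → a , b , p))
                            (trans (pair-blocks (λ e → proj₂ other (trans p (cong cls (sym e))))) (sym (trans (cong (_* l) (ind-yes (yes p) p)) (*-identityˡ l))))
              go (no ¬p) = trans (#-empty (mk (λ B → I? α B ×-dec mem? (meet B j) y)) (λ B (_ , _ , e) → ¬p e)) (sym (cong (_* l) (ind-no (no ¬p) ¬p)))
            pairs : sum (λ B → # (mk (λ y → I? α B ×-dec mem? (meet B j) y))) ≡ c * l
            pairs = trans (∑-comm _) (trans (sum-cong-≗ col) (trans (sym (*-distribʳ-sum l (λ y → ind (mem? J y)))) (cong (_* l) (cls-size j))))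

          conclusion : ImprimitiveArithmetic.Conclusion c d k l ℓ
          conclusion = ImprimitiveArithmetic.conclude c d k l ℓ 1<c 1<d 2≤k 1≤l (meet-pos α B₀ αB₀) (same-class α B₀ αB₀)
            (trans (parameters α) (cong (λ t → (t ∸ 1) * l) v≡)) large ℓ∣k ℓ∣cl


        -- Return to permutation groups and systems of imprimitivity

        module Translation (Gᵖ : PermGroup v) (perm : Fin n → Permutation′ v)
          (perm-act : ∀ i x → act i x ≡ perm i ⟨$⟩ʳ x) (perm∈ : ∀ i → perm i ∈ᴳ Gᵖ)
          (find : ∀ g → g ∈ᴳ Gᵖ → Σ[ i ∈ Fin n ] perm i ≈ g)
          (D : Design v k l) (block : Fin v → Subset v) (I⇒∈ : ∀ {x B} → I x B → x ∈ₛ block B) (∈⇒I : ∀ {x B} → x ∈ₛ block B → I x B)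
          (block-of : ∀ B → B ∈ blocks D → Σ[ j ∈ Fin v ] block j ≡ B) where

          perm-∙ : ∀ i j x → perm (i ∙ j) ⟨$⟩ʳ x ≡ perm i ⟨$⟩ʳ (perm j ⟨$⟩ʳ x)
          perm-∙ i j x = trans (sym (perm-act _ x)) (trans (act-∙ i j x) (trans (perm-act i _) (cong (perm i ⟨$⟩ʳ_) (perm-act j x))))

          perm-ε : ∀ x → perm ε ⟨$⟩ʳ x ≡ x
          perm-ε x = trans (sym (perm-act ε x)) (act-ε x)

          perm-⁻¹ : ∀ i x → perm (i ⁻¹) ⟨$⟩ʳ x ≡ perm i ⟨$⟩ˡ x
          perm-⁻¹ i x = trans (sym (Perm.inverseˡ (perm i))) (cong (perm i ⟨$⟩ˡ_) (trans (sym (perm-∙ i (i ⁻¹) x)) (trans (cong (λ t → perm t ⟨$⟩ʳ x) (inverseʳ i)) (perm-ε x))))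

          perm-ext : ∀ {i j} → perm i ≈ perm j → i ≡ j
          perm-ext {i} {j} h = trans (solve 2 (λ i j → i ⊜ j · (j ⁻ · i)) refl i j) (trans (cong (j ∙_) (faithful (j ⁻¹ ∙ i) λ x →
            trans (act-∙ _ _ x) (trans (cong (act (j ⁻¹)) (trans (perm-act i x) (trans (h x) (sym (perm-act j x))))) (act⁻¹ j x)))) (identityʳ j))

          transitive : Transitive Gᵖ
          transitive x y = let i , e = G-transitive x y in perm i , perm∈ i , trans (sym (perm-act i x)) e

          -- Systems of imprimitivity

          module FromSystem {c d : ℕ} (S : SystemOfImprimitivity Gᵖ c d) where
            open SystemOfImprimitivity S using (partition; class-size; invariant; 1<c; 1<d)

            cls : Fin v → Fin d
            cls x = proj₁ (partition x)

            cls-∈ : ∀ x → x ∈ₛ class S (cls x)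
            cls-∈ x = proj₁ (proj₂ (partition x))

            cls-unique : ∀ x {i} → x ∈ₛ class S i → cls x ≡ i
            cls-unique x = proj₂ (proj₂ (partition x))

            cls-size : ∀ i → # (mk (λ x → i Fin.≟ cls x)) ≡ c
            cls-size i = trans (#-cong (mk (λ x → i Fin.≟ cls x)) (mk (_∈? class S i)) (λ { x refl → cls-∈ x }) (λ x p → sym (cls-unique x p)))
              (trans (sym (∣subset∣ (class S i))) (class-size i))

            cls-inv : ∀ g x y → cls x ≡ cls y → cls (act g x) ≡ cls (act g y)
            cls-inv g x y e = trans (to x refl) (sym (to y (sym e)))
              where
              j : Fin d
              j = proj₁ (invariant (perm∈ g) (cls x))
              to : ∀ z → cls z ≡ cls x → cls (act g z) ≡ j
              to z e' = cls-unique (act g z) (subst₂ _∈ₛ_ (sym (perm-act g z)) (proj₂ (invariant (perm∈ g) (cls x)))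
                (∈image⁺ (perm g) (class S (cls x)) (subst (λ i → z ∈ₛ class S i) e' (cls-∈ z))))

            module K = Classes c d cls cls-size cls-inv 1<c 1<d

            ∣B∩class∣ : ∀ B i → card (block B ∩ class S i) ≡ # (K.meet B i)
            ∣B∩class∣ B i = trans (∣subset∣ (block B ∩ class S i)) (#-cong (mk (_∈? (block B ∩ class S i))) (K.meet B i)
              (λ x p → let xB , xi = x∈p∩q⁻ (block B) (class S i) p in ∈⇒I xB , sym (cls-unique x xi))
              (λ { x (xB , refl) → x∈p∩q⁺ (I⇒∈ xB , cls-∈ x) }))

            intersections : ∀ B → B ∈ blocks D → ∀ i → card (B ∩ class S i) ≡ 0 ⊎ card (B ∩ class S i) ≡ K.ℓ
            intersections B B∈ i = let j , block-j = block-of B B∈ in subst (λ B → card (B ∩ class S i) ≡ 0 ⊎ card (B ∩ class S i) ≡ K.ℓ) block-j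
                ([ (λ e → inj₁ (trans (∣B∩class∣ j i) e)) , (λ e → inj₂ (trans (∣B∩class∣ j i) e)) ]′ (K.meet-0-or-ℓ j i))

            sq : ∀ m → m * m ≡ m ^ 2
            sq m = cong (m *_) (sym (*-identityʳ m))

            parameters-λ : (v , k , l) ≡ (l ^ 2 * (l + 2) , l * (l + 1) , l)
            parameters-λ = cong₂ (λ a b → a , b , l) (trans K.v≡ ([ (λ (c≡ , d≡ , _) → trans (cong₂ _*_ c≡ d≡) (cong (_* (l + 2)) (sq l)))
                , (λ (c≡ , d≡ , _) → trans (cong₂ _*_ c≡ d≡) (trans (*-comm (l + 2) (l * l)) (cong (_* (l + 2)) (sq l)))) ]′ (proj₂ K.conclusion))) (proj₁ K.conclusion)

            triple : (c , d , K.ℓ) ≡ (l ^ 2 , l + 2 , l) ⊎ (c , d , K.ℓ) ≡ (l + 2 , l ^ 2 , 2)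
            triple = [ (λ (c≡ , d≡ , ℓ≡) → inj₁ (cong₂ _,_ (trans c≡ (sq l)) (cong₂ _,_ d≡ ℓ≡))) , (λ (c≡ , d≡ , ℓ≡) → inj₂ (cong₂ _,_ c≡ (cong₂ _,_ (trans d≡ (sq l)) ℓ≡))) ]′ (proj₂ K.conclusion)

          -- A nontrivial block of imprimitivity through α. It is a single subset with a decidable
          -- property, so primitivity can be decided by search.
          IsBlock : Subset v → Set
          IsBlock S = α ∈ₛ S × (Σ[ β ∈ Fin v ] (β ∈ₛ S × β ≢ α)) × (Σ[ γ ∈ Fin v ] ¬ γ ∈ₛ S) ×
            (∀ g x → x ∈ₛ S → act g x ∈ₛ S → ∀ y → y ∈ₛ S → act g y ∈ₛ S)

          isBlock? : ∀ S → Dec (IsBlock S)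
          isBlock? S = (α ∈? S) ×-dec (Fin.any? (λ β → (β ∈? S) ×-dec ¬? (β Fin.≟ α)) ×-dec (Fin.any? (λ γ → ¬? (γ ∈? S)) ×-dec
            Fin.all? (λ g → Fin.all? (λ x → (x ∈? S) →-dec ((act g x ∈? S) →-dec Fin.all? (λ y → (y ∈? S) →-dec (act g y ∈? S)))))))

          system⇒block : ∀ {c d} (S : SystemOfImprimitivity Gᵖ c d) → IsBlock (class S (FromSystem.cls S α))
          system⇒block {c} {d} S = cls-∈ α , (β , β∈ , proj₂ (proj₂ other-β)) , (γ , γ∉) , stable
            where
            open FromSystem S
            open SystemOfImprimitivity S using (1<c; 1<d)
            X : DSet v
            X = mk (λ x → cls α Fin.≟ cls x)
            other-β : Σ[ b ∈ Fin v ] (b ∊ X × b ≢ α)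
            other-β = #>1 X α refl (subst (1 <_) (sym (cls-size (cls α))) 1<c)
            β : Fin v
            β = proj₁ other-β
            β∈ : β ∈ₛ class S (cls α)
            β∈ = subst (λ i → β ∈ₛ class S i) (sym (proj₁ (proj₂ other-β))) (cls-∈ β)
            other-j : Σ[ j ∈ Fin d ] (j ∊ full × j ≢ cls α)
            other-j = #>1 (full {d}) (cls α) refl (subst (1 <_) (sym (#-full d)) 1<d)
            inhabited : ∀ j → Σ[ x ∈ Fin v ] j ≡ cls x
            inhabited j with Fin.any? (λ x → j Fin.≟ cls x)
            ... | yes p = p
            ... | no ¬p = ⊥-elim (<⇒≢ (≤-trans (s≤s z≤n) 1<c) (trans (sym (#-empty (mk (λ x → j Fin.≟ cls x)) (λ x e → ¬p (x , e)))) (cls-size j)))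
            γ : Fin v
            γ = proj₁ (inhabited (proj₁ other-j))
            γ∉ : ¬ γ ∈ₛ class S (cls α)
            γ∉ p = proj₂ (proj₂ other-j) (trans (proj₂ (inhabited (proj₁ other-j))) (cls-unique γ p))
            stable : ∀ g x → x ∈ₛ class S (cls α) → act g x ∈ₛ class S (cls α) → ∀ y → y ∈ₛ class S (cls α) → act g y ∈ₛ class S (cls α)
            stable g x x∈ gx∈ y y∈ = subst (λ i → act g y ∈ₛ class S i)
              (trans (cls-inv g y x (trans (cls-unique y y∈) (sym (cls-unique x x∈)))) (cls-unique (act g x) gx∈)) (cls-∈ (act g y))

          module FromBlock (S : Subset v) (isB : IsBlock S) where
            α∈ : α ∈ₛ S
            α∈ = proj₁ isB

            stable : ∀ g x → x ∈ₛ S → act g x ∈ₛ S → ∀ y → y ∈ₛ S → act g y ∈ₛ S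
            stable = proj₂ (proj₂ (proj₂ isB))

            _~_ : Fin v → Fin v → Set
            x ~ y = Σ[ g ∈ Fin n ] (act (g ⁻¹) x ∈ₛ S × act (g ⁻¹) y ∈ₛ S)

            -- Two translates of S that share the point `x` coincide; this makes "lying in a common
            -- translate" transitive.
            shift : ∀ {x y g h} → act (g ⁻¹) x ∈ₛ S → act (h ⁻¹) x ∈ₛ S → act (h ⁻¹) y ∈ₛ S → act (g ⁻¹) y ∈ₛ S
            shift {x} {y} {g} {h} gx hx hy = subst (_∈ₛ S) (e y) (stable (g ⁻¹ ∙ h) (act (h ⁻¹) x) hx (subst (_∈ₛ S) (sym (e x)) gx) _ hy)
              where
              e : ∀ z → act (g ⁻¹ ∙ h) (act (h ⁻¹) z) ≡ act (g ⁻¹) z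
              e z = trans (act-∙ _ _ _) (cong (act (g ⁻¹)) (act-act⁻¹ h z))

            E : DEquiv v
            E = record
              { _~_ = _~_
              ; ~? = λ x y → Fin.any? (λ g → (act (g ⁻¹) x ∈? S) ×-dec (act (g ⁻¹) y ∈? S))
              ; ~refl = λ x → let g , e = G-transitive α x ; p = subst (_∈ₛ S) (trans (sym (act⁻¹ g α)) (cong (act (g ⁻¹)) e)) α∈ in g , p , p
              ; ~sym = λ (g , p , q) → g , q , p
              ; ~trans = λ { (g , p , q) (h , p' , q') → h , shift p' q p , q' } }

            module Q = Quotient (quotient E)

            X : Fin Q.size → DSet v
            X i = mk (λ x → i Fin.≟ Q.cls x)

            S' : DSet v
            S' = mk (_∈? S)

            ∣X∣ : ∀ i → # (X i) ≡ # S'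
            ∣X∣ i = #-bij (X i) S' (act (g ⁻¹)) (act g) (act⁻¹ g) (act-act⁻¹ g)
                (λ y e → let h , hx , hy = Q.exact {Q.rep i} {y} (trans (Q.cls-rep i) e) in shift gx hx hy)
                (λ y y∈ → trans (sym (Q.cls-rep i)) (Q.sound (g , gx , subst (_∈ₛ S) (sym (act⁻¹ g y)) y∈)))
              where
              g : Fin n
              g = proj₁ (G-transitive α (Q.rep i))
              gx : act (g ⁻¹) (Q.rep i) ∈ₛ S
              gx = subst (_∈ₛ S) (trans (sym (act⁻¹ g α)) (cong (act (g ⁻¹)) (proj₂ (G-transitive α (Q.rep i))))) α∈

            cls-act : ∀ g {x y} → Q.cls x ≡ Q.cls y → Q.cls (act g x) ≡ Q.cls (act g y)
            cls-act g {x} {y} e = let h , hx , hy = Q.exact {x} {y} e in Q.sound (g ∙ h , subst (_∈ₛ S) (sym (eq h x)) hx , subst (_∈ₛ S) (sym (eq h y)) hy)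
              where
              eq : ∀ h z → act ((g ∙ h) ⁻¹) (act g z) ≡ act (h ⁻¹) z
              eq h z = trans (sym (act-∙ _ _ z)) (cong (λ t → act t z) (solve 2 (λ g h → (g · h) ⁻ · g ⊜ h ⁻) refl g h))

            system : SystemOfImprimitivity Gᵖ (# S') Q.size
            system = record
              { class = λ i → subset (X i)
              ; partition = λ x → Q.cls x , ∈subset⁺ (X (Q.cls x)) refl , λ {j} p → sym (∈subset⁻ (X j) p)
              ; class-size = λ i → trans (∣subset∣ (subset (X i))) (trans (#-cong (mk (_∈? subset (X i))) (X i) (λ _ → ∈subset⁻ (X i)) (λ _ → ∈subset⁺ (X i))) (∣X∣ i))
              ; invariant = λ {g} g∈ i → let t , t≈ = find g g∈ in Q.cls (act t (Q.rep i)) , tabulate-cong (λ y → trans (lookup∘tabulate _ (g ⟨$⟩ˡ y)) (agree g t t≈ i y))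
              ; 1<c = let β , β∈ , ne = proj₁ (proj₂ isB) in subst (_< # S') (#-single α) (#-strict (single α) S' (λ { _ refl → α∈ }) β β∈ ne)
              ; 1<d = two (Q.cls α) (Q.cls (proj₁ γ)) λ e → proj₂ γ (let h , hα , hγ = Q.exact {α} {proj₁ γ} e in
                        subst (_∈ₛ S) (trans (cong (λ t → act t (proj₁ γ)) (solve 0 (:ε ⁻ ⊜ :ε) refl)) (act-ε _))
                          (shift {α} {proj₁ γ} {ε} {h} (subst (_∈ₛ S) (sym (trans (cong (λ t → act t α) (solve 0 (:ε ⁻ ⊜ :ε) refl)) (act-ε α))) α∈) hα hγ)) }
              where
              γ : Σ[ γ ∈ Fin v ] ¬ γ ∈ₛ S
              γ = proj₁ (proj₂ (proj₂ isB))
              two : ∀ {d} (i j : Fin d) → i ≢ j → 1 < d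
              two {suc zero} zero zero ne = ⊥-elim (ne refl)
              two {suc (suc d)} _ _ _ = s≤s (s≤s z≤n)
              agree : ∀ g t → perm t ≈ g → ∀ i y → does (mem? (X i) (g ⟨$⟩ˡ y)) ≡ does (mem? (X (Q.cls (act t (Q.rep i)))) y)
              agree g t t≈ i y = same (mem? (X i) (g ⟨$⟩ˡ y)) (mem? (X (Q.cls (act t (Q.rep i)))) y)
                  (λ e → trans (cls-act t (trans (Q.cls-rep i) e)) (cong Q.cls ty))
                  (λ e → trans (sym (Q.cls-rep i)) (trans (sym (cong Q.cls (act⁻¹ t (Q.rep i)))) (trans (cls-act (t ⁻¹) e) (cong Q.cls (trans (cong (act (t ⁻¹)) (sym ty)) (act⁻¹ t _))))))
                where
                ty : act t (g ⟨$⟩ˡ y) ≡ y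
                ty = trans (perm-act t _) (trans (t≈ _) (Perm.inverseʳ g))
                same : ∀ {P Q : Set} (d : Dec P) (e : Dec Q) → (P → Q) → (Q → P) → does d ≡ does e
                same (yes p) e f _ = sym (dec-true e (f p))
                same (no ¬p) e _ g = sym (dec-false e (¬p ∘ g))

          -- The orbit of α under L would be a block. If `g` takes `a α` to `b α` with `a, b ∈ L`,
          -- then `b⁻¹ g a` lies in G_α and normalises L, so `g` maps the orbit into itself.
          no-block⇒maximal : ¬ (Σ[ S ∈ Subset v ] IsBlock S) → ∀ L → (∀ g x → g ∈' St → x ∈' L → g ▷ x ∈' L) → L ⊆' St ⊎ TransitiveOn L α
          no-block⇒maximal none L inv with ⊆?' L St | Fin.all? (λ y → mem? (orbit L α) y)
          ... | yes p | _ = inj₁ p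
          ... | no _ | yes q = inj₂ q
          ... | no ¬p | no ¬q = ⊥-elim (none (subset O , ∈subset⁺ O (x∊orbit L α) , moved , outside-point , stable))
            where
            O : DSet v
            O = orbit L α
            moved : Σ[ β ∈ Fin v ] (β ∈ₛ subset O × β ≢ α)
            moved with Fin.any? (λ x → (x ∈?' L) ×-dec ¬? (x ∈?' St))
            ... | yes (x , x∈ , ne) = act x α , ∈subset⁺ O (x , x∈ , refl) , ne
            ... | no h = ⊥-elim (¬p λ x x∈ → decidable-stable (x ∈?' St) λ ne → h (x , x∈ , ne))
            outside-point : Σ[ γ ∈ Fin v ] ¬ γ ∈ₛ subset O
            outside-point with Fin.any? (λ y → ¬? (mem? O y))
            ... | yes (y , ne) = y , ne ∘ ∈subset⁻ O
            ... | no h = ⊥-elim (¬q λ y → decidable-stable (mem? O y) λ ne → h (y , ne))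
            stable : ∀ g x → x ∈ₛ subset O → act g x ∈ₛ subset O → ∀ y → y ∈ₛ subset O → act g y ∈ₛ subset O
            stable g x x∈ gx∈ y y∈ = ∈subset⁺ O (go (∈subset⁻ O x∈) (∈subset⁻ O gx∈) (∈subset⁻ O y∈))
              where
              go : x ∊ O → act g x ∊ O → y ∊ O → act g y ∊ O
              go (a , a∈ , refl) (b , b∈ , e) (c , c∈ , refl) = b ∙ (h ▷ (a ⁻¹ ∙ c)) , ∙∈ L b∈ (inv h _ h∈ (∙∈ L (⁻¹∈ L a∈) c∈)) ,
                  trans (act-∙ _ _ α) (trans (cong (λ z → act b (act (h ▷ (a ⁻¹ ∙ c)) z)) (sym h∈)) (trans (cong (act b) (act-▷ h _ α))
                    (trans (sym (act-∙ _ _ _)) (trans (sym (act-∙ _ _ α)) (trans (cong (λ t → act t α)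
                      (solve 4 (λ a b c g → b · (b ⁻ · g · a) · (a ⁻ · c) ⊜ g · c) refl a b c g)) (act-∙ g c α))))))
                where
                h : Fin n
                h = b ⁻¹ ∙ g ∙ a
                h∈ : h ∈' St
                h∈ = trans (act-∙ _ _ α) (trans (act-∙ _ _ _) (trans (cong (act (b ⁻¹)) (sym e)) (act⁻¹ b α)))

          -- Translating subgroups

          toPerm : Sub → PermGroup v
          toPerm H = record
            { Member = λ g → Σ[ i ∈ Fin n ] (i ∈' H × perm i ≈ g)
            ; member? = λ g → Fin.any? (λ i → (i ∈?' H) ×-dec Fin.all? (λ x → perm i ⟨$⟩ʳ x Fin.≟ g ⟨$⟩ʳ x))
            ; resp = λ g≈h (i , i∈ , e) → i , i∈ , λ x → trans (e x) (g≈h x)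
            ; id-closed = ε , ε∈ H , perm-ε
            ; ∘-closed = λ {g} {h} (i , i∈ , e) (j , j∈ , e') → j ∙ i , ∙∈ H j∈ i∈ , λ x → trans (perm-∙ j i x) (trans (cong (perm j ⟨$⟩ʳ_) (e x)) (e' _))
            ; inv-closed = λ {g} (i , i∈ , e) → i ⁻¹ , ⁻¹∈ H i∈ , λ x → trans (perm-⁻¹ i x) (flip-≈ {perm i} {g} e x) }
            where
            flip-≈ : ∀ {g h : Permutation′ v} → g ≈ h → ∀ x → g ⟨$⟩ˡ x ≡ h ⟨$⟩ˡ x
            flip-≈ {g} {h} e x = trans (cong (g ⟨$⟩ˡ_) (trans (sym (Perm.inverseʳ h)) (sym (e _)))) (Perm.inverseˡ g)

          toSub : PermGroup v → Sub
          toSub M = record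
            { set = mk (λ i → member? (perm i)) ; ε∈ = resp (λ x → sym (perm-ε x)) id-closed
            ; ∙∈ = λ {i} {j} p q → resp (λ x → sym (perm-∙ i j x)) (∘-closed q p)
            ; ⁻¹∈ = λ {i} p → resp (λ x → sym (perm-⁻¹ i x)) (inv-closed p) }
            where open PermGroup M

          perm-▷ : ∀ i j x → perm (i ▷ j) ⟨$⟩ʳ x ≡ (flip (perm i) ∘ₚ perm j ∘ₚ perm i) ⟨$⟩ʳ x
          perm-▷ i j x = trans (perm-∙ (i ∙ j) (i ⁻¹) x) (trans (perm-∙ i j _) (cong (λ z → perm i ⟨$⟩ʳ (perm j ⟨$⟩ʳ z)) (perm-⁻¹ i x)))

          conj-≈ : ∀ {g g' m m' : Permutation′ v} → g ≈ g' → m ≈ m' → (flip g ∘ₚ m ∘ₚ g) ≈ (flip g' ∘ₚ m' ∘ₚ g')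
          conj-≈ {g} {g'} {m} {m'} e e' x = trans (e _) (cong (g' ⟨$⟩ʳ_) (trans (e' _) (cong (m' ⟨$⟩ʳ_)
            (trans (cong (g ⟨$⟩ˡ_) (trans (sym (Perm.inverseʳ g')) (sym (e _)))) (Perm.inverseˡ g)))))

          toPerm∈G : ∀ H → toPerm H ⊆ᴳ Gᵖ
          toPerm∈G H (i , _ , e) = PermGroup.resp Gᵖ e (perm∈ i)

          toPerm-⊴ : ∀ {H} → Invariant H → toPerm H ⊴ Gᵖ
          toPerm-⊴ {H} inv = toPerm∈G H , λ {g} {m} g∈ (j , j∈ , e) → let i , i≈ = find g g∈ in
            i ▷ j , inv i j j∈ , λ x → trans (perm-▷ i j x) (conj-≈ {perm i} {g} {perm j} {m} i≈ e x)

          toSub-invariant : ∀ M → M ⊴ Gᵖ → Invariant (toSub M)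
          toSub-invariant M (_ , nrm) i j j∈ = PermGroup.resp M (λ x → sym (perm-▷ i j x)) (nrm (perm∈ i) j∈)

          toPerm-nontrivial : ∀ {H} → ¬ IsTrivial H → ¬ Trivial (toPerm H)
          toPerm-nontrivial nt t = nt λ i i∈ → perm-ext λ x → trans (t {perm i} (i , i∈ , λ _ → refl) x) (sym (perm-ε x))

          toSub-trivial : ∀ M → M ⊆ᴳ Gᵖ → IsTrivial (toSub M) → Trivial M
          toSub-trivial M M⊆ t {g} g∈ x = let i , i≈ = find g (M⊆ g∈) in
            trans (sym (i≈ x)) (trans (cong (λ i → perm i ⟨$⟩ʳ x) (t i (PermGroup.resp M (λ y → sym (i≈ y)) g∈))) (perm-ε x))

          toPerm-⊆ : ∀ M H → H ⊆' toSub M → toPerm H ⊆ᴳ M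
          toPerm-⊆ M H le (i , i∈ , e) = PermGroup.resp M e (le i i∈)

          toSub⊆ : ∀ M H → M ⊆ᴳ toPerm H → toSub M ⊆' H
          toSub⊆ M H le i i∈ = let j , j∈ , e = le i∈ in ∈-cong H (perm-ext e) j∈

          -- A minimal normal subgroup, found by searching all subsets

          IsNormal : Subset n → Set
          IsNormal S = (∀ x y → x ∈ₛ S → y ∈ₛ S → x ∙ y ∈ₛ S) × (∀ x → x ∈ₛ S → x ⁻¹ ∈ₛ S) × (∀ g x → x ∈ₛ S → g ▷ x ∈ₛ S) × (Σ[ x ∈ Fin n ] (x ∈ₛ S × x ≢ ε))

          isNormal? : ∀ S → Dec (IsNormal S)
          isNormal? S = Fin.all? (λ x → Fin.all? (λ y → (x ∈? S) →-dec ((y ∈? S) →-dec (x ∙ y ∈? S)))) ×-dec (Fin.all? (λ x → (x ∈? S) →-dec (x ⁻¹ ∈? S)) ×-dec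
            (Fin.all? (λ g → Fin.all? (λ x → (x ∈? S) →-dec (g ▷ x ∈? S))) ×-dec Fin.any? (λ x → (x ∈? S) ×-dec ¬? (x Fin.≟ ε))))

          smallest : ∀ m S → IsNormal S → card S ≤ m → Σ[ S ∈ Subset n ] (IsNormal S × ∀ S' → IsNormal S' → card S ≤ card S')
          smallest m S nS le with anySubset? (λ S' → isNormal? S' ×-dec (card S' <? card S))
          smallest m S nS le | no none = S , nS , λ S' nS' → ≮⇒≥ (λ lt → none (S' , nS' , lt))
          smallest zero S nS le | yes (S' , nS' , lt) = ⊥-elim (<⇒≱ lt (≤-trans le z≤n))
          smallest (suc m) S nS le | yes (S' , nS' , lt) = smallest m S' nS' (s≤s⁻¹ (≤-trans lt le))

          G-nontrivial : Σ[ x ∈ Fin n ] x ≢ ε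
          G-nontrivial = let β , _ , ne = #>1 (full {v}) α refl (subst (1 <_) (sym (#-full v)) (<-trans 2≤k k<v)) ; g , e = G-transitive α β in
            g , λ g≡ε → ne (trans (sym e) (trans (cong (λ t → act t α) g≡ε) (act-ε α)))

          record MinimalSub : Set₁ where
            field
              N    : Sub
              inv  : Invariant N
              N-nt : ¬ IsTrivial N
              minN : ∀ M → Invariant M → M ⊆' N → ¬ IsTrivial M → N ⊆' M

          minimalSub : MinimalSub
          minimalSub = record { N = N ; inv = proj₁ (proj₂ (proj₂ nS)) ; N-nt = λ t → let x , x∈ , ne = proj₂ (proj₂ (proj₂ nS)) in ne (t x x∈)
            ; minN = λ M inv M⊆ nt → ⊆∧≥⇒⊇ {M} {N} M⊆ (subst₂ _≤_ (∣subset∣ S) (trans (∣subset∣ (subset (set M)))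
                 (#-cong (mk (_∈? subset (set M))) (set M) (λ _ → ∈subset⁻ (set M)) (λ _ → ∈subset⁺ (set M)))) (min (subset (set M)) (normal M inv nt))) }
            where
            normal : ∀ M → Invariant M → ¬ IsTrivial M → IsNormal (subset (set M))
            normal M inv nt = (λ x y p q → ∈subset⁺ (set M) (∙∈ M (∈subset⁻ (set M) p) (∈subset⁻ (set M) q))) , (λ x p → ∈subset⁺ (set M) (⁻¹∈ M (∈subset⁻ (set M) p))) ,
              (λ g x p → ∈subset⁺ (set M) (inv g x (∈subset⁻ (set M) p))) , (let x , x∈ , ne = witness {M} nt in x , ∈subset⁺ (set M) x∈ , ne)
            best : Σ[ S ∈ Subset n ] (IsNormal S × ∀ S' → IsNormal S' → card S ≤ card S')
            best = smallest (card (subset (set whole))) (subset (set whole)) (normal whole (λ _ _ _ → refl) (λ t → proj₂ G-nontrivial (t _ refl))) ≤-refl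
            S : Subset n
            S = proj₁ best
            nS : IsNormal S
            nS = proj₁ (proj₂ best)
            min : ∀ S' → IsNormal S' → card S ≤ card S'
            min = proj₂ (proj₂ best)
            N : Sub
            N = record { set = mk (_∈? S) ; ε∈ = let x , x∈ , _ = proj₂ (proj₂ (proj₂ nS)) in subst (_∈ₛ S) (inverseˡ x) (proj₁ nS _ _ (proj₁ (proj₂ nS) x x∈) x∈)
                       ; ∙∈ = proj₁ nS _ _ ; ⁻¹∈ = proj₁ (proj₂ nS) _ }

          perm-pow : ∀ i p x → power (perm i) p ⟨$⟩ʳ x ≡ perm (pow i p) ⟨$⟩ʳ x
          perm-pow i zero x = sym (perm-ε x)
          perm-pow i (suc p) x = trans (perm-pow i p _) (trans (sym (perm-∙ (pow i p) i x)) (cong (λ t → perm t ⟨$⟩ʳ x) (pow-suc p)))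
            where
            pow-suc : ∀ p → pow i p ∙ i ≡ pow i (suc p)
            pow-suc zero = trans (identityˡ i) (sym (identityʳ i))
            pow-suc (suc p) = trans (assoc i (pow i p) i) (cong (i ∙_) (pow-suc p))

          power-cong : ∀ {g h : Permutation′ v} → g ≈ h → ∀ p x → power g p ⟨$⟩ʳ x ≡ power h p ⟨$⟩ʳ x
          power-cong e zero x = refl
          power-cong {g} {h} e (suc p) x = trans (power-cong {g} {h} e p _) (cong (power h p ⟨$⟩ʳ_) (e x))

          module Maximal (prim : ∀ L → (∀ g x → g ∈' St → x ∈' L → g ▷ x ∈' L) → L ⊆' St ⊎ TransitiveOn L α) (MS : MinimalSub) where
            open MinimalSub MS

            affine : CommuteWith N N → AffineType Gᵖ
            affine ab = toPerm N , toPerm-⊴ {N} inv ,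
                ((λ {g} {h} (i , i∈ , e) (j , j∈ , e') x → trans (cong (h ⟨$⟩ʳ_) (sym (e x))) (trans (sym (e' _)) (trans (sym (perm-∙ j i x))
                    (trans (cong (λ t → perm t ⟨$⟩ʳ x) (ab j i j∈ i∈)) (trans (perm-∙ i j x) (trans (cong (perm i ⟨$⟩ʳ_) (e' x)) (e _))))))) ,
                 p , pr , λ {g} (i , i∈ , e) x → trans (power-cong {g} {perm i} (λ y → sym (e y)) p x) (trans (perm-pow i p x) (trans (cong (λ t → perm t ⟨$⟩ʳ x) (ep i i∈)) (perm-ε x)))) ,
                (λ x y → let m , m∈ , e = tr x ; m' , m'∈ , e' = tr y in perm (m' ∙ m ⁻¹) , (m' ∙ m ⁻¹ , ∙∈ N m'∈ (⁻¹∈ N m∈) , λ _ → refl) ,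
                    trans (sym (perm-act _ x)) (trans (act-∙ _ _ x) (trans (cong (act m') (trans (cong (act (m ⁻¹)) (sym e)) (act⁻¹ m α))) e'))) ,
                λ {g} (i , i∈ , e) x fix y → trans (sym (e y)) (trans (cong (λ t → perm t ⟨$⟩ʳ y)
                    (PrimitiveCase.semiregular prim N tr i (λ z z∈ → ab i z i∈ z∈) x (trans (perm-act i x) (trans (e x) fix)))) (perm-ε y))
              where
              tr : TransitiveOn N α
              tr = PrimitiveCase.transN prim N inv N-nt minN
              el = PrimitiveCase.elementary prim N inv N-nt minN ab
              p : ℕ
              p = proj₁ el
              pr = proj₁ (proj₂ el)
              ep : ∀ x → x ∈' N → pow x p ≡ ε
              ep = proj₂ (proj₂ el)

            almostSimple : NonAbelian N → AlmostSimpleType Gᵖ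
            almostSimple nonab = toPerm N , (contains , least) , (toPerm-nontrivial {N} N-nt , normal-subs) , λ ab → nonab λ i j i∈ j∈ → perm-ext λ x →
                trans (perm-∙ i j x) (trans (ab {perm j} {perm i} (j , j∈ , λ _ → refl) (i , i∈ , λ _ → refl) x) (sym (perm-∙ j i x)))
              where
              N-simple : IsSimple N
              N-simple = PrimitiveCase.simple prim N inv N-nt minN nonab
              normal-subs : ∀ M → M ⊴ toPerm N → Trivial M ⊎ toPerm N ⊆ᴳ M
              normal-subs M (M⊆ , nrm) with trivial? (toSub M)
              ... | yes t = inj₁ (toSub-trivial M (λ p → toPerm∈G N (M⊆ p)) t)
              ... | no nt = inj₂ (toPerm-⊆ M N (N-simple (toSub M) (toSub⊆ M N M⊆ , λ g x g∈ x∈ → PermGroup.resp M (λ y → sym (perm-▷ g x y)) (nrm {perm g} {perm x} (g , g∈ , λ _ → refl) x∈)) nt))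
              N-minimal : MinimalNormal (toPerm N) Gᵖ
              N-minimal = toPerm-⊴ {N} inv , toPerm-nontrivial {N} N-nt , λ M M⊴ M⊆ → go M M⊴ M⊆ (trivial? (toSub M))
                where
                go : ∀ M → M ⊴ Gᵖ → M ⊆ᴳ toPerm N → Dec (IsTrivial (toSub M)) → Trivial M ⊎ toPerm N ⊆ᴳ M
                go M M⊴ M⊆ (yes t) = inj₁ (toSub-trivial M (proj₁ M⊴) t)
                go M M⊴ M⊆ (no nt) = inj₂ (toPerm-⊆ M N (minN (toSub M) (toSub-invariant M M⊴) (toSub⊆ M N M⊆) nt))
              least : ∀ H → (∀ M → MinimalNormal M Gᵖ → M ⊆ᴳ H) → toPerm N ⊆ᴳ H
              least H h = h (toPerm N) N-minimal
              -- If M meets N trivially, it centralises N and is trivial, because C_G(N) = 1.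
              -- Otherwise minimality of N gives N ≤ M, and minimality of M gives equality.
              contains : ∀ M → MinimalNormal M Gᵖ → M ⊆ᴳ toPerm N
              contains M (M⊴ , M-nt , M-min) = go (trivial? (toSub M ⊓ N))
                where
                M' : Sub
                M' = toSub M
                M'-inv : Invariant M'
                M'-inv = toSub-invariant M M⊴
                choose : Trivial (toPerm N) ⊎ M ⊆ᴳ toPerm N → M ⊆ᴳ toPerm N
                choose (inj₁ t) = ⊥-elim (toPerm-nontrivial {N} N-nt (λ {g} → t {g}))
                choose (inj₂ le) = le
                go : Dec (IsTrivial (M' ⊓ N)) → M ⊆ᴳ toPerm N
                go (yes t) = ⊥-elim (M-nt (toSub-trivial M (proj₁ M⊴) λ x x∈ → PrimitiveCase.centralizer-trivial prim N inv N-nt minN nonab x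
                  (refl , λ y y∈ → disjoint⇒commute {M'} {N} {whole} ((λ _ _ → refl) , λ g y _ → M'-inv g y) ((λ _ _ → refl) , λ g y _ → inv g y) t x y x∈ y∈)))
                go (no nt) = choose (M-min (toPerm N) (toPerm-⊴ {N} inv)
                  (toPerm-⊆ M N λ x x∈ → proj₁ (minN (M' ⊓ N) (λ g y (p , q) → M'-inv g y p , inv g y q) (λ _ → proj₂) nt x x∈)))

            type : AffineType Gᵖ ⊎ AlmostSimpleType Gᵖ
            type with Fin.all? (λ x → Fin.all? (λ y → (x ∈?' N) →-dec ((y ∈?' N) →-dec (x ∙ y Fin.≟ y ∙ x))))
            ... | yes ab = inj₁ (affine ab)
            ... | no nonab = inj₂ (almostSimple nonab)

          result : (Primitive Gᵖ × (AffineType Gᵖ ⊎ AlmostSimpleType Gᵖ))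
            ⊎ (Imprimitive Gᵖ × (v , k , l) ≡ (l ^ 2 * (l + 2) , l * (l + 1) , l)
              × (∀ c d (S : SystemOfImprimitivity Gᵖ c d) →
                   ∃[ ℓ ] ((∀ B → B ∈ blocks D → ∀ i → card (B ∩ class S i) ≡ 0 ⊎ card (B ∩ class S i) ≡ ℓ)
                           × ((c , d , ℓ) ≡ (l ^ 2 , l + 2 , l) ⊎ (c , d , ℓ) ≡ (l + 2 , l ^ 2 , 2)))))
          result with anySubset? isBlock?
          ... | yes (S , isB) = inj₂ ((transitive , _ , _ , system) , FromSystem.parameters-λ system ,
                  λ c d S' → FromSystem.K.ℓ S' , FromSystem.intersections S' , FromSystem.triple S')
            where open FromBlock S isB using (system)
          ... | no none = inj₁ ((transitive , λ c d S → none (_ , system⇒block S)) , Maximal.type (no-block⇒maximal none) minimalSub)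

-- The given design as a flag-transitive incidence structure

open import Data.Fin.Subset using (∣_∣)
open import Data.Integer as ℤ using (+_)
import Data.Integer.Properties as ℤ
import Data.Integer.Tactic.RingSolver as ℤ-Solver

ℤ-large : ∀ l k → (+ l) ℤ.* ((+ l) ℤ.- (+ 2)) ℤ.< (+ k) → l * l < k + 2 * l
ℤ-large l k h = ℤ.drop‿+<+ (subst₂ ℤ._<_ (trans (lem (+ l)) (sym (ℤ.pos-* l l))) (cong (ℤ._+_ (+ k)) (sym (ℤ.pos-* 2 l))) (ℤ.+-monoˡ-< (+ 2 ℤ.* + l) h))
  where
  lem : ∀ x → x ℤ.* (x ℤ.- + 2) ℤ.+ + 2 ℤ.* x ≡ x ℤ.* x
  lem = ℤ-Solver.solve-∀

module _ {v k l : ℕ} (D : Design v k l) (sym-D : Symmetric D) (large : l * l < k + 2 * l)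
         (G : PermGroup v) (flag : FlagTransitive D G) where
  open Design D using (block-size; pair-blocks; 2≤k; k<v; 1≤λ)

  block : Fin v → Subset v
  block j = List.lookup (blocks D) (cast (sym sym-D) j)

  block∈ : ∀ j → block j ∈ blocks D
  block∈ j = ∈-lookup {xs = blocks D} (cast (sym sym-D) j)

  block-of : ∀ B → B ∈ blocks D → Σ[ j ∈ Fin v ] block j ≡ B
  block-of B B∈ = cast sym-D (position B∈) ,
    trans (cong (List.lookup (blocks D)) (Fin.cast-involutive (sym sym-D) sym-D (position B∈))) (sym (lookup-index B∈))

  flagDesign : (R : Realisation G) → FlagDesign v k l (Realisation.group R) (Realisation.action R)
  flagDesign R = record
    { I? = λ x B → x ∈? block B
    ; block-size = λ B → trans (sym (∣subset∣ (block B))) (block-size (block∈ B))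
    ; pair-blocks = λ ne → trans (sym (length-filter _ (blocks D) (sym sym-D))) (pair-blocks ne)
    ; 2≤k = 2≤k ; k<v = k<v ; 1≤l = 1≤λ ; large = large
    ; flag = λ {x} {y} {B} {C} xB yC →
        let g , g∈ , gx , gB = flag (block∈ B) xB (block∈ C) yC
            i , i≈ = Realisation.index R g g∈
            eq : ∀ z → Action.act (Realisation.action R) i z ≡ g ⟨$⟩ʳ z
            eq z = trans (Realisation.perm-act R i z) (i≈ z)
        in i , trans (eq x) gx ,
           (λ z zB → subst₂ _∈ₛ_ (sym (eq z)) gB (∈image⁺ g (block B) zB)) ,
           (λ z zC → ∈image⁻ g (block B) (subst₂ _∈ₛ_ (eq z) (sym gB) zC)) }

mainTheorem1 : ∀ (v k λ′ : ℕ) (D : Design v k λ′) → Symmetric D →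
    (+ λ′) ℤ.* ((+ λ′) ℤ.- (+ 2)) ℤ.< (+ k) →
    ∀ (G : PermGroup v) → IsAutomorphismGroup D G → FlagTransitive D G →
    (Primitive G × (AffineType G ⊎ AlmostSimpleType G))
    ⊎
    (Imprimitive G
    × (v , k , λ′) ≡ (λ′ ^ 2 * (λ′ + 2) , λ′ * (λ′ + 1) , λ′)
    × (∀ c d (S : SystemOfImprimitivity G c d) →
    ∃[ ℓ ] ((∀ B → B ∈ blocks D → ∀ i →
    ∣ B ∩ class S i ∣ ≡ 0 ⊎ ∣ B ∩ class S i ∣ ≡ ℓ)
    × ((c , d , ℓ) ≡ (λ′ ^ 2 , λ′ + 2 , λ′)
    ⊎ (c , d , ℓ) ≡ (λ′ + 2 , λ′ ^ 2 , 2)))))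
mainTheorem1 v k λ′ D sym-D large G _ flag =
    GroupTheory.Orbits.Structure.Counting.Translation.result R.group R.action α (flagDesign D sym-D (ℤ-large λ′ k large) G flag R)
      G R.perm R.perm-act R.perm∈ R.index D (block D sym-D (ℤ-large λ′ k large) G flag) id id (block-of D sym-D (ℤ-large λ′ k large) G flag)
  where
  R : Realisation G
  R = realise G
  module R = Realisation R
  α : Fin v
  α = fromℕ< (≤-trans (s≤s z≤n) (Design.k<v D))
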